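{- The following hold: (1) If $p$ is a prime with $p\equiv 5\pmod 8$, then $64p\in S(16)$; (2) If $p$ is a prime with $p\equiv 3 \pmod 8$, then $64p^2\in S(16)$; (3) If $p$ is a prime with $p = a^2+b^2\equiv 1\pmod 8$ for integers $a,b$ such that both $a+b$ and $a-b$ lie in $\{8m\pm 3\mid m\in\mathbb{Z}\}$, then $64p\in S(16)$.
   Context: $S(16)$ is the set of all values $D(a_0,\dots,a_{15})$ with $a_i\in\mathbb{Z}$, where $D(a_0,\dots,a_{15})$ is the determinant of the $16\times16$ circulant matrix whose $(i,j)$ entry ($0\le i,j\le15$) is $a_{(i-j)\bmod 16}$. -}

module Defs where

open import Data.Nat using (ℕ; zero; suc)
open import Data.Fin using (Fin; zero; suc; toℕ; punchIn; fromℕ<)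
open import Data.Integer using (ℤ; +_; _+_; _-_; _*_; -_)
open import Data.Product using (Σ; ∃; _,_)
open import Data.Sum using (_⊎_)
open import Data.Nat.DivMod using (_%_)
open import Relation.Binary.PropositionalEquality using (_≡_)

sumFin : (n : ℕ) → (Fin n → ℤ) → ℤ
sumFin zero    f = + 0
sumFin (suc n) f = f zero + sumFin n (λ i → f (suc i))

sign : ℕ → ℤ
sign zero = + 1
sign (suc k) = - sign k

minor : {n : ℕ} → (Fin (suc n) → Fin (suc n) → ℤ) → Fin (suc n) → Fin n → Fin n → ℤ
minor M j r c = M (suc r) (punchIn j c)

det : (n : ℕ) → (Fin n → Fin n → ℤ) → ℤ
det zero    M = + 1
det (suc n) M = sumFin (suc n) (λ j → sign (toℕ j) * (M zero j * det n (minor M j)))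

subMod16 : Fin 16 → Fin 16 → Fin 16
subMod16 i j = fromℕ< (Data.Nat.DivMod.m%n<n (16 Data.Nat.+ toℕ i Data.Nat.∸ toℕ j) 16)
  where import Data.Nat
        import Data.Nat.DivMod

circulant16 : (Fin 16 → ℤ) → Fin 16 → Fin 16 → ℤ
circulant16 a i j = a (subMod16 i j)

D16 : (Fin 16 → ℤ) → ℤ
D16 a = det 16 (circulant16 a)

InS16 : ℤ → Set
InS16 x = Σ (Fin 16 → ℤ) (λ a → D16 a ≡ x)

Is8m±3 : ℤ → Set
Is8m±3 x = ∃ λ (m : ℤ) → (x ≡ + 8 * m + + 3) ⊎ (x ≡ + 8 * m - + 3)

{-# OPTIONS --safe #-}

-- Write F = Σ aᵢxⁱ. Adding and subtracting the two halves of a circulant matrix gives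
-- D(F) = F(1) F(-1) |F(i)|² N(F(ζ)) N(F(ζ₁₆)), where ζ is a primitive 8th root of unity.
-- Adding multiples of (x¹⁶ - 1)/(x² + 1) to F changes F(i) by arbitrary multiples of 8 and no other factor, so that
-- 64p is obtained for p ≡ 5 (mod 8) from F = 1 - x³ + x⁸ + x¹² and p = a² + b², via F(i) = (a - b) + (a + b)i.
-- Likewise F(ζ) can be changed modulo 4 by multiples of (x¹⁶ - 1)/(x⁴ + 1); starting from F = 1 + x + x² + x⁸ one obtains
-- 64 N(α) for all α in ℤ[ζ] whose norm A + Bi down to ℤ[i] satisfies A ± B ≡ ±3 (mod 8), since such α are,
-- up to conjugation and a factor of norm 2, in the required class modulo 4. For p ≡ 3 (mod 8) take
-- α = x + y√-2 with p = x² + 2y²; for p ≡ 1 (mod 8) take α of norm p, which exists because Siegel's lemma gives α of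
-- norm kp with k < 16, and then k can be removed; here A + Bi and a + bi agree up to conjugation and units.
module Submission where

open import Defs
open import Data.Nat as ℕ using (ℕ; zero; suc; s≤s; z≤n; _!)
import Data.Nat.Properties as ℕ
import Data.Nat.Divisibility as ℕ
open import Data.Nat.Coprimality using (prime⇒coprime; coprime-Bézout)
open import Data.Nat.DivMod using (_%_; _/_; m≡m%n+[m/n]*n)
open import Data.Nat.GCD using (module Bézout)
open import Data.Nat.ListAction using (product)
open import Data.Nat.ListAction.Properties using (product-↭)
open import Data.Nat.Primality using (Prime; euclidsLemma; prime⇒irreducible; prime⇒nonZero; ¬prime[1]; prime[2])
open import Data.Nat.Induction using (<-rec)
open import Data.Nat.Tactic.RingSolver using () renaming (solve-∀ to ℕ-solve-∀)
open import Data.Fin as Fin using (Fin; zero; suc; toℕ; punchIn; _↑ˡ_; _↑ʳ_; splitAt; fromℕ<; finToFun; funToFin)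
import Data.Fin.Properties as Fin
open import Data.Integer using (ℤ; +_; -[1+_]; +[1+_]; _+_; _-_; _*_; -_; 0ℤ; 1ℤ; -1ℤ; _≟_; _%ℕ_; _/ℕ_; ∣_∣; _^_)
open import Data.Integer.Properties using (+-comm; +-assoc; +-identityˡ; +-identityʳ; +-injective; *-comm; *-identityˡ; *-identityʳ; *-zeroʳ; *-distribˡ-+; *-cancelˡ-≡; -1*i≡-i; i-j≡0⇒i≡j; ∣i∣≡0⇒i≡0; abs-*; pos-+; pos-*; m-n≡m⊖n; ∣m⊝n∣≤m⊔n; ^-zeroˡ; ^-*-assoc; ^-distribˡ-+-*)
open import Data.Integer.DivMod using (n%ℕd<d; a≡a%ℕn+[a/ℕn]*n)
open import Data.Integer.Divisibility.Signed using (_∣_; divides; _∣?_; ∣⇒∣ᵤ; ∣ᵤ⇒∣; ∣m∣n⇒∣m+n; ∣m+n∣n⇒∣m; ∣m⇒∣m*n; ∣n⇒∣m*n; ∣m⇒∣-m)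
open import Data.Integer.Tactic.RingSolver using (solve-∀)
open import Data.List using (List; []; _∷_; _++_; [_]; length; map; downFrom)
open import Data.List.Properties using (length-map; length-downFrom)
open import Data.List.Membership.Propositional using (_∈_)
open import Data.List.Membership.Propositional.Properties using (∈-∃++; ∈-map⁺; ∈-map⁻; ∈-downFrom⁺; ∈-downFrom⁻)
open import Data.List.Relation.Unary.All as All using (All)
open import Data.List.Relation.Unary.AllPairs using ([]; _∷_)
open import Data.List.Relation.Unary.Any using (here; there)
open import Data.List.Relation.Unary.Unique.Propositional using (Unique)
import Data.List.Relation.Unary.Unique.Propositional.Properties as Unique
open import Data.List.Relation.Binary.Permutation.Propositional using (_↭_; prep; ↭-sym; ↭⇒↭ₛ)
open import Data.List.Relation.Binary.Permutation.Propositional.Properties using (∈-resp-↭; ↭-length) renaming (shift to ↭-shift)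
import Data.List.Relation.Binary.Permutation.Setoid.Properties as Permutation
open import Data.Product using (∃; ∃₂; _×_; _,_; proj₁; proj₂)
open import Data.Sum as Sum using (_⊎_; inj₁; inj₂; [_,_]′)
open import Data.Vec using (Vec; []; _∷_; zipWith; head; replicate; lookup)
import Data.Vec.Properties as Vec
open import Data.Vec.Functional using (updateAt)
import Data.Vec.Functional.Properties as Vector
open import Function using (_∘_; flip; const)
open import Relation.Binary.Definitions using (tri<; tri≈; tri>)
open import Relation.Nullary using (Dec; ¬_; contradiction; yes; no; ¬?)
open import Relation.Nullary.Decidable using (decidable-stable; from-yes; toWitnessFalse; _×-dec_; _⊎-dec_; _→-dec_)
open import Relation.Binary.PropositionalEquality hiding ([_])
open ≡-Reasoning

-- Determinants

-- In both families the four factors without parameters multiply to 32, so the varied factor has to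
-- be 2p or 2p². The extra 2 is the norm of 1 + i in ℤ[i], and of an associate of 1 + ζ or 1 + ζ³ in
-- ℤ[ζ]. The moduli 8 and 4 are the absolute values of (x¹⁶ - 1)/(x² + 1) at i and of (x¹⁶ - 1)/(x⁴
-- + 1) at ζ. The need for two families comes from the congruence class of the first: up to order
-- and signs its values at i are u + vi with u ≡ 3 and v ≡ 1 (mod 8). For p ≡ 5 (mod 8) this is
-- automatic, because u² + v² = 2p ≡ 10 (mod 16) and odd squares are 1 or 9 modulo 16. In the other
-- two cases the coordinates of (1 + i)p, respectively of (1 + i)(a + bi), are both ≡ ±3 (mod 8),
-- outside that class, and the factor at ζ has to be varied instead.

Matrix : ℕ → Set
Matrix n = Fin n → Fin n → ℤ

sumFin-cong : ∀ n {f g : Fin n → ℤ} → (∀ i → f i ≡ g i) → sumFin n f ≡ sumFin n g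
sumFin-cong zero    f≡g = refl
sumFin-cong (suc n) f≡g = cong₂ _+_ (f≡g zero) (sumFin-cong n (f≡g ∘ suc))

sumFin-0 : ∀ n {f : Fin n → ℤ} → (∀ i → f i ≡ 0ℤ) → sumFin n f ≡ 0ℤ
sumFin-0 zero    f≡0 = refl
sumFin-0 (suc n) f≡0 = cong₂ _+_ (f≡0 zero) (sumFin-0 n (f≡0 ∘ suc))

sumFin-+ : ∀ n (f g : Fin n → ℤ) → sumFin n (λ i → f i + g i) ≡ sumFin n f + sumFin n g
sumFin-+ zero    f g = refl
sumFin-+ (suc n) f g = begin
  f zero + g zero + sumFin n (λ i → f (suc i) + g (suc i))            ≡⟨ cong (λ x → f zero + g zero + x) (sumFin-+ n (f ∘ suc) (g ∘ suc)) ⟩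
  f zero + g zero + (sumFin n (f ∘ suc) + sumFin n (g ∘ suc))         ≡⟨ interchange (f zero) (g zero) (sumFin n (f ∘ suc)) (sumFin n (g ∘ suc)) ⟩
  f zero + sumFin n (f ∘ suc) + (g zero + sumFin n (g ∘ suc))         ∎
  where
  interchange : ∀ a b c d → a + b + (c + d) ≡ a + c + (b + d)
  interchange = solve-∀

sumFin-* : ∀ n c (f : Fin n → ℤ) → sumFin n (λ i → c * f i) ≡ c * sumFin n f
sumFin-* zero    c f = sym (*-zeroʳ c)
sumFin-* (suc n) c f = trans (cong (λ x → c * f zero + x) (sumFin-* n c (f ∘ suc))) (sym (*-distribˡ-+ c (f zero) _))

sumFin-swap : ∀ m n (f : Fin m → Fin n → ℤ) →
  sumFin m (λ i → sumFin n (f i)) ≡ sumFin n (λ j → sumFin m (λ i → f i j))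
sumFin-swap zero    n f = sym (sumFin-0 n (λ _ → refl))
sumFin-swap (suc m) n f = trans (cong (λ x → sumFin n (f zero) + x) (sumFin-swap m n (f ∘ suc)))
                                (sym (sumFin-+ n (f zero) (λ j → sumFin m (λ i → f (suc i) j))))

sumFin-↑ : ∀ m n (f : Fin (m ℕ.+ n) → ℤ) →
  sumFin (m ℕ.+ n) f ≡ sumFin m (λ i → f (i ↑ˡ n)) + sumFin n (λ j → f (m ↑ʳ j))
sumFin-↑ zero    n f = sym (+-identityˡ _)
sumFin-↑ (suc m) n f = trans (cong (λ x → f zero + x) (sumFin-↑ m n (f ∘ suc))) (sym (+-assoc (f zero) _ _))

det-cong : ∀ n {M N : Matrix n} → (∀ i j → M i j ≡ N i j) → det n M ≡ det n N
det-cong zero    M≡N = refl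
det-cong (suc n) M≡N = sumFin-cong (suc n) λ j →
  cong₂ (λ x d → sign (toℕ j) * (x * d)) (M≡N zero j) (det-cong n λ r c → M≡N (suc r) (punchIn j c))

-- Expanding along the first row and then along the first column is symmetric in rows and columns.
det-flip : ∀ n (M : Matrix n) → det n M ≡ det n (flip M)
det-flip zero          M = refl
det-flip (suc zero)    M = refl
det-flip (suc (suc n)) M = cong₂ _+_ (cong (λ d → 1ℤ * (M zero zero * d)) (det-flip (suc n) (minor M zero))) (begin
  sumFin (suc n) (λ j → - s j * (M zero (suc j) * det (suc n) (minor M (suc j))))    ≡⟨ expand (det-flip (suc n)) M ⟩
  sumFin (suc n) (λ j → sumFin (suc n) (term M j))                                  ≡⟨ sumFin-swap (suc n) (suc n) (term M) ⟩
  sumFin (suc n) (λ i → sumFin (suc n) (λ j → term M j i))                          ≡⟨ sumFin-cong (suc n) (λ i → sumFin-cong (suc n) (λ j → term-flip j i)) ⟩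
  sumFin (suc n) (λ i → sumFin (suc n) (term (flip M) i))                           ≡⟨ expand (det-flip (suc n)) (flip M) ⟨
  sumFin (suc n) (λ i → - s i * (M (suc i) zero * det (suc n) (minor (flip M) (suc i)))) ∎)
  where
  s : ∀ {m} → Fin m → ℤ
  s j = sign (toℕ j)

  column : Matrix (suc (suc n)) → Fin (suc n) → Fin (suc n) → ℤ
  column N j i = s i * (N (suc i) zero * det n (λ c r → N (suc (punchIn i r)) (suc (punchIn j c))))

  term : Matrix (suc (suc n)) → Fin (suc n) → Fin (suc n) → ℤ
  term N j i = - s j * (N zero (suc j) * column N j i)

  expand : (∀ N → det (suc n) N ≡ det (suc n) (flip N)) → ∀ N →
           sumFin (suc n) (λ j → - s j * (N zero (suc j) * det (suc n) (minor N (suc j)))) ≡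
           sumFin (suc n) (λ j → sumFin (suc n) (term N j))
  expand ih N = sumFin-cong (suc n) λ j → begin
    - s j * (N zero (suc j) * det (suc n) (minor N (suc j)))
      ≡⟨ cong (λ d → - s j * (N zero (suc j) * d)) (ih (minor N (suc j))) ⟩
    - s j * (N zero (suc j) * sumFin (suc n) (column N j))
      ≡⟨ cong (λ x → - s j * x) (sumFin-* (suc n) (N zero (suc j)) (column N j)) ⟨
    - s j * sumFin (suc n) (λ i → N zero (suc j) * column N j i)
      ≡⟨ sumFin-* (suc n) (- s j) (λ i → N zero (suc j) * column N j i) ⟨
    sumFin (suc n) (term N j) ∎

  term-flip : ∀ j i → term M j i ≡ term (flip M) i j
  term-flip j i = trans (cong (λ d → - s j * (M zero (suc j) * (s i * (M (suc i) zero * d)))) (det-flip n (λ c r → M (suc (punchIn i r)) (suc (punchIn j c)))))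
                        (rearrange (s j) (M zero (suc j)) (s i) (M (suc i) zero) _)
    where
    rearrange : ∀ a x b y d → - a * (x * (b * (y * d))) ≡ - b * (y * (a * (x * d)))
    rearrange = solve-∀

-- Stated for three matrices compared entrywise. If `k` is zero the minors of all three coincide;
-- otherwise the first rows do, and the minors are again linear in one row.
det-row-linear : ∀ n (k : Fin n) c (M N P : Matrix n) →
  (∀ j → P k j ≡ M k j + c * N k j) →
  (∀ i → i ≢ k → ∀ j → M i j ≡ P i j) → (∀ i → i ≢ k → ∀ j → N i j ≡ P i j) →
  det n P ≡ det n M + c * det n N
det-row-linear (suc n) k c M N P Pk≡ M≡P N≡P = begin
  sumFin (suc n) (summand P)
    ≡⟨ sumFin-cong (suc n) (λ j → termwise k j Pk≡ M≡P N≡P) ⟩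
  sumFin (suc n) (λ j → summand M j + c * summand N j)
    ≡⟨ sumFin-+ (suc n) (summand M) (λ j → c * summand N j) ⟩
  det (suc n) M + sumFin (suc n) (λ j → c * summand N j)
    ≡⟨ cong (λ x → det (suc n) M + x) (sumFin-* (suc n) c (summand N)) ⟩
  det (suc n) M + c * det (suc n) N ∎
  where
  summand : Matrix (suc n) → Fin (suc n) → ℤ
  summand Q j = sign (toℕ j) * (Q zero j * det n (minor Q j))

  first : ∀ s c x y d → s * ((x + c * y) * d) ≡ s * (x * d) + c * (s * (y * d))
  first = solve-∀

  later : ∀ s c x d e → s * (x * (d + c * e)) ≡ s * (x * d) + c * (s * (x * e))
  later = solve-∀

  termwise : ∀ k j → (∀ j → P k j ≡ M k j + c * N k j) →
    (∀ i → i ≢ k → ∀ j → M i j ≡ P i j) → (∀ i → i ≢ k → ∀ j → N i j ≡ P i j) →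
    summand P j ≡ summand M j + c * summand N j
  termwise zero j Pk≡ M≡P N≡P
    rewrite Pk≡ j
          | det-cong n {minor M j} {minor P j} (λ r l → M≡P (suc r) (λ ()) (punchIn j l))
          | det-cong n {minor N j} {minor P j} (λ r l → N≡P (suc r) (λ ()) (punchIn j l))
    = first (sign (toℕ j)) c (M zero j) (N zero j) _
  termwise (suc k) j Pk≡ M≡P N≡P
    rewrite M≡P zero (λ ()) j | N≡P zero (λ ()) j
          | det-row-linear n k c (minor M j) (minor N j) (minor P j) (λ l → Pk≡ (punchIn j l))
              (λ i i≢k l → M≡P (suc i) (i≢k ∘ Fin.suc-injective) (punchIn j l))
              (λ i i≢k l → N≡P (suc i) (i≢k ∘ Fin.suc-injective) (punchIn j l))
    = later (sign (toℕ j)) c (P zero j) _ _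

-- Since the expansion runs along the first row, this case can be read off directly: the first two
-- terms have the same minor and opposite signs, and every later minor still contains both columns.
det-equal-columns₀₁ : ∀ n (M : Matrix (suc (suc n))) →
  (∀ i → M i zero ≡ M i (suc zero)) → det (suc (suc n)) M ≡ 0ℤ
det-equal-columns₀₁ n M M₀≡M₁ = begin
  1ℤ * (M zero zero * det (suc n) (minor M zero)) + (- 1ℤ * (M zero (suc zero) * det (suc n) (minor M (suc zero))) + rest)
    ≡⟨ cong₂ (λ x d → 1ℤ * (x * d) + (- 1ℤ * (M zero (suc zero) * det (suc n) (minor M (suc zero))) + rest))
             (M₀≡M₁ zero) (det-cong (suc n) {minor M zero} {minor M (suc zero)} λ { r zero → sym (M₀≡M₁ (suc r)) ; r (suc c) → refl }) ⟩
  1ℤ * (M zero (suc zero) * d₁) + (- 1ℤ * (M zero (suc zero) * d₁) + rest)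
    ≡⟨ cong (λ x → 1ℤ * (M zero (suc zero) * d₁) + (- 1ℤ * (M zero (suc zero) * d₁) + x)) (sumFin-0 n (rest≡0 n M M₀≡M₁)) ⟩
  1ℤ * (M zero (suc zero) * d₁) + (- 1ℤ * (M zero (suc zero) * d₁) + 0ℤ)
    ≡⟨ cancel (M zero (suc zero) * d₁) ⟩
  0ℤ ∎
  where
  rest = sumFin n (λ j → sign (suc (suc (toℕ j))) * (M zero (suc (suc j)) * det (suc n) (minor M (suc (suc j)))))
  d₁ = det (suc n) (minor M (suc zero))

  cancel : ∀ x → 1ℤ * x + (- 1ℤ * x + 0ℤ) ≡ 0ℤ
  cancel = solve-∀

  rest≡0 : ∀ n (M : Matrix (suc (suc n))) → (∀ i → M i zero ≡ M i (suc zero)) →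
    ∀ j → sign (suc (suc (toℕ j))) * (M zero (suc (suc j)) * det (suc n) (minor M (suc (suc j)))) ≡ 0ℤ
  rest≡0 (suc n) M M₀≡M₁ j
    rewrite det-equal-columns₀₁ n (minor M (suc (suc j))) (M₀≡M₁ ∘ suc)
          | *-zeroʳ (M zero (suc (suc j)))
    = *-zeroʳ (sign (suc (suc (toℕ j))))

setRow : ∀ {n} → Matrix n → Fin n → (Fin n → ℤ) → Matrix n
setRow M i v = updateAt M i (const v)

-- Mutual induction on the size. Two rows below the first stay equal in every minor; a pair
-- containing the first row is either transposed into the first two columns or reduced to a lower
-- pair of the same size.
det-equal-rows : ∀ n (M : Matrix n) i k → i ≢ k → (∀ j → M i j ≡ M k j) → det n M ≡ 0ℤ
det-equal-rows-suc : ∀ n (M : Matrix (suc n)) i k → i ≢ k → (∀ j → M (suc i) j ≡ M (suc k) j) → det (suc n) M ≡ 0ℤ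
det-equal-rows-zero : ∀ n (M : Matrix (suc n)) k → (∀ j → M zero j ≡ M (suc k) j) → det (suc n) M ≡ 0ℤ

det-equal-rows n M zero    zero    i≢k Mi≡Mk = contradiction refl i≢k
det-equal-rows (suc n) M zero    (suc k) i≢k Mi≡Mk = det-equal-rows-zero n M k Mi≡Mk
det-equal-rows (suc n) M (suc i) zero    i≢k Mi≡Mk = det-equal-rows-zero n M i (sym ∘ Mi≡Mk)
det-equal-rows (suc n) M (suc i) (suc k) i≢k Mi≡Mk = det-equal-rows-suc n M i k (i≢k ∘ cong suc) Mi≡Mk

det-equal-rows-suc n M i k i≢k Mi≡Mk = sumFin-0 (suc n) λ j →
  trans (cong (λ d → sign (toℕ j) * (M zero j * d)) (det-equal-rows n (minor M j) i k i≢k (Mi≡Mk ∘ punchIn j)))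
        (trans (cong (sign (toℕ j) *_) (*-zeroʳ (M zero j))) (*-zeroʳ (sign (toℕ j))))

det-equal-rows-zero (suc n) M zero    M₀≡Mk =
  trans (det-flip (suc (suc n)) M) (det-equal-columns₀₁ n (flip M) M₀≡Mk)
-- With both rows 0 and 1 set to u + v the determinant vanishes, so swapping rows 0 and 1 changes its sign;
-- after the swap the equal rows are 1 and k.
det-equal-rows-zero (suc n) M (suc k) M₀≡Mk = begin
  det _ M                                        ≡⟨ det-cong _ M≡uv ⟩
  D u v                                          ≡⟨ sum-zero (D u v) (D v u) (trans (sym expansion) (zero₀₁ w)) (det-equal-rows-suc (suc n) (R v u) zero (suc k) (λ ()) M₀≡Mk) ⟩
  0ℤ                                             ∎
  where
  u v w : Fin (suc (suc n)) → ℤ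
  u = M zero
  v = M (suc zero)
  w j = u j + 1ℤ * v j

  R : (p q : Fin (suc (suc n)) → ℤ) → Matrix (suc (suc n))
  R p q zero          = p
  R p q (suc zero)    = q
  R p q (suc (suc i)) = M (suc (suc i))

  D : (p q : Fin (suc (suc n)) → ℤ) → ℤ
  D p q = det (suc (suc n)) (R p q)

  M≡uv : ∀ i j → M i j ≡ R u v i j
  M≡uv zero          j = refl
  M≡uv (suc zero)    j = refl
  M≡uv (suc (suc i)) j = refl

  zero₀₁ : ∀ p → D p p ≡ 0ℤ
  zero₀₁ p = trans (det-flip (suc (suc n)) (R p p)) (det-equal-columns₀₁ n (flip (R p p)) (λ _ → refl))

  linear₀ : ∀ q → D w q ≡ D u q + 1ℤ * D v q
  linear₀ q = det-row-linear (suc (suc n)) zero 1ℤ (R u q) (R v q) (R w q) (λ _ → refl) same same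
    where
    same : ∀ {p} i → i ≢ zero → ∀ j → R p q i j ≡ R w q i j
    same zero          i≢0 j = contradiction refl i≢0
    same (suc zero)    i≢0 j = refl
    same (suc (suc i)) i≢0 j = refl

  linear₁ : ∀ p → D p w ≡ D p u + 1ℤ * D p v
  linear₁ p = det-row-linear (suc (suc n)) (suc zero) 1ℤ (R p u) (R p v) (R p w) (λ _ → refl) same same
    where
    same : ∀ {q} i → i ≢ suc zero → ∀ j → R p q i j ≡ R p w i j
    same zero          i≢1 j = refl
    same (suc zero)    i≢1 j = contradiction refl i≢1
    same (suc (suc i)) i≢1 j = refl

  expansion : D w w ≡ D u v + D v u
  expansion = begin
    D w w                                                     ≡⟨ linear₀ w ⟩
    D u w + 1ℤ * D v w                                        ≡⟨ cong₂ (λ x y → x + 1ℤ * y) (linear₁ u) (linear₁ v) ⟩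
    D u u + 1ℤ * D u v + 1ℤ * (D v u + 1ℤ * D v v)            ≡⟨ cong₂ (λ x y → x + 1ℤ * D u v + 1ℤ * (D v u + 1ℤ * y)) (zero₀₁ u) (zero₀₁ v) ⟩
    0ℤ + 1ℤ * D u v + 1ℤ * (D v u + 1ℤ * 0ℤ)                  ≡⟨ simplify (D u v) (D v u) ⟩
    D u v + D v u                                             ∎
    where
    simplify : ∀ x y → 0ℤ + 1ℤ * x + 1ℤ * (y + 1ℤ * 0ℤ) ≡ x + y
    simplify = solve-∀

  sum-zero : ∀ x y → x + y ≡ 0ℤ → y ≡ 0ℤ → x ≡ 0ℤ
  sum-zero x y x+y≡0 refl = trans (sym (+-identityʳ x)) x+y≡0

det-addRow : ∀ n (M N : Matrix n) i k c → i ≢ k →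
  (∀ j → N i j ≡ M i j + c * M k j) → (∀ l → l ≢ i → ∀ j → N l j ≡ M l j) → det n N ≡ det n M
det-addRow n M N i k c i≢k Ni≡ N≡M = begin
  det n N                              ≡⟨ det-row-linear n i c M M′ N
                                            (λ j → trans (Ni≡ j) (cong (λ v → M i j + c * v j) (sym (Vector.updateAt-updates i M))))
                                            (λ l l≢i j → sym (N≡M l l≢i j))
                                            (λ l l≢i j → trans (cong (λ v → v j) (Vector.updateAt-minimal l i M l≢i)) (sym (N≡M l l≢i j))) ⟩
  det n M + c * det n M′               ≡⟨ cong (λ d → det n M + c * d) (det-equal-rows n M′ i k i≢k λ j →
                                            cong (λ v → v j) (trans (Vector.updateAt-updates i M) (sym (Vector.updateAt-minimal k i M (i≢k ∘ sym))))) ⟩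
  det n M + c * 0ℤ                     ≡⟨ cong (λ x → det n M + x) (*-zeroʳ c) ⟩
  det n M + 0ℤ                         ≡⟨ +-identityʳ _ ⟩
  det n M                              ∎
  where
  M′ = setRow M i (M k)

-- A simultaneous row operation. The condition `c i * c (s i) ≡ 0ℤ` says that a row which really
-- serves as a source is not itself changed. Hence the rows can be replaced one at a time, and by
-- `source` each step may read its source row from the partly updated matrix `P k`.
det-addRows : ∀ n (c : Fin n → ℤ) (s : Fin n → Fin n) → (∀ i → i ≢ s i) → (∀ i → c i * c (s i) ≡ 0ℤ) →
  (M N : Matrix n) → (∀ i j → N i j ≡ M i j + c i * M (s i) j) → det n N ≡ det n M
det-addRows n c s i≢s cs≡0 M N N≡ = trans (det-cong n (λ i j → sym (below n i j (Fin.toℕ<n i)))) (partial n ℕ.≤-refl)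
  where
  P : ℕ → Matrix n
  P k i with toℕ i ℕ.<? k
  ... | yes _ = N i
  ... | no  _ = M i

  below : ∀ k i j → toℕ i ℕ.< k → P k i j ≡ N i j
  below k i j i<k with toℕ i ℕ.<? k
  ... | yes _  = refl
  ... | no i≮k = contradiction i<k i≮k

  above : ∀ k i j → k ℕ.≤ toℕ i → P k i j ≡ M i j
  above k i j k≤i with toℕ i ℕ.<? k
  ... | yes i<k = contradiction (ℕ.<-≤-trans i<k k≤i) (ℕ.<-irrefl refl)
  ... | no _    = refl

  source : ∀ k i j → c i * P k (s i) j ≡ c i * M (s i) j
  source k i j with toℕ (s i) ℕ.<? k
  ... | no _  = refl
  ... | yes _ = begin
    c i * N (s i) j                                             ≡⟨ cong (c i *_) (N≡ (s i) j) ⟩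
    c i * (M (s i) j + c (s i) * M (s (s i)) j)                 ≡⟨ expand (c i) (M (s i) j) (c (s i)) (M (s (s i)) j) ⟩
    c i * M (s i) j + c i * c (s i) * M (s (s i)) j             ≡⟨ cong (λ x → c i * M (s i) j + x * M (s (s i)) j) (cs≡0 i) ⟩
    c i * M (s i) j + 0ℤ                                        ≡⟨ +-identityʳ _ ⟩
    c i * M (s i) j                                             ∎
    where
    expand : ∀ x m y m′ → x * (m + y * m′) ≡ x * m + x * y * m′
    expand = solve-∀

  others : ∀ k i j → toℕ i ≢ k → P (suc k) i j ≡ P k i j
  others k i j i≢k with ℕ.<-cmp (toℕ i) k
  ... | tri< i<k _ _ = trans (below (suc k) i j (ℕ.m<n⇒m<1+n i<k)) (sym (below k i j i<k))
  ... | tri≈ _ i≡k _ = contradiction i≡k i≢k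
  ... | tri> _ _ k<i = trans (above (suc k) i j k<i) (sym (above k i j (ℕ.<⇒≤ k<i)))

  partial : ∀ k → k ℕ.≤ n → det n (P k) ≡ det n M
  partial zero    _   = det-cong n (λ i j → above zero i j z≤n)
  partial (suc k) k<n = trans (det-addRow n (P k) (P (suc k)) i (s i) (c i) (i≢s i) added unchanged) (partial k (ℕ.<⇒≤ k<n))
    where
    i = Fin.fromℕ< k<n
    i≡k : toℕ i ≡ k
    i≡k = Fin.toℕ-fromℕ< k<n
    added : ∀ j → P (suc k) i j ≡ P k i j + c i * P k (s i) j
    added j = begin
      P (suc k) i j                    ≡⟨ below (suc k) i j (s≤s (ℕ.≤-reflexive i≡k)) ⟩
      N i j                            ≡⟨ N≡ i j ⟩
      M i j + c i * M (s i) j          ≡⟨ cong₂ _+_ (above k i j (ℕ.≤-reflexive (sym i≡k))) (source k i j) ⟨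
      P k i j + c i * P k (s i) j      ∎
    unchanged : ∀ l → l ≢ i → ∀ j → P (suc k) l j ≡ P k l j
    unchanged l l≢i j = others k l j (λ l≡k → l≢i (Fin.toℕ-injective (trans l≡k (sym i≡k))))

punchIn-↑ˡ : ∀ {m} n (i : Fin (suc m)) (j : Fin m) → punchIn (i ↑ˡ n) (j ↑ˡ n) ≡ punchIn i j ↑ˡ n
punchIn-↑ˡ n zero    j       = refl
punchIn-↑ˡ n (suc i) zero    = refl
punchIn-↑ˡ n (suc i) (suc j) = cong suc (punchIn-↑ˡ n i j)

punchIn-↑ʳ : ∀ {m} n (i : Fin (suc m)) (j : Fin n) → punchIn (i ↑ˡ n) (m ↑ʳ j) ≡ suc m ↑ʳ j
punchIn-↑ʳ         n zero    j = refl
punchIn-↑ʳ {suc m} n (suc i) j = cong suc (punchIn-↑ʳ n i j)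

-- Only the left columns contribute to the expansion along the first row, and deleting one of them
-- leaves the lower right block intact.
det-blockTriangular : ∀ m n (M : Matrix (m ℕ.+ n)) → (∀ i j → M (i ↑ˡ n) (m ↑ʳ j) ≡ 0ℤ) →
  det (m ℕ.+ n) M ≡ det m (λ i j → M (i ↑ˡ n) (j ↑ˡ n)) * det n (λ i j → M (m ↑ʳ i) (m ↑ʳ j))
det-blockTriangular zero    n M M≡0 = sym (*-identityˡ _)
det-blockTriangular (suc m) n M M≡0 = begin
  sumFin (suc m ℕ.+ n) summand
    ≡⟨ sumFin-↑ (suc m) n summand ⟩
  sumFin (suc m) (λ j → summand (j ↑ˡ n)) + sumFin n (λ j → summand (suc m ↑ʳ j))
    ≡⟨ cong₂ _+_ (sumFin-cong (suc m) left) (sumFin-0 n right) ⟩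
  sumFin (suc m) (λ j → D * (sign (toℕ j) * (A zero j * det m (minor A j)))) + 0ℤ
    ≡⟨ +-identityʳ _ ⟩
  sumFin (suc m) (λ j → D * (sign (toℕ j) * (A zero j * det m (minor A j))))
    ≡⟨ sumFin-* (suc m) D (λ j → sign (toℕ j) * (A zero j * det m (minor A j))) ⟩
  D * det (suc m) A
    ≡⟨ *-comm D _ ⟩
  det (suc m) A * D ∎
  where
  summand : Fin (suc m ℕ.+ n) → ℤ
  summand j = sign (toℕ j) * (M zero j * det (m ℕ.+ n) (minor M j))
  A : Matrix (suc m)
  A i j = M (i ↑ˡ n) (j ↑ˡ n)
  D : ℤ
  D = det n (λ i j → M (suc m ↑ʳ i) (suc m ↑ʳ j))

  right : ∀ j → summand (suc m ↑ʳ j) ≡ 0ℤ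
  right j = trans (cong (λ x → sign (toℕ (suc m ↑ʳ j)) * (x * det (m ℕ.+ n) (minor M (suc m ↑ʳ j)))) (M≡0 zero j))
                  (*-zeroʳ (sign (toℕ (suc m ↑ʳ j))))

  left : ∀ j → summand (j ↑ˡ n) ≡ D * (sign (toℕ j) * (A zero j * det m (minor A j)))
  left j = begin
    summand (j ↑ˡ n)
      ≡⟨ cong₂ (λ k d → sign k * (A zero j * d)) (Fin.toℕ-↑ˡ j n)
           (det-blockTriangular m n (minor M (j ↑ˡ n)) λ r c →
             trans (cong (M (suc (r ↑ˡ n))) (punchIn-↑ʳ n j c)) (M≡0 (suc r) c)) ⟩
    sign (toℕ j) * (A zero j * (det m (λ r c → minor M (j ↑ˡ n) (r ↑ˡ n) (c ↑ˡ n)) * det n (λ r c → minor M (j ↑ˡ n) (m ↑ʳ r) (m ↑ʳ c))))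
      ≡⟨ cong₂ (λ d e → sign (toℕ j) * (A zero j * (d * e)))
           (det-cong m λ r c → cong (M (suc (r ↑ˡ n))) (punchIn-↑ˡ n j c))
           (det-cong n λ r c → cong (M (suc (m ↑ʳ r))) (punchIn-↑ʳ n j c)) ⟩
    sign (toℕ j) * (A zero j * (det m (minor A j) * D))
      ≡⟨ rearrange (sign (toℕ j)) (A zero j) (det m (minor A j)) D ⟩
    D * (sign (toℕ j) * (A zero j * det m (minor A j))) ∎
    where
    rearrange : ∀ s x d e → s * (x * (d * e)) ≡ e * (s * (x * d))
    rearrange = solve-∀

↑-elim : ∀ m n (P : Fin (m ℕ.+ n) → Set) → (∀ i → P (i ↑ˡ n)) → (∀ i → P (m ↑ʳ i)) → ∀ i → P i
↑-elim m n P left right i = subst P (Fin.join-splitAt m n i) (Sum.[_,_] {C = P ∘ Fin.join m n} left right (splitAt m i))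

-- As ab = 0, at most one half of the rows changes. Keeping both coefficients lets one lemma serve
-- for adding the lower half to the upper and the upper half to the lower.
det-addHalves : ∀ n a b → a * b ≡ 0ℤ → (M N : Matrix (n ℕ.+ n)) →
  (∀ i j → N (i ↑ˡ n) j ≡ M (i ↑ˡ n) j + a * M (n ↑ʳ i) j) →
  (∀ i j → N (n ↑ʳ i) j ≡ M (n ↑ʳ i) j + b * M (i ↑ˡ n) j) →
  det (n ℕ.+ n) N ≡ det (n ℕ.+ n) M
det-addHalves n a b ab≡0 M N top bottom = det-addRows (n ℕ.+ n) (c ∘ splitAt n) (s ∘ splitAt n)
  (↑-elim n n _ top-≢ bottom-≢) (↑-elim n n _ top-0 bottom-0) M N (↑-elim n n _ top-≡ bottom-≡)
  where
  c : Fin n ⊎ Fin n → ℤ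
  c = [ const a , const b ]′
  s : Fin n ⊎ Fin n → Fin (n ℕ.+ n)
  s = [ (λ i → n ↑ʳ i) , (λ i → i ↑ˡ n) ]′

  split-↑ˡ : ∀ i → splitAt n (i ↑ˡ n) ≡ inj₁ i
  split-↑ˡ i = Fin.splitAt-↑ˡ n i n
  split-↑ʳ : ∀ i → splitAt n (n ↑ʳ i) ≡ inj₂ i
  split-↑ʳ i = Fin.splitAt-↑ʳ n n i

  ↑ˡ≢↑ʳ : ∀ i → i ↑ˡ n ≢ n ↑ʳ i
  ↑ˡ≢↑ʳ i eq = contradiction (trans (sym (split-↑ˡ i)) (trans (cong (splitAt n) eq) (split-↑ʳ i))) λ ()

  top-≢ : ∀ i → i ↑ˡ n ≢ s (splitAt n (i ↑ˡ n))
  top-≢ i rewrite split-↑ˡ i = ↑ˡ≢↑ʳ i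
  bottom-≢ : ∀ i → n ↑ʳ i ≢ s (splitAt n (n ↑ʳ i))
  bottom-≢ i rewrite split-↑ʳ i = ↑ˡ≢↑ʳ i ∘ sym

  top-0 : ∀ i → c (splitAt n (i ↑ˡ n)) * c (splitAt n (s (splitAt n (i ↑ˡ n)))) ≡ 0ℤ
  top-0 i rewrite split-↑ˡ i | split-↑ʳ i = ab≡0
  bottom-0 : ∀ i → c (splitAt n (n ↑ʳ i)) * c (splitAt n (s (splitAt n (n ↑ʳ i)))) ≡ 0ℤ
  bottom-0 i rewrite split-↑ʳ i | split-↑ˡ i = trans (*-comm b a) ab≡0

  top-≡ : ∀ i j → N (i ↑ˡ n) j ≡ M (i ↑ˡ n) j + c (splitAt n (i ↑ˡ n)) * M (s (splitAt n (i ↑ˡ n))) j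
  top-≡ i j rewrite split-↑ˡ i = top i j
  bottom-≡ : ∀ i j → N (n ↑ʳ i) j ≡ M (n ↑ʳ i) j + c (splitAt n (n ↑ʳ i)) * M (s (splitAt n (n ↑ʳ i))) j
  bottom-≡ i j rewrite split-↑ʳ i = bottom i j

-- In blocks the matrix is [A B; B A]. Adding the lower rows to the upper ones gives [A+B A+B; B A],
-- and subtracting the left columns from the right ones gives [A+B 0; B A-B].
det-blockCirculant : ∀ n (M : Matrix (n ℕ.+ n)) →
  (∀ i j → M (n ↑ʳ i) (n ↑ʳ j) ≡ M (i ↑ˡ n) (j ↑ˡ n)) →
  (∀ i j → M (n ↑ʳ i) (j ↑ˡ n) ≡ M (i ↑ˡ n) (n ↑ʳ j)) →
  det (n ℕ.+ n) M ≡ det n (λ i j → M (i ↑ˡ n) (j ↑ˡ n) + M (i ↑ˡ n) (n ↑ʳ j)) *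
                    det n (λ i j → M (i ↑ˡ n) (j ↑ˡ n) - M (i ↑ˡ n) (n ↑ʳ j))
det-blockCirculant n M diagonal off = begin
  det (n ℕ.+ n) M                ≡⟨ det-addHalves n 1ℤ 0ℤ refl M M₁ (M₁-top) M₁-bottom ⟨
  det (n ℕ.+ n) M₁               ≡⟨ det-flip (n ℕ.+ n) M₁ ⟩
  det (n ℕ.+ n) (flip M₁)        ≡⟨ det-addHalves n 0ℤ -1ℤ refl (flip M₁) (flip M₂) M₂-left M₂-right ⟨
  det (n ℕ.+ n) (flip M₂)        ≡⟨ det-flip (n ℕ.+ n) M₂ ⟨
  det (n ℕ.+ n) M₂               ≡⟨ det-blockTriangular n n M₂ corner ⟩
  det n (λ i j → M₂ (i ↑ˡ n) (j ↑ˡ n)) * det n (λ i j → M₂ (n ↑ʳ i) (n ↑ʳ j))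
    ≡⟨ cong₂ _*_ (det-cong n first) (det-cong n second) ⟩
  det n (λ i j → A i j + B i j) * det n (λ i j → A i j - B i j) ∎
  where
  A B : Matrix n
  A i j = M (i ↑ˡ n) (j ↑ˡ n)
  B i j = M (i ↑ˡ n) (n ↑ʳ j)

  half : ∀ {X : Set} → (Fin n → X) → (Fin n → X) → Fin (n ℕ.+ n) → X
  half f g = [ f , g ]′ ∘ splitAt n
  half-↑ˡ : ∀ {X : Set} (f g : Fin n → X) i → half f g (i ↑ˡ n) ≡ f i
  half-↑ˡ f g i = cong [ f , g ]′ (Fin.splitAt-↑ˡ n i n)
  half-↑ʳ : ∀ {X : Set} (f g : Fin n → X) i → half f g (n ↑ʳ i) ≡ g i
  half-↑ʳ f g i = cong [ f , g ]′ (Fin.splitAt-↑ʳ n n i)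

  M₁ M₂ : Matrix (n ℕ.+ n)
  M₁ i j = half (λ i → M (i ↑ˡ n) j + 1ℤ * M (n ↑ʳ i) j) (λ i → M (n ↑ʳ i) j) i
  M₂ i j = half (λ j → M₁ i (j ↑ˡ n)) (λ j → M₁ i (n ↑ʳ j) + -1ℤ * M₁ i (j ↑ˡ n)) j

  M₁-top : ∀ i j → M₁ (i ↑ˡ n) j ≡ M (i ↑ˡ n) j + 1ℤ * M (n ↑ʳ i) j
  M₁-top i j = half-↑ˡ _ _ i
  M₁-bottom : ∀ i j → M₁ (n ↑ʳ i) j ≡ M (n ↑ʳ i) j + 0ℤ
  M₁-bottom i j = trans (half-↑ʳ _ _ i) (sym (+-identityʳ _))
  M₂-left : ∀ j i → M₂ i (j ↑ˡ n) ≡ M₁ i (j ↑ˡ n) + 0ℤ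
  M₂-left j i = trans (half-↑ˡ _ _ j) (sym (+-identityʳ _))
  M₂-right : ∀ j i → M₂ i (n ↑ʳ j) ≡ M₁ i (n ↑ʳ j) + -1ℤ * M₁ i (j ↑ˡ n)
  M₂-right j i = half-↑ʳ _ _ j

  corner : ∀ i j → M₂ (i ↑ˡ n) (n ↑ʳ j) ≡ 0ℤ
  corner i j = begin
    M₂ (i ↑ˡ n) (n ↑ʳ j)                                      ≡⟨ M₂-right j (i ↑ˡ n) ⟩
    M₁ (i ↑ˡ n) (n ↑ʳ j) + -1ℤ * M₁ (i ↑ˡ n) (j ↑ˡ n)         ≡⟨ cong₂ (λ x y → x + -1ℤ * y) (M₁-top i (n ↑ʳ j)) (M₁-top i (j ↑ˡ n)) ⟩
    (B i j + 1ℤ * M (n ↑ʳ i) (n ↑ʳ j)) + -1ℤ * (A i j + 1ℤ * M (n ↑ʳ i) (j ↑ˡ n))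
      ≡⟨ cong₂ (λ x y → (B i j + 1ℤ * x) + -1ℤ * (A i j + 1ℤ * y)) (diagonal i j) (off i j) ⟩
    (B i j + 1ℤ * A i j) + -1ℤ * (A i j + 1ℤ * B i j)         ≡⟨ cancel (A i j) (B i j) ⟩
    0ℤ                                                        ∎
    where
    cancel : ∀ x y → (y + 1ℤ * x) + -1ℤ * (x + 1ℤ * y) ≡ 0ℤ
    cancel = solve-∀

  first : ∀ i j → M₂ (i ↑ˡ n) (j ↑ˡ n) ≡ A i j + B i j
  first i j = begin
    M₂ (i ↑ˡ n) (j ↑ˡ n)                      ≡⟨ half-↑ˡ _ _ j ⟩
    M₁ (i ↑ˡ n) (j ↑ˡ n)                      ≡⟨ M₁-top i (j ↑ˡ n) ⟩
    A i j + 1ℤ * M (n ↑ʳ i) (j ↑ˡ n)          ≡⟨ cong (λ x → A i j + x) (trans (*-identityˡ _) (off i j)) ⟩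
    A i j + B i j                             ∎

  second : ∀ i j → M₂ (n ↑ʳ i) (n ↑ʳ j) ≡ A i j - B i j
  second i j = begin
    M₂ (n ↑ʳ i) (n ↑ʳ j)                                    ≡⟨ M₂-right j (n ↑ʳ i) ⟩
    M₁ (n ↑ʳ i) (n ↑ʳ j) + -1ℤ * M₁ (n ↑ʳ i) (j ↑ˡ n)       ≡⟨ cong₂ (λ x y → x + -1ℤ * y) (half-↑ʳ _ _ i) (half-↑ʳ _ _ i) ⟩
    M (n ↑ʳ i) (n ↑ʳ j) + -1ℤ * M (n ↑ʳ i) (j ↑ˡ n)         ≡⟨ cong₂ (λ x y → x + y) (diagonal i j) (trans (-1*i≡-i _) (cong -_ (off i j))) ⟩
    A i j - B i j                                           ∎

-- Circulant determinants of size 16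

-- An affine form c₀ + c₁ρ₁ + … + cₖρₖ, given by its coefficients: the identities between the entries of the
-- matrices below are then decidable.
Affine : ℕ → Set
Affine k = Vec ℤ (suc k)

linear : ∀ {k} → Vec ℤ k → Vec ℤ k → ℤ
linear []      []      = 0ℤ
linear (r ∷ ρ) (c ∷ v) = c * r + linear ρ v

⟦_⟧ : ∀ {k} → Affine k → Vec ℤ k → ℤ
⟦ c ∷ v ⟧ ρ = c + linear ρ v

_⊕_ _⊖_ : ∀ {k} → Vec ℤ k → Vec ℤ k → Vec ℤ k
_⊕_ = zipWith _+_
_⊖_ = zipWith _-_

linear-⊕ : ∀ {k} (ρ u v : Vec ℤ k) → linear ρ (u ⊕ v) ≡ linear ρ u + linear ρ v
linear-⊕ []      []      []      = refl
linear-⊕ (r ∷ ρ) (a ∷ u) (b ∷ v) = trans (cong (λ x → (a + b) * r + x) (linear-⊕ ρ u v)) (rearrange a b r _ _)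
  where
  rearrange : ∀ a b r x y → (a + b) * r + (x + y) ≡ (a * r + x) + (b * r + y)
  rearrange = solve-∀

linear-⊖ : ∀ {k} (ρ u v : Vec ℤ k) → linear ρ (u ⊖ v) ≡ linear ρ u - linear ρ v
linear-⊖ []      []      []      = refl
linear-⊖ (r ∷ ρ) (a ∷ u) (b ∷ v) = trans (cong (λ x → (a - b) * r + x) (linear-⊖ ρ u v)) (rearrange a b r _ _)
  where
  rearrange : ∀ a b r x y → (a - b) * r + (x - y) ≡ (a * r + x) - (b * r + y)
  rearrange = solve-∀

⟦⟧-⊕ : ∀ {k} (u v : Affine k) ρ → ⟦ u ⊕ v ⟧ ρ ≡ ⟦ u ⟧ ρ + ⟦ v ⟧ ρ
⟦⟧-⊕ (a ∷ u) (b ∷ v) ρ = trans (cong (λ x → a + b + x) (linear-⊕ ρ u v)) (rearrange a b _ _)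
  where
  rearrange : ∀ a b x y → a + b + (x + y) ≡ (a + x) + (b + y)
  rearrange = solve-∀

⟦⟧-⊖ : ∀ {k} (u v : Affine k) ρ → ⟦ u ⊖ v ⟧ ρ ≡ ⟦ u ⟧ ρ - ⟦ v ⟧ ρ
⟦⟧-⊖ (a ∷ u) (b ∷ v) ρ = trans (cong (λ x → a - b + x) (linear-⊖ ρ u v)) (rearrange a b _ _)
  where
  rearrange : ∀ a b x y → a - b + (x - y) ≡ (a + x) - (b + y)
  rearrange = solve-∀

constant : ∀ {k} → ℤ → Affine k
constant c = c ∷ replicate _ 0ℤ

⟦⟧-constant : ∀ {k} c (ρ : Vec ℤ k) → ⟦ constant c ⟧ ρ ≡ c
⟦⟧-constant c ρ = trans (cong (λ x → c + x) (linear-0 ρ)) (+-identityʳ c)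
  where
  linear-0 : ∀ {k} (ρ : Vec ℤ k) → linear ρ (replicate _ 0ℤ) ≡ 0ℤ
  linear-0 []      = refl
  linear-0 (r ∷ ρ) = trans (+-identityˡ _) (linear-0 ρ)

toeplitz : ∀ {A : Set} n → (ℤ → A) → Fin n → Fin n → A
toeplitz n g i j = g (+ toℕ i - + toℕ j)

-- If g has period 2n, its values are the coefficients of a polynomial modulo x²ⁿ - 1; fold⁺ reduces it modulo xⁿ - 1
-- and fold⁻ modulo xⁿ + 1.
fold⁺ fold⁻ : ∀ {k} → ℕ → (ℤ → Affine k) → ℤ → Affine k
fold⁺ n g z = g z ⊕ g (z - + n)
fold⁻ n g z = g z ⊖ g (z - + n)

-- The first two conjuncts carry the period 2n of `g`. The last two express the upper blocks by `g`
-- at exactly the arguments that `fold⁺` and `fold⁻` use, so that the same decision procedure also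
-- does the index arithmetic for `det-split`.
BlockCirculant : ∀ {k} → ℕ → (ℤ → Affine k) → Set
BlockCirculant n g = ∀ i j →
  T (n ↑ʳ i) (n ↑ʳ j) ≡ T (i ↑ˡ n) (j ↑ˡ n) × T (n ↑ʳ i) (j ↑ˡ n) ≡ T (i ↑ˡ n) (n ↑ʳ j) ×
  T (i ↑ˡ n) (j ↑ˡ n) ≡ g (+ toℕ i - + toℕ j) × T (i ↑ˡ n) (n ↑ʳ j) ≡ g (+ toℕ i - + toℕ j - + n)
  where T = toeplitz (n ℕ.+ n) g

_≟ᵃ_ : ∀ {k} (u v : Affine k) → Dec (u ≡ v)
_≟ᵃ_ = Vec.≡-dec _≟_

blockCirculant? : ∀ {k} n (g : ℤ → Affine k) → Dec (BlockCirculant n g)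
blockCirculant? n g = Fin.all? λ i → Fin.all? λ j → (_ ≟ᵃ _) ×-dec (_ ≟ᵃ _) ×-dec (_ ≟ᵃ _) ×-dec (_ ≟ᵃ _)

-- Opaque, lest the type checker expand determinants of size 16.
opaque
  det⟦_⟧ : ∀ {k} → (ℤ → Affine k) → ℕ → Vec ℤ k → ℤ
  det⟦ g ⟧ n ρ = det n (λ i j → ⟦ toeplitz n g i j ⟧ ρ)

opaque
  unfolding det⟦_⟧

  det⟦⟧-cong : ∀ {k} n (M : Matrix n) (g : ℤ → Affine k) ρ →
    (∀ i j → M i j ≡ ⟦ toeplitz n g i j ⟧ ρ) → det n M ≡ det⟦ g ⟧ n ρ
  det⟦⟧-cong n M g ρ M≡ = det-cong n M≡

  det-split : ∀ {k} n (g : ℤ → Affine k) ρ → BlockCirculant n g →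
    det⟦ g ⟧ (n ℕ.+ n) ρ ≡ det⟦ fold⁺ n g ⟧ n ρ * det⟦ fold⁻ n g ⟧ n ρ
  det-split n g ρ circ = trans
    (det-blockCirculant n (λ i j → ⟦ toeplitz (n ℕ.+ n) g i j ⟧ ρ)
      (λ i j → cong (λ u → ⟦ u ⟧ ρ) (proj₁ (circ i j)))
      (λ i j → cong (λ u → ⟦ u ⟧ ρ) (proj₁ (proj₂ (circ i j)))))
    (cong₂ _*_
      (det-cong n λ i j → trans (cong₂ _+_ (left i j) (right i j)) (sym (⟦⟧-⊕ (g _) (g _) ρ)))
      (det-cong n λ i j → trans (cong₂ _-_ (left i j) (right i j)) (sym (⟦⟧-⊖ (g _) (g _) ρ))))
    where
    T : Matrix (n ℕ.+ n)
    T i j = ⟦ toeplitz (n ℕ.+ n) g i j ⟧ ρ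
    left : ∀ i j → T (i ↑ˡ n) (j ↑ˡ n) ≡ ⟦ g (+ toℕ i - + toℕ j) ⟧ ρ
    left i j = cong (λ u → ⟦ u ⟧ ρ) (proj₁ (proj₂ (proj₂ (circ i j))))
    right : ∀ i j → T (i ↑ˡ n) (n ↑ʳ j) ≡ ⟦ g (+ toℕ i - + toℕ j - + n) ⟧ ρ
    right i j = cong (λ u → ⟦ u ⟧ ρ) (proj₂ (proj₂ (proj₂ (circ i j))))

-- Skips the minors at zero entries, so that determinants of sparse matrices can be evaluated.
sparseTerm : ℤ → ℤ → ℤ → ℤ
sparseTerm s (+ zero) d = 0ℤ
sparseTerm s +[1+ x ] d = s * (+[1+ x ] * d)
sparseTerm s -[1+ x ] d = s * (-[1+ x ] * d)

sparseDet : ∀ n → Matrix n → ℤ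
sparseDet zero    M = 1ℤ
sparseDet (suc n) M = sumFin (suc n) λ j → sparseTerm (sign (toℕ j)) (M zero j) (sparseDet n (minor M j))

sparseTerm-≡ : ∀ s x d → s * (x * d) ≡ sparseTerm s x d
sparseTerm-≡ s (+ zero) d = *-zeroʳ s
sparseTerm-≡ s +[1+ x ] d = refl
sparseTerm-≡ s -[1+ x ] d = refl

det≡sparseDet : ∀ n (M : Matrix n) → det n M ≡ sparseDet n M
det≡sparseDet zero    M = refl
det≡sparseDet (suc n) M = sumFin-cong (suc n) λ j →
  trans (cong (λ d → sign (toℕ j) * (M zero j * d)) (det≡sparseDet n (minor M j)))
        (sparseTerm-≡ (sign (toℕ j)) (M zero j) (sparseDet n (minor M j)))

-- True of every factor except the varied one: (x¹⁶ - 1)/(x² + 1) and (x¹⁶ - 1)/(x⁴ + 1) vanish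
-- modulo the polynomials that belong to the other factors, so the parameters cancel there.
Constant : ∀ {k} → ℕ → (ℤ → Affine k) → Set
Constant n g = ∀ (i j : Fin n) → toeplitz n g i j ≡ constant (head (toeplitz n g i j))

constant? : ∀ {k} n (g : ℤ → Affine k) → Dec (Constant n g)
constant? n g = Fin.all? λ i → Fin.all? λ j → _ ≟ᵃ _

opaque
  unfolding det⟦_⟧

  det-constant : ∀ {k} n (g : ℤ → Affine k) ρ → Constant n g → det⟦ g ⟧ n ρ ≡ sparseDet n (toeplitz n (head ∘ g))
  det-constant n g ρ const = trans
    (det-cong n λ i j → trans (cong (λ u → ⟦ u ⟧ ρ) (const i j)) (⟦⟧-constant _ ρ))
    (det≡sparseDet n _)

residue₁₆ : ℤ → Fin 16
residue₁₆ z = fromℕ< (n%ℕd<d z 16)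

subMod16-residue : ∀ i j → subMod16 i j ≡ toeplitz 16 residue₁₆ i j
subMod16-residue = from-yes (Fin.all? λ i → Fin.all? λ j → subMod16 i j Fin.≟ toeplitz 16 residue₁₆ i j)

-- `g₁₆` lists the coefficients of F modulo x¹⁶ - 1. The determinants of `g₁⁺`, `g₁⁻`, `g₂⁻`, `g₄⁻`,
-- `g₈⁻` belong to the reductions modulo x - 1, x + 1, x² + 1, x⁴ + 1, x⁸ + 1, that is, to the five
-- factors of D(F).
module Factors {k} (a : Vec (Affine k) 16) (ρ : Vec ℤ k) where

  g₁₆ g₈⁺ g₈⁻ g₄⁺ g₄⁻ g₂⁺ g₂⁻ g₁⁺ g₁⁻ : ℤ → Affine k
  g₁₆ z = lookup a (residue₁₆ z)
  g₈⁺ = fold⁺ 8 g₁₆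
  g₈⁻ = fold⁻ 8 g₁₆
  g₄⁺ = fold⁺ 4 g₈⁺
  g₄⁻ = fold⁻ 4 g₈⁺
  g₂⁺ = fold⁺ 2 g₄⁺
  g₂⁻ = fold⁻ 2 g₄⁺
  g₁⁺ = fold⁺ 1 g₂⁺
  g₁⁻ = fold⁻ 1 g₂⁺

  factors∈S16 : BlockCirculant 8 g₁₆ → BlockCirculant 4 g₈⁺ → BlockCirculant 2 g₄⁺ → BlockCirculant 1 g₂⁺ →
    InS16 (det⟦ g₁⁺ ⟧ 1 ρ * det⟦ g₁⁻ ⟧ 1 ρ * det⟦ g₂⁻ ⟧ 2 ρ * det⟦ g₄⁻ ⟧ 4 ρ * det⟦ g₈⁻ ⟧ 8 ρ)
  factors∈S16 c₈ c₄ c₂ c₁ = (λ i → ⟦ lookup a i ⟧ ρ) , telescope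
    (det⟦ g₁⁺ ⟧ 1 ρ) (det⟦ g₁⁻ ⟧ 1 ρ) (det⟦ g₂⁻ ⟧ 2 ρ) (det⟦ g₄⁻ ⟧ 4 ρ) (det⟦ g₈⁻ ⟧ 8 ρ)
    (det⟦⟧-cong 16 (circulant16 (λ i → ⟦ lookup a i ⟧ ρ)) g₁₆ ρ (λ i j → cong (λ r → ⟦ lookup a r ⟧ ρ) (subMod16-residue i j)))
    (det-split 8 g₁₆ ρ c₈) (det-split 4 g₈⁺ ρ c₄) (det-split 2 g₄⁺ ρ c₂) (det-split 1 g₂⁺ ρ c₁)
    where
    telescope : ∀ e₁ f₁ f₂ f₄ f₈ {d e e₂ e₄ e₈} → d ≡ e → e ≡ e₈ * f₈ → e₈ ≡ e₄ * f₄ → e₄ ≡ e₂ * f₂ → e₂ ≡ e₁ * f₁ →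
      d ≡ e₁ * f₁ * f₂ * f₄ * f₈
    telescope _ _ _ _ _ refl refl refl refl refl = refl

-- ⟨ a , b , c , d ⟩ stands for a + bζ + cζ² + dζ³ with ζ⁴ = -1.
data ℤ[ζ] : Set where
  ⟨_,_,_,_⟩ : (a b c d : ℤ) → ℤ[ζ]

-- The norm of α down to ℤ[ζ²] = ℤ[i] is re α + i im α.
re im norm : ℤ[ζ] → ℤ
re ⟨ a , b , c , d ⟩ = a * a - c * c + + 2 * (b * d)
im ⟨ a , b , c , d ⟩ = + 2 * (a * c) - b * b + d * d
norm α = re α * re α + im α * im α

det₂-≡ : ∀ (M : Matrix 2) → det 2 M ≡ M zero zero * M (suc zero) (suc zero) - M zero (suc zero) * M (suc zero) zero
det₂-≡ M = identity (M zero zero) (M zero (suc zero)) (M (suc zero) zero) (M (suc zero) (suc zero))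
  where
  identity : ∀ a b c d → 1ℤ * (a * (1ℤ * (d * 1ℤ) + 0ℤ)) + (- 1ℤ * (b * (1ℤ * (c * 1ℤ) + 0ℤ)) + 0ℤ) ≡ a * d - b * c
  identity = solve-∀

det₃-≡ : ∀ (M : Matrix 3) → let m = λ (i j : Fin 3) → M i j; 0F = zero; 1F = suc zero; 2F = suc (suc zero) in
  det 3 M ≡ m 0F 0F * (m 1F 1F * m 2F 2F - m 1F 2F * m 2F 1F) - m 0F 1F * (m 1F 0F * m 2F 2F - m 1F 2F * m 2F 0F) +
            m 0F 2F * (m 1F 0F * m 2F 1F - m 1F 1F * m 2F 0F)
det₃-≡ M = expand (M zero zero) (M zero (suc zero)) (M zero (suc (suc zero)))
  (det₂-≡ (minor M zero)) (det₂-≡ (minor M (suc zero))) (det₂-≡ (minor M (suc (suc zero))))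
  where
  expand : ∀ x y z {m₀ m₁ m₂ n₀ n₁ n₂} → m₀ ≡ n₀ → m₁ ≡ n₁ → m₂ ≡ n₂ →
    1ℤ * (x * m₀) + (- 1ℤ * (y * m₁) + (1ℤ * (z * m₂) + 0ℤ)) ≡ x * n₀ - y * n₁ + z * n₂
  expand x y z {m₀} {m₁} {m₂} refl refl refl = simplify x y z m₀ m₁ m₂
    where
    simplify : ∀ x y z m₀ m₁ m₂ → 1ℤ * (x * m₀) + (- 1ℤ * (y * m₁) + (1ℤ * (z * m₂) + 0ℤ)) ≡ x * m₀ - y * m₁ + z * m₂
    simplify = solve-∀

opaque
  unfolding det⟦_⟧

  -- The matrix is that of multiplication by u + vi on ℤ[i], so its determinant is the norm.
  det-negacyclic₂ : ∀ {k} (g : ℤ → Affine k) ρ u v →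
    ⟦ g (+ 0) ⟧ ρ ≡ u → ⟦ g (+ 1) ⟧ ρ ≡ v → ⟦ g (- + 1) ⟧ ρ ≡ - v → det⟦ g ⟧ 2 ρ ≡ u * u + v * v
  det-negacyclic₂ g ρ u v g₀ g₁ g₋₁ rewrite g₀ | g₁ | g₋₁ = expand u v
    where
    expand : ∀ u v → 1ℤ * (u * (1ℤ * (u * 1ℤ) + 0ℤ)) + (- 1ℤ * (- v * (1ℤ * (v * 1ℤ) + 0ℤ)) + 0ℤ) ≡ u * u + v * v
    expand = solve-∀

  -- Likewise the matrix of multiplication by a + bζ + cζ² + dζ³ in the basis 1, ζ, ζ², ζ³.
  det-negacyclic₄ : ∀ {k} (g : ℤ → Affine k) ρ a b c d →
    ⟦ g (+ 0) ⟧ ρ ≡ a → ⟦ g (+ 1) ⟧ ρ ≡ b → ⟦ g (+ 2) ⟧ ρ ≡ c → ⟦ g (+ 3) ⟧ ρ ≡ d →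
    ⟦ g (- + 3) ⟧ ρ ≡ - b → ⟦ g (- + 2) ⟧ ρ ≡ - c → ⟦ g (- + 1) ⟧ ρ ≡ - d →
    det⟦ g ⟧ 4 ρ ≡ norm ⟨ a , b , c , d ⟩
  det-negacyclic₄ g ρ a b c d g₀ g₁ g₂ g₃ g₋₃ g₋₂ g₋₁ = trans (det-cong 4 entries) (trans
    (expand a (- d) (- c) (- b) (det₃-≡ (minor M zero)) (det₃-≡ (minor M (suc zero)))
      (det₃-≡ (minor M (suc (suc zero)))) (det₃-≡ (minor M (suc (suc (suc zero))))))
    (identity a b c d))
    where
    M : Matrix 4
    M i j = lookup (lookup ((a ∷ - d ∷ - c ∷ - b ∷ []) ∷ (b ∷ a ∷ - d ∷ - c ∷ []) ∷
                            (c ∷ b ∷ a ∷ - d ∷ []) ∷ (d ∷ c ∷ b ∷ a ∷ []) ∷ []) i) j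
    entries : ∀ i j → ⟦ toeplitz 4 g i j ⟧ ρ ≡ M i j
    entries zero                   zero                   = g₀
    entries zero                   (suc zero)             = g₋₁
    entries zero                   (suc (suc zero))       = g₋₂
    entries zero                   (suc (suc (suc zero))) = g₋₃
    entries (suc zero)             zero                   = g₁
    entries (suc zero)             (suc zero)             = g₀
    entries (suc zero)             (suc (suc zero))       = g₋₁
    entries (suc zero)             (suc (suc (suc zero))) = g₋₂
    entries (suc (suc zero))       zero                   = g₂
    entries (suc (suc zero))       (suc zero)             = g₁
    entries (suc (suc zero))       (suc (suc zero))       = g₀
    entries (suc (suc zero))       (suc (suc (suc zero))) = g₋₁
    entries (suc (suc (suc zero))) zero                   = g₃
    entries (suc (suc (suc zero))) (suc zero)             = g₂
    entries (suc (suc (suc zero))) (suc (suc zero))       = g₁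
    entries (suc (suc (suc zero))) (suc (suc (suc zero))) = g₀
    expand : ∀ x y z w {m₀ m₁ m₂ m₃ n₀ n₁ n₂ n₃} → m₀ ≡ n₀ → m₁ ≡ n₁ → m₂ ≡ n₂ → m₃ ≡ n₃ →
      1ℤ * (x * m₀) + (- 1ℤ * (y * m₁) + (1ℤ * (z * m₂) + (- 1ℤ * (w * m₃) + 0ℤ))) ≡ x * n₀ - y * n₁ + z * n₂ - w * n₃
    expand x y z w {m₀} {m₁} {m₂} {m₃} refl refl refl refl = simplify x y z w m₀ m₁ m₂ m₃
      where
      simplify : ∀ x y z w m₀ m₁ m₂ m₃ →
        1ℤ * (x * m₀) + (- 1ℤ * (y * m₁) + (1ℤ * (z * m₂) + (- 1ℤ * (w * m₃) + 0ℤ))) ≡ x * m₀ - y * m₁ + z * m₂ - w * m₃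
      simplify = solve-∀
    identity : ∀ a b c d →
      a * (a * (a * a - - d * b) - - d * (b * a - - d * c) + - c * (b * b - a * c)) -
      - d * (b * (a * a - - d * b) - - d * (c * a - - d * d) + - c * (c * b - a * d)) +
      - c * (b * (b * a - - d * c) - a * (c * a - - d * d) + - c * (c * c - b * d)) -
      - b * (b * (b * b - a * c) - a * (c * b - a * d) + - d * (c * c - b * d)) ≡
      (a * a - c * c + + 2 * (b * d)) * (a * a - c * c + + 2 * (b * d)) +
      (+ 2 * (a * c) - b * b + d * d) * (+ 2 * (a * c) - b * b + d * d)
    identity = solve-∀

*-cong₅ : ∀ {a a′ b b′ c c′ d d′ e e′ : ℤ} → a ≡ a′ → b ≡ b′ → c ≡ c′ → d ≡ d′ → e ≡ e′ → a * b * c * d * e ≡ a′ * b′ * c′ * d′ * e′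
*-cong₅ refl refl refl refl refl = refl

-- The constant part 1 - x³ + x⁸ + x¹² reduces to 1 - x³ modulo x⁴ + 1 and to -x³(1 + x) modulo x⁸ +
-- 1; both have norm 2.
gaussianFamily : Vec (Affine 2) 16
gaussianFamily = (+ 1 ∷ + 1 ∷ + 0 ∷ []) ∷ (+ 0 ∷ + 0 ∷ + 1 ∷ [])
   ∷ (+ 0 ∷ -1ℤ ∷ + 0 ∷ []) ∷ (-1ℤ ∷ + 0 ∷ -1ℤ ∷ [])
   ∷ (+ 0 ∷ + 1 ∷ + 0 ∷ []) ∷ (+ 0 ∷ + 0 ∷ + 1 ∷ [])
   ∷ (+ 0 ∷ -1ℤ ∷ + 0 ∷ []) ∷ (+ 0 ∷ + 0 ∷ -1ℤ ∷ [])
   ∷ (+ 1 ∷ + 1 ∷ + 0 ∷ []) ∷ (+ 0 ∷ + 0 ∷ + 1 ∷ [])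
   ∷ (+ 0 ∷ -1ℤ ∷ + 0 ∷ []) ∷ (+ 0 ∷ + 0 ∷ -1ℤ ∷ [])
   ∷ (+ 1 ∷ + 1 ∷ + 0 ∷ []) ∷ (+ 0 ∷ + 0 ∷ + 1 ∷ [])
   ∷ (+ 0 ∷ -1ℤ ∷ + 0 ∷ []) ∷ (+ 0 ∷ + 0 ∷ -1ℤ ∷ []) ∷ []

-- 1 - x³ + x⁸ + x¹² + (m + nx)(x¹⁶ - 1)/(x² + 1) takes the values 2 and 4 at ±1 and, up to conjugation, 3 + 8m + (1 + 8n)i at i.
gaussian∈S16 : ∀ m n → InS16 (+ 32 * ((+ 3 + + 8 * m) * (+ 3 + + 8 * m) + (+ 1 + + 8 * n) * (+ 1 + + 8 * n)))
gaussian∈S16 m n = subst InS16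
  (trans (*-cong₅ (det-constant 1 g₁⁺ ρ (from-yes (constant? 1 g₁⁺))) (det-constant 1 g₁⁻ ρ (from-yes (constant? 1 g₁⁻)))
           (det-negacyclic₂ g₂⁻ ρ (+ 3 + + 8 * m) (+ 1 + + 8 * n) (value₀ m) (value₁ n) (value₋₁ n))
           (det-constant 4 g₄⁻ ρ (from-yes (constant? 4 g₄⁻))) (det-constant 8 g₈⁻ ρ (from-yes (constant? 8 g₈⁻))))
         (collect _))
  (factors∈S16 (from-yes (blockCirculant? 8 g₁₆)) (from-yes (blockCirculant? 4 g₈⁺)) (from-yes (blockCirculant? 2 g₄⁺)) (from-yes (blockCirculant? 1 g₂⁺)))
  where
  ρ = m ∷ n ∷ []
  open Factors gaussianFamily ρ
  -- The left-hand sides are what `⟦ g₂⁻ z ⟧ ρ` evaluates to at z = 0, 1, -1; the repeated folding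
  -- has added up eight copies of each parameter.
  value₀ : ∀ m → + 3 + (+ 8 * m + (+ 0 + + 0)) ≡ + 3 + + 8 * m
  value₀ = solve-∀
  value₁ : ∀ n → + 1 + (+ 0 + (+ 8 * n + + 0)) ≡ + 1 + + 8 * n
  value₁ = solve-∀
  value₋₁ : ∀ n → -1ℤ + (+ 0 + (- + 8 * n + + 0)) ≡ - (+ 1 + + 8 * n)
  value₋₁ = solve-∀
  collect : ∀ x → + 2 * + 4 * x * + 2 * + 2 ≡ + 32 * x
  collect = solve-∀

-- The constant part 1 + x + x² + x⁸ reduces to 2 + x + x² modulo x⁴ + 1, and to x(1 + x), of norm
-- 2, modulo x⁸ + 1.
cyclotomicFamily : Vec (Affine 4) 16
cyclotomicFamily = (+ 1 ∷ + 1 ∷ + 0 ∷ + 0 ∷ + 0 ∷ [])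
   ∷ (+ 1 ∷ + 0 ∷ + 1 ∷ + 0 ∷ + 0 ∷ [])
   ∷ (+ 1 ∷ + 0 ∷ + 0 ∷ + 1 ∷ + 0 ∷ [])
   ∷ (+ 0 ∷ + 0 ∷ + 0 ∷ + 0 ∷ + 1 ∷ [])
   ∷ (+ 0 ∷ -1ℤ ∷ + 0 ∷ + 0 ∷ + 0 ∷ [])
   ∷ (+ 0 ∷ + 0 ∷ -1ℤ ∷ + 0 ∷ + 0 ∷ [])
   ∷ (+ 0 ∷ + 0 ∷ + 0 ∷ -1ℤ ∷ + 0 ∷ [])
   ∷ (+ 0 ∷ + 0 ∷ + 0 ∷ + 0 ∷ -1ℤ ∷ [])
   ∷ (+ 1 ∷ + 1 ∷ + 0 ∷ + 0 ∷ + 0 ∷ [])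
   ∷ (+ 0 ∷ + 0 ∷ + 1 ∷ + 0 ∷ + 0 ∷ [])
   ∷ (+ 0 ∷ + 0 ∷ + 0 ∷ + 1 ∷ + 0 ∷ [])
   ∷ (+ 0 ∷ + 0 ∷ + 0 ∷ + 0 ∷ + 1 ∷ [])
   ∷ (+ 0 ∷ -1ℤ ∷ + 0 ∷ + 0 ∷ + 0 ∷ [])
   ∷ (+ 0 ∷ + 0 ∷ -1ℤ ∷ + 0 ∷ + 0 ∷ [])
   ∷ (+ 0 ∷ + 0 ∷ + 0 ∷ -1ℤ ∷ + 0 ∷ [])
   ∷ (+ 0 ∷ + 0 ∷ + 0 ∷ + 0 ∷ -1ℤ ∷ [])
   ∷ []

-- 1 + x + x² + x⁸ + (m₀ + m₁x + m₂x² + m₃x³)(1 - x⁴ + x⁸ - x¹²) takes the values 4, 2 and 1 + i at 1, -1 and i.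
cyclotomic∈S16 : ∀ m₀ m₁ m₂ m₃ → InS16 (+ 32 * norm ⟨ + 2 + + 4 * m₀ , + 1 + + 4 * m₁ , + 1 + + 4 * m₂ , + 4 * m₃ ⟩)
cyclotomic∈S16 m₀ m₁ m₂ m₃ = subst InS16
  (trans (*-cong₅ (det-constant 1 g₁⁺ ρ (from-yes (constant? 1 g₁⁺))) (det-constant 1 g₁⁻ ρ (from-yes (constant? 1 g₁⁻)))
           (det-constant 2 g₂⁻ ρ (from-yes (constant? 2 g₂⁻)))
           (det-negacyclic₄ g₄⁻ ρ (+ 2 + + 4 * m₀) (+ 1 + + 4 * m₁) (+ 1 + + 4 * m₂) (+ 4 * m₃)
             (value₀ m₀) (value₁ m₁) (value₂ m₂) (value₃ m₃) (value₋₃ m₁) (value₋₂ m₂) (value₋₁ m₃))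
           (det-constant 8 g₈⁻ ρ (from-yes (constant? 8 g₈⁻))))
         (collect _))
  (factors∈S16 (from-yes (blockCirculant? 8 g₁₆)) (from-yes (blockCirculant? 4 g₈⁺)) (from-yes (blockCirculant? 2 g₄⁺)) (from-yes (blockCirculant? 1 g₂⁺)))
  where
  ρ = m₀ ∷ m₁ ∷ m₂ ∷ m₃ ∷ []
  open Factors cyclotomicFamily ρ
  value₀ : ∀ m → + 2 + (+ 4 * m + (+ 0 + (+ 0 + (+ 0 + + 0)))) ≡ + 2 + + 4 * m
  value₀ = solve-∀
  value₁ : ∀ m → + 1 + (+ 0 + (+ 4 * m + (+ 0 + (+ 0 + + 0)))) ≡ + 1 + + 4 * m
  value₁ = solve-∀
  value₂ : ∀ m → + 1 + (+ 0 + (+ 0 + (+ 4 * m + (+ 0 + + 0)))) ≡ + 1 + + 4 * m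
  value₂ = solve-∀
  value₃ : ∀ m → + 0 + (+ 0 + (+ 0 + (+ 0 + (+ 4 * m + + 0)))) ≡ + 4 * m
  value₃ = solve-∀
  value₋₃ : ∀ m → -1ℤ + (+ 0 + (- + 4 * m + (+ 0 + (+ 0 + + 0)))) ≡ - (+ 1 + + 4 * m)
  value₋₃ = solve-∀
  value₋₂ : ∀ m → -1ℤ + (+ 0 + (+ 0 + (- + 4 * m + (+ 0 + + 0)))) ≡ - (+ 1 + + 4 * m)
  value₋₂ = solve-∀
  value₋₁ : ∀ m → + 0 + (+ 0 + (+ 0 + (+ 0 + (- + 4 * m + + 0)))) ≡ - (+ 4 * m)
  value₋₁ = solve-∀
  collect : ∀ x → + 4 * + 2 * + 2 * x * + 2 ≡ + 32 * x
  collect = solve-∀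

-- The two parametric families modulo 8 and modulo 4

residue : ∀ n .{{_ : ℕ.NonZero n}} a → ∃₂ λ (r : Fin n) q → a ≡ + toℕ r + + n * q
residue n a = fromℕ< (n%ℕd<d a n) , a /ℕ n , (begin
  a                                                   ≡⟨ a≡a%ℕn+[a/ℕn]*n a n ⟩
  + (a %ℕ n) + (a /ℕ n) * + n                         ≡⟨ cong₂ (λ r x → + r + x) (sym (Fin.toℕ-fromℕ< (n%ℕd<d a n))) (*-comm (a /ℕ n) (+ n)) ⟩
  + toℕ (fromℕ< (n%ℕd<d a n)) + + n * (a /ℕ n)        ∎)

GaussianClass : ℤ → ℤ → Set
GaussianClass u v = ((+ 8 ∣ u - + 3) ⊎ (+ 8 ∣ - u - + 3)) × ((+ 8 ∣ v - + 1) ⊎ (+ 8 ∣ - v - + 1))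

gaussianClass? : ∀ u v → Dec (GaussianClass u v)
gaussianClass? u v = (_ ∣? _ ⊎-dec _ ∣? _) ×-dec (_ ∣? _ ⊎-dec _ ∣? _)

-- A square is 1 or 9 modulo 16 when its root is ±1 or ±3 modulo 8, and 0 or 4 when its root is
-- even. A sum of two squares that is 10 modulo 16 can thus only be 1 + 9.
gaussianClasses : ∀ (r s : Fin 8) → let u = + toℕ r; v = + toℕ s in
  + 16 ∣ u * u + v * v - + 10 → GaussianClass u v ⊎ GaussianClass v u
gaussianClasses = from-yes (Fin.all? λ (r : Fin 8) → Fin.all? λ (s : Fin 8) → let u = + toℕ r; v = + toℕ s in
  + 16 ∣? (u * u + v * v - + 10) →-dec (gaussianClass? u v ⊎-dec gaussianClass? v u))

same-square : ∀ c r m → ((+ 8 ∣ r - c) ⊎ (+ 8 ∣ - r - c)) → ∃ λ q → (r + + 8 * m) * (r + + 8 * m) ≡ (c + + 8 * q) * (c + + 8 * q)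
same-square c r m (inj₁ (divides q eq)) = q + m , (begin
  (r + + 8 * m) * (r + + 8 * m)                         ≡⟨ identity r c m ⟩
  (r - c + (c + + 8 * m)) * (r - c + (c + + 8 * m))     ≡⟨ cong (λ x → (x + (c + + 8 * m)) * (x + (c + + 8 * m))) eq ⟩
  (q * + 8 + (c + + 8 * m)) * (q * + 8 + (c + + 8 * m)) ≡⟨ identity′ q c m ⟩
  (c + + 8 * (q + m)) * (c + + 8 * (q + m))             ∎)
  where
  identity : ∀ r c m → (r + + 8 * m) * (r + + 8 * m) ≡ (r - c + (c + + 8 * m)) * (r - c + (c + + 8 * m))
  identity = solve-∀
  identity′ : ∀ q c m → (q * + 8 + (c + + 8 * m)) * (q * + 8 + (c + + 8 * m)) ≡ (c + + 8 * (q + m)) * (c + + 8 * (q + m))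
  identity′ = solve-∀
same-square c r m (inj₂ (divides q eq)) = q - m , (begin
  (r + + 8 * m) * (r + + 8 * m)                             ≡⟨ identity r c m ⟩
  (- r - c + (c - + 8 * m)) * (- r - c + (c - + 8 * m))     ≡⟨ cong (λ x → (x + (c - + 8 * m)) * (x + (c - + 8 * m))) eq ⟩
  (q * + 8 + (c - + 8 * m)) * (q * + 8 + (c - + 8 * m))     ≡⟨ identity′ q c m ⟩
  (c + + 8 * (q - m)) * (c + + 8 * (q - m))                 ∎)
  where
  identity : ∀ r c m → (r + + 8 * m) * (r + + 8 * m) ≡ (- r - c + (c - + 8 * m)) * (- r - c + (c - + 8 * m))
  identity = solve-∀
  identity′ : ∀ q c m → (q * + 8 + (c - + 8 * m)) * (q * + 8 + (c - + 8 * m)) ≡ (c + + 8 * (q - m)) * (c + + 8 * (q - m))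
  identity′ = solve-∀

represent : ∀ x y m n → GaussianClass x y → InS16 (+ 32 * ((x + + 8 * m) * (x + + 8 * m) + (y + + 8 * n) * (y + + 8 * n)))
represent x y m n (x≡3 , y≡1) = subst InS16 (cong (+ 32 *_) (sym (cong₂ _+_ (proj₂ u²) (proj₂ v²)))) (gaussian∈S16 (proj₁ u²) (proj₁ v²))
  where
  u² = same-square (+ 3) x m x≡3
  v² = same-square (+ 1) y n y≡1

-- The square of u modulo 16 depends only on u modulo 8, so the hypothesis passes to the residues of
-- u and v, where the finite table applies.
twice-5mod8∈S16 : ∀ u v → + 16 ∣ u * u + v * v - + 10 → InS16 (+ 32 * (u * u + v * v))
twice-5mod8∈S16 u v (divides k eq) = reduce (residue 8 u) (residue 8 v) eq
  where
  conclude : ∀ ρ σ m n → GaussianClass ρ σ ⊎ GaussianClass σ ρ →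
    InS16 (+ 32 * ((ρ + + 8 * m) * (ρ + + 8 * m) + (σ + + 8 * n) * (σ + + 8 * n)))
  conclude ρ σ m n (inj₁ class) = represent ρ σ m n class
  conclude ρ σ m n (inj₂ class) = subst InS16 (cong (+ 32 *_) (+-comm ((σ + + 8 * n) * (σ + + 8 * n)) ((ρ + + 8 * m) * (ρ + + 8 * m)))) (represent σ ρ n m class)

  shift : ℤ → ℤ → ℤ
  shift x y = x * y + + 4 * (y * y)
  complete : ∀ x m y n → x * x + y * y - + 10 ≡
    (x + + 8 * m) * (x + + 8 * m) + (y + + 8 * n) * (y + + 8 * n) - + 10 - (x * m + + 4 * (m * m)) * + 16 - (y * n + + 4 * (n * n)) * + 16
  complete = solve-∀
  collect : ∀ k x y → k * + 16 - x * + 16 - y * + 16 ≡ (k - x - y) * + 16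
  collect = solve-∀

  reduced : ∀ ρ m σ n → (ρ + + 8 * m) * (ρ + + 8 * m) + (σ + + 8 * n) * (σ + + 8 * n) - + 10 ≡ k * + 16 →
    + 16 ∣ ρ * ρ + σ * σ - + 10
  reduced ρ m σ n eq = divides (k - shift ρ m - shift σ n) (begin
    ρ * ρ + σ * σ - + 10                                                        ≡⟨ complete ρ m σ n ⟩
    (ρ + + 8 * m) * (ρ + + 8 * m) + (σ + + 8 * n) * (σ + + 8 * n) - + 10 - shift ρ m * + 16 - shift σ n * + 16
                                                                                ≡⟨ cong (λ x → x - shift ρ m * + 16 - shift σ n * + 16) eq ⟩
    k * + 16 - shift ρ m * + 16 - shift σ n * + 16                              ≡⟨ collect k (shift ρ m) (shift σ n) ⟩
    (k - shift ρ m - shift σ n) * + 16                                          ∎)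

  reduce : ∀ {u v} → (∃₂ λ (r : Fin 8) q → u ≡ + toℕ r + + 8 * q) → (∃₂ λ (r : Fin 8) q → v ≡ + toℕ r + + 8 * q) →
    u * u + v * v - + 10 ≡ k * + 16 → InS16 (+ 32 * (u * u + v * v))
  reduce (r , m , refl) (s , n , refl) eq =
    conclude (+ toℕ r) (+ toℕ s) m n (gaussianClasses r s (reduced (+ toℕ r) m (+ toℕ s) n eq))

-- Arithmetic of ℤ[ζ] and classes modulo 4

infixr 7 _⊗_
_⊗_ : ℤ[ζ] → ℤ[ζ] → ℤ[ζ]
⟨ a , b , c , d ⟩ ⊗ ⟨ a′ , b′ , c′ , d′ ⟩ =
  ⟨ a * a′ - b * d′ - c * c′ - d * b′ , a * b′ + b * a′ - c * d′ - d * c′ ,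
    a * c′ + b * b′ + c * a′ - d * d′ , a * d′ + b * c′ + c * b′ + d * a′ ⟩

re-⊗ : ∀ α β → re (α ⊗ β) ≡ re α * re β - im α * im β
re-⊗ ⟨ a , b , c , d ⟩ ⟨ a′ , b′ , c′ , d′ ⟩ = identity a b c d a′ b′ c′ d′
  where
  identity : ∀ a b c d a′ b′ c′ d′ →
    (a * a′ - b * d′ - c * c′ - d * b′) * (a * a′ - b * d′ - c * c′ - d * b′) -
    (a * c′ + b * b′ + c * a′ - d * d′) * (a * c′ + b * b′ + c * a′ - d * d′) +
    + 2 * ((a * b′ + b * a′ - c * d′ - d * c′) * (a * d′ + b * c′ + c * b′ + d * a′)) ≡
    (a * a - c * c + + 2 * (b * d)) * (a′ * a′ - c′ * c′ + + 2 * (b′ * d′)) -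
    (+ 2 * (a * c) - b * b + d * d) * (+ 2 * (a′ * c′) - b′ * b′ + d′ * d′)
  identity = solve-∀

im-⊗ : ∀ α β → im (α ⊗ β) ≡ re α * im β + im α * re β
im-⊗ ⟨ a , b , c , d ⟩ ⟨ a′ , b′ , c′ , d′ ⟩ = identity a b c d a′ b′ c′ d′
  where
  identity : ∀ a b c d a′ b′ c′ d′ →
    + 2 * ((a * a′ - b * d′ - c * c′ - d * b′) * (a * c′ + b * b′ + c * a′ - d * d′)) -
    (a * b′ + b * a′ - c * d′ - d * c′) * (a * b′ + b * a′ - c * d′ - d * c′) +
    (a * d′ + b * c′ + c * b′ + d * a′) * (a * d′ + b * c′ + c * b′ + d * a′) ≡
    (a * a - c * c + + 2 * (b * d)) * (+ 2 * (a′ * c′) - b′ * b′ + d′ * d′) +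
    (+ 2 * (a * c) - b * b + d * d) * (a′ * a′ - c′ * c′ + + 2 * (b′ * d′))
  identity = solve-∀

norm-⊗ : ∀ α β → norm (α ⊗ β) ≡ norm α * norm β
norm-⊗ α β = trans (cong₂ (λ x y → x * x + y * y) (re-⊗ α β) (im-⊗ α β)) (brahmagupta (re α) (im α) (re β) (im β))
  where
  brahmagupta : ∀ a b c d → (a * c - b * d) * (a * c - b * d) + (a * d + b * c) * (a * d + b * c) ≡ (a * a + b * b) * (c * c + d * d)
  brahmagupta = solve-∀

-- Complex conjugation, ζ ↦ ζ⁻¹ = -ζ³.
conjugate : ℤ[ζ] → ℤ[ζ]
conjugate ⟨ a , b , c , d ⟩ = ⟨ a , - d , - c , - b ⟩

norm-conjugate : ∀ α → norm (conjugate α) ≡ norm α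
norm-conjugate ⟨ a , b , c , d ⟩ = cong₂ _+_ (cong (λ x → x * x) (re-≡ a b c d)) (im-≡ a b c d)
  where
  re-≡ : ∀ a b c d → a * a - - c * - c + + 2 * (- d * - b) ≡ a * a - c * c + + 2 * (b * d)
  re-≡ = solve-∀
  im-≡ : ∀ a b c d → (+ 2 * (a * - c) - - d * - d + - b * - b) * (+ 2 * (a * - c) - - d * - d + - b * - b) ≡
                     (+ 2 * (a * c) - b * b + d * d) * (+ 2 * (a * c) - b * b + d * d)
  im-≡ = solve-∀

infixl 6 _+[_]_
_+[_]_ : ℤ[ζ] → ℤ → ℤ[ζ] → ℤ[ζ]
⟨ a , b , c , d ⟩ +[ n ] ⟨ a′ , b′ , c′ , d′ ⟩ = ⟨ a + n * a′ , b + n * b′ , c + n * c′ , d + n * d′ ⟩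

⟨⟩-≡ : ∀ {a a′ b b′ c c′ d d′} → a ≡ a′ → b ≡ b′ → c ≡ c′ → d ≡ d′ → ⟨ a , b , c , d ⟩ ≡ ⟨ a′ , b′ , c′ , d′ ⟩
⟨⟩-≡ refl refl refl refl = refl

⊗-+[] : ∀ n μ α β → μ ⊗ (α +[ n ] β) ≡ μ ⊗ α +[ n ] μ ⊗ β
⊗-+[] n ⟨ m₀ , m₁ , m₂ , m₃ ⟩ ⟨ a , b , c , d ⟩ ⟨ a′ , b′ , c′ , d′ ⟩ =
  ⟨⟩-≡ (minus n m₀ m₁ m₂ m₃ a d c b a′ d′ c′ b′) (mixed n m₀ m₁ m₂ m₃ b a d c b′ a′ d′ c′)
       (mixed′ n m₀ m₁ m₂ m₃ c b a d c′ b′ a′ d′) (plus n m₀ m₁ m₂ m₃ d c b a d′ c′ b′ a′)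
  where
  scale : ∀ n w a a′ → w * (a + n * a′) ≡ w * a + n * (w * a′)
  scale = solve-∀
  linear-minus : ∀ n p q r s p′ q′ r′ s′ → (p + n * p′) - (q + n * q′) - (r + n * r′) - (s + n * s′) ≡
    p - q - r - s + n * (p′ - q′ - r′ - s′)
  linear-minus = solve-∀
  minus : ∀ n w x y z a b c d a′ b′ c′ d′ → w * (a + n * a′) - x * (b + n * b′) - y * (c + n * c′) - z * (d + n * d′) ≡
    w * a - x * b - y * c - z * d + n * (w * a′ - x * b′ - y * c′ - z * d′)
  minus n w x y z a b c d a′ b′ c′ d′ =
    trans (cong₂ _-_ (cong₂ _-_ (cong₂ _-_ (scale n w a a′) (scale n x b b′)) (scale n y c c′)) (scale n z d d′))
          (linear-minus n (w * a) (x * b) (y * c) (z * d) (w * a′) (x * b′) (y * c′) (z * d′))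
  linear-mixed : ∀ n p q r s p′ q′ r′ s′ → (p + n * p′) + (q + n * q′) - (r + n * r′) - (s + n * s′) ≡
    p + q - r - s + n * (p′ + q′ - r′ - s′)
  linear-mixed = solve-∀
  mixed : ∀ n w x y z a b c d a′ b′ c′ d′ → w * (a + n * a′) + x * (b + n * b′) - y * (c + n * c′) - z * (d + n * d′) ≡
    w * a + x * b - y * c - z * d + n * (w * a′ + x * b′ - y * c′ - z * d′)
  mixed n w x y z a b c d a′ b′ c′ d′ =
    trans (cong₂ _-_ (cong₂ _-_ (cong₂ _+_ (scale n w a a′) (scale n x b b′)) (scale n y c c′)) (scale n z d d′))
          (linear-mixed n (w * a) (x * b) (y * c) (z * d) (w * a′) (x * b′) (y * c′) (z * d′))
  linear-mixed′ : ∀ n p q r s p′ q′ r′ s′ → (p + n * p′) + (q + n * q′) + (r + n * r′) - (s + n * s′) ≡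
    p + q + r - s + n * (p′ + q′ + r′ - s′)
  linear-mixed′ = solve-∀
  mixed′ : ∀ n w x y z a b c d a′ b′ c′ d′ → w * (a + n * a′) + x * (b + n * b′) + y * (c + n * c′) - z * (d + n * d′) ≡
    w * a + x * b + y * c - z * d + n * (w * a′ + x * b′ + y * c′ - z * d′)
  mixed′ n w x y z a b c d a′ b′ c′ d′ =
    trans (cong₂ _-_ (cong₂ _+_ (cong₂ _+_ (scale n w a a′) (scale n x b b′)) (scale n y c c′)) (scale n z d d′))
          (linear-mixed′ n (w * a) (x * b) (y * c) (z * d) (w * a′) (x * b′) (y * c′) (z * d′))
  linear-plus : ∀ n p q r s p′ q′ r′ s′ → (p + n * p′) + (q + n * q′) + (r + n * r′) + (s + n * s′) ≡
    p + q + r + s + n * (p′ + q′ + r′ + s′)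
  linear-plus = solve-∀
  plus : ∀ n w x y z a b c d a′ b′ c′ d′ → w * (a + n * a′) + x * (b + n * b′) + y * (c + n * c′) + z * (d + n * d′) ≡
    w * a + x * b + y * c + z * d + n * (w * a′ + x * b′ + y * c′ + z * d′)
  plus n w x y z a b c d a′ b′ c′ d′ =
    trans (cong₂ _+_ (cong₂ _+_ (cong₂ _+_ (scale n w a a′) (scale n x b b′)) (scale n y c c′)) (scale n z d d′))
          (linear-plus n (w * a) (x * b) (y * c) (z * d) (w * a′) (x * b′) (y * c′) (z * d′))

conjugate-+[] : ∀ n α β → conjugate (α +[ n ] β) ≡ conjugate α +[ n ] conjugate β
conjugate-+[] n ⟨ a , b , c , d ⟩ ⟨ a′ , b′ , c′ , d′ ⟩ = ⟨⟩-≡ refl (negate n d d′) (negate n c c′) (negate n b b′)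
  where
  negate : ∀ n x y → - (x + n * y) ≡ - x + n * - y
  negate = solve-∀

_ζ^_ : ℤ[ζ] → ℕ → ℤ[ζ]
α ζ^ zero  = α
α ζ^ suc k = ⟨ 0ℤ , 1ℤ , 0ℤ , 0ℤ ⟩ ⊗ (α ζ^ k)

norm-ζ^ : ∀ α k → norm (α ζ^ k) ≡ norm α
norm-ζ^ α zero    = refl
norm-ζ^ α (suc k) = trans (norm-⊗ ⟨ 0ℤ , 1ℤ , 0ℤ , 0ℤ ⟩ (α ζ^ k)) (trans (*-identityˡ _) (norm-ζ^ α k))

-- The class of 2 + ζ + ζ² modulo 4, where 2 + ζ + ζ² is the value of 1 + x + x² + x⁸ at ζ.
Target : ℤ[ζ] → Set
Target ⟨ a , b , c , d ⟩ = (+ 4 ∣ a - + 2) × (+ 4 ∣ b - + 1) × (+ 4 ∣ c - + 1) × (+ 4 ∣ d)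

target? : ∀ α → Dec (Target α)
target? ⟨ _ , _ , _ , _ ⟩ = _ ∣? _ ×-dec _ ∣? _ ×-dec _ ∣? _ ×-dec _ ∣? _

target-+4 : ∀ α β → Target α → Target (α +[ + 4 ] β)
target-+4 ⟨ a , b , c , d ⟩ ⟨ a′ , b′ , c′ , d′ ⟩ (2∣ , 1∣ , 1∣′ , 0∣) =
  shift (+ 2) a a′ 2∣ , shift (+ 1) b b′ 1∣ , shift (+ 1) c c′ 1∣′ , shift₀ d′ 0∣
  where
  shift₀ : ∀ {x} y → + 4 ∣ x → + 4 ∣ x + + 4 * y
  shift₀ {x} y (divides q refl) = divides (q + y) (identity q y)
    where
    identity : ∀ q y → q * + 4 + + 4 * y ≡ (q + y) * + 4
    identity = solve-∀
  shift : ∀ c x y → + 4 ∣ x - c → + 4 ∣ x + + 4 * y - c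
  shift c x y 4∣ = subst (+ 4 ∣_) (identity x y c) (shift₀ y 4∣)
    where
    identity : ∀ x y c → x - c + + 4 * y ≡ x + + 4 * y - c
    identity = solve-∀

target∈S16 : ∀ α → Target α → InS16 (+ 32 * norm α)
target∈S16 ⟨ a , b , c , d ⟩ (divides m₀ a≡ , divides m₁ b≡ , divides m₂ c≡ , divides m₃ d≡) =
  subst (λ α → InS16 (+ 32 * norm α)) (sym (⟨⟩-≡ (solve (+ 2) a m₀ a≡) (solve (+ 1) b m₁ b≡) (solve (+ 1) c m₂ c≡) (trans d≡ (*-comm m₃ (+ 4)))))
        (cyclotomic∈S16 m₀ m₁ m₂ m₃)
  where
  solve : ∀ r x m → x - r ≡ m * + 4 → x ≡ r + + 4 * m
  solve r x m eq = trans (identity r x) (cong (λ y → r + y) (trans eq (*-comm m (+ 4))))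
    where
    identity : ∀ r x → x ≡ r + (x - r)
    identity = solve-∀

ν₁ ν₃ : ℤ[ζ]
ν₁ = ⟨ 1ℤ , 1ℤ , 0ℤ , 0ℤ ⟩
ν₃ = ⟨ 1ℤ , 0ℤ , 0ℤ , 1ℤ ⟩

-- Multiplication by an associate of 1 + ζ or 1 + ζ³, both of norm 2, leads to the target class.
Normalisable : ℤ[ζ] → Set
Normalisable α = ∃ λ (k : Fin 8) → Target ((ν₁ ζ^ toℕ k) ⊗ α) ⊎ Target ((ν₃ ζ^ toℕ k) ⊗ α)

normalisable-+4 : ∀ α β → Normalisable α → Normalisable (α +[ + 4 ] β)
normalisable-+4 α β (k , inj₁ t) = k , inj₁ (subst Target (sym (⊗-+[] (+ 4) (ν₁ ζ^ toℕ k) α β)) (target-+4 _ ((ν₁ ζ^ toℕ k) ⊗ β) t))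
normalisable-+4 α β (k , inj₂ t) = k , inj₂ (subst Target (sym (⊗-+[] (+ 4) (ν₃ ζ^ toℕ k) α β)) (target-+4 _ ((ν₃ ζ^ toℕ k) ⊗ β) t))

normalisable∈S16 : ∀ α → Normalisable α → InS16 (+ 64 * norm α)
normalisable∈S16 α (k , t) = cases t
  where
  double : ∀ ν → norm ν ≡ + 2 → + 32 * norm ((ν ζ^ toℕ k) ⊗ α) ≡ + 64 * norm α
  double ν norm≡2 = trans (cong (+ 32 *_) (trans (norm-⊗ (ν ζ^ toℕ k) α) (cong (_* norm α) (trans (norm-ζ^ ν (toℕ k)) norm≡2)))) (identity (norm α))
    where
    identity : ∀ x → + 32 * (+ 2 * x) ≡ + 64 * x
    identity = solve-∀
  cases : Target ((ν₁ ζ^ toℕ k) ⊗ α) ⊎ Target ((ν₃ ζ^ toℕ k) ⊗ α) → InS16 (+ 64 * norm α)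
  cases (inj₁ t) = subst InS16 (double ν₁ refl) (target∈S16 ((ν₁ ζ^ toℕ k) ⊗ α) t)
  cases (inj₂ t) = subst InS16 (double ν₃ refl) (target∈S16 ((ν₃ ζ^ toℕ k) ⊗ α) t)

normalisable? : ∀ α → Dec (Normalisable α)
normalisable? α = Fin.any? λ k → target? _ ⊎-dec target? _

-- For integers x, the condition x ≡ ±3 (mod 8) is equivalent to x² ≡ 9 (mod 16).
classes : ∀ (a b c d : Fin 4) → let α = ⟨ + toℕ a , + toℕ b , + toℕ c , + toℕ d ⟩; x = re α + im α; y = re α - im α in
  + 16 ∣ x * x - + 9 → + 16 ∣ y * y - + 9 → Normalisable α ⊎ Normalisable (conjugate α)
classes = from-yes (Fin.all? λ (a : Fin 4) → Fin.all? λ (b : Fin 4) → Fin.all? λ (c : Fin 4) → Fin.all? λ (d : Fin 4) →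
  let α = ⟨ + toℕ a , + toℕ b , + toℕ c , + toℕ d ⟩; x = re α + im α; y = re α - im α in
  + 16 ∣? (x * x - + 9) →-dec (+ 16 ∣? (y * y - + 9) →-dec (normalisable? α ⊎-dec normalisable? (conjugate α))))

fromFin : ∀ {n} (a b c d : Fin n) → ℤ[ζ]
fromFin a b c d = ⟨ + toℕ a , + toℕ b , + toℕ c , + toℕ d ⟩

data Residues (n : ℕ) : ℤ[ζ] → Set where
  reduced : ∀ (a b c d : Fin n) β → Residues n (fromFin a b c d +[ + n ] β)

residues : ∀ n .{{_ : ℕ.NonZero n}} α → Residues n α
residues n ⟨ a , b , c , d ⟩ = combine (residue n a) (residue n b) (residue n c) (residue n d)
  where
  combine : ∀ {a b c d} → (∃₂ λ (r : Fin n) q → a ≡ + toℕ r + + n * q) → (∃₂ λ (r : Fin n) q → b ≡ + toℕ r + + n * q) →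
    (∃₂ λ (r : Fin n) q → c ≡ + toℕ r + + n * q) → (∃₂ λ (r : Fin n) q → d ≡ + toℕ r + + n * q) → Residues n ⟨ a , b , c , d ⟩
  combine (r , a′ , refl) (s , b′ , refl) (t , c′ , refl) (u , d′ , refl) = reduced r s t u ⟨ a′ , b′ , c′ , d′ ⟩

-- The relative norm is built from squares and doubled products, so a change of α by a multiple of 4
-- changes it by a multiple of 8. Thus a condition modulo 8 on the relative norm is one on α modulo
-- 4.
re-+4 : ∀ α β → ∃ λ k → re (α +[ + 4 ] β) ≡ re α + + 8 * k
re-+4 ⟨ a , b , c , d ⟩ ⟨ a′ , b′ , c′ , d′ ⟩ = _ , identity a b c d a′ b′ c′ d′
  where
  identity : ∀ a b c d a′ b′ c′ d′ →
    (a + + 4 * a′) * (a + + 4 * a′) - (c + + 4 * c′) * (c + + 4 * c′) + + 2 * ((b + + 4 * b′) * (d + + 4 * d′)) ≡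
    a * a - c * c + + 2 * (b * d) +
    + 8 * (a * a′ + + 2 * (a′ * a′) - c * c′ - + 2 * (c′ * c′) + b * d′ + b′ * d + + 4 * (b′ * d′))
  identity = solve-∀

im-+4 : ∀ α β → ∃ λ k → im (α +[ + 4 ] β) ≡ im α + + 8 * k
im-+4 ⟨ a , b , c , d ⟩ ⟨ a′ , b′ , c′ , d′ ⟩ = _ , identity a b c d a′ b′ c′ d′
  where
  identity : ∀ a b c d a′ b′ c′ d′ →
    + 2 * ((a + + 4 * a′) * (c + + 4 * c′)) - (b + + 4 * b′) * (b + + 4 * b′) + (d + + 4 * d′) * (d + + 4 * d′) ≡
    + 2 * (a * c) - b * b + d * d +
    + 8 * (a * c′ + a′ * c + + 4 * (a′ * c′) - b * b′ - + 2 * (b′ * b′) + d * d′ + + 2 * (d′ * d′))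
  identity = solve-∀

±3⇒square : ∀ x y k → Is8m±3 x → x ≡ y + + 8 * k → + 16 ∣ y * y - + 9
±3⇒square x y k (m , inj₁ x≡) x≡′ = divides ((m - k) * (+ 4 * (m - k) + + 3)) (trans (cong (λ z → z * z - + 9) y≡) (identity m k))
  where
  y≡ : y ≡ + 8 * m + + 3 - + 8 * k
  y≡ = trans (cancel y k) (cong (_- + 8 * k) (trans (sym x≡′) x≡))
    where
    cancel : ∀ y k → y ≡ y + + 8 * k - + 8 * k
    cancel = solve-∀
  identity : ∀ m k → (+ 8 * m + + 3 - + 8 * k) * (+ 8 * m + + 3 - + 8 * k) - + 9 ≡ ((m - k) * (+ 4 * (m - k) + + 3)) * + 16
  identity = solve-∀
±3⇒square x y k (m , inj₂ x≡) x≡′ = divides ((m - k) * (+ 4 * (m - k) - + 3)) (trans (cong (λ z → z * z - + 9) y≡) (identity m k))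
  where
  y≡ : y ≡ + 8 * m - + 3 - + 8 * k
  y≡ = trans (cancel y k) (cong (_- + 8 * k) (trans (sym x≡′) x≡))
    where
    cancel : ∀ y k → y ≡ y + + 8 * k - + 8 * k
    cancel = solve-∀
  identity : ∀ m k → (+ 8 * m - + 3 - + 8 * k) * (+ 8 * m - + 3 - + 8 * k) - + 9 ≡ ((m - k) * (+ 4 * (m - k) - + 3)) * + 16
  identity = solve-∀

64*norm∈S16 : ∀ α → Is8m±3 (re α + im α) → Is8m±3 (re α - im α) → InS16 (+ 64 * norm α)
64*norm∈S16 α = reduce (residues 4 α)
  where
  conclude : ∀ ρ β → Normalisable ρ ⊎ Normalisable (conjugate ρ) → InS16 (+ 64 * norm (ρ +[ + 4 ] β))
  conclude ρ β (inj₁ n) = normalisable∈S16 (ρ +[ + 4 ] β) (normalisable-+4 ρ β n)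
  conclude ρ β (inj₂ n) = subst (λ x → InS16 (+ 64 * x)) (norm-conjugate (ρ +[ + 4 ] β))
    (normalisable∈S16 (conjugate (ρ +[ + 4 ] β)) (subst Normalisable (sym (conjugate-+[] (+ 4) ρ β)) (normalisable-+4 (conjugate ρ) (conjugate β) n)))

  sum-≡ : ∀ x y k l → x + + 8 * k + (y + + 8 * l) ≡ x + y + + 8 * (k + l)
  sum-≡ = solve-∀
  difference-≡ : ∀ x y k l → x + + 8 * k - (y + + 8 * l) ≡ x - y + + 8 * (k - l)
  difference-≡ = solve-∀

  reduce : ∀ {α} → Residues 4 α → Is8m±3 (re α + im α) → Is8m±3 (re α - im α) → InS16 (+ 64 * norm α)
  reduce (reduced r s t u β) sum difference = conclude ρ β (classes r s t u
    (±3⇒square (re γ + im γ) (re ρ + im ρ) (k + l) sum (trans (cong₂ _+_ (proj₂ (re-+4 ρ β)) (proj₂ (im-+4 ρ β))) (sum-≡ (re ρ) (im ρ) k l)))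
    (±3⇒square (re γ - im γ) (re ρ - im ρ) (k - l) difference (trans (cong₂ _-_ (proj₂ (re-+4 ρ β)) (proj₂ (im-+4 ρ β))) (difference-≡ (re ρ) (im ρ) k l))))
    where
    ρ γ : ℤ[ζ]
    ρ = fromFin r s t u
    γ = ρ +[ + 4 ] β
    k l : ℤ
    k = proj₁ (re-+4 ρ β)
    l = proj₁ (im-+4 ρ β)

-- Primes represented by x² + y² and x² + 2y²

module Congruence (n : ℤ) where

  infix 4 _≈_
  -- A record, so that `a` and `b` can be inferred from a congruence; they could not be recovered
  -- from the difference `a - b`.
  record _≈_ (a b : ℤ) : Set where
    constructor congruent
    field difference : n ∣ a - b
  open _≈_ public

  ≈-reflexive : ∀ {a b} → a ≡ b → a ≈ b
  ≈-reflexive {a} refl = congruent (divides 0ℤ (identity a))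
    where
    identity : ∀ a → a - a ≡ 0ℤ
    identity = solve-∀

  ≈-refl : ∀ {a} → a ≈ a
  ≈-refl = ≈-reflexive refl

  ≈-sym : ∀ {a b} → a ≈ b → b ≈ a
  ≈-sym {a} {b} (congruent n∣) = congruent (subst (n ∣_) (identity a b) (∣m⇒∣-m n∣))
    where
    identity : ∀ a b → - (a - b) ≡ b - a
    identity = solve-∀

  ≈-trans : ∀ {a b c} → a ≈ b → b ≈ c → a ≈ c
  ≈-trans {a} {b} {c} (congruent p) (congruent q) = congruent (subst (n ∣_) (identity a b c) (∣m∣n⇒∣m+n p q))
    where
    identity : ∀ a b c → a - b + (b - c) ≡ a - c
    identity = solve-∀

  *-cong : ∀ {a b c d} → a ≈ b → c ≈ d → a * c ≈ b * d
  *-cong {a} {b} {c} {d} (congruent p) (congruent q) = congruent (subst (n ∣_) (identity a b c d) (∣m∣n⇒∣m+n (∣m⇒∣m*n c p) (∣n⇒∣m*n b q)))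
    where
    identity : ∀ a b c d → (a - b) * c + b * (c - d) ≡ a * c - b * d
    identity = solve-∀

  ^-cong : ∀ {a b} k → a ≈ b → a ^ k ≈ b ^ k
  ^-cong zero    a≈b = ≈-refl
  ^-cong (suc k) a≈b = *-cong a≈b (^-cong k a≈b)

  ≈0⇒∣ : ∀ {a} → a ≈ 0ℤ → n ∣ a
  ≈0⇒∣ (congruent n∣) = subst (n ∣_) (+-identityʳ _) n∣

  ∣⇒≈0 : ∀ {a} → n ∣ a → a ≈ 0ℤ
  ∣⇒≈0 n∣ = congruent (subst (n ∣_) (sym (+-identityʳ _)) n∣)

module PrimeModulus {p : ℕ} (pr : Prime p) where

  open Congruence (+ p) public

  p∤1 : ¬ + p ∣ 1ℤ
  p∤1 p∣1 = ¬prime[1] (subst Prime (ℕ.∣1⇒≡1 (∣⇒∣ᵤ p∣1)) pr)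

  euclid : ∀ a b → + p ∣ a * b → (+ p ∣ a) ⊎ (+ p ∣ b)
  euclid a b p∣ab = Sum.map ∣ᵤ⇒∣ ∣ᵤ⇒∣ (euclidsLemma ∣ a ∣ ∣ b ∣ pr (subst (p ℕ.∣_) (abs-* a b) (∣⇒∣ᵤ p∣ab)))

  cancel : ∀ c {a b} → ¬ + p ∣ c → c * a ≈ c * b → a ≈ b
  cancel c {a} {b} p∤c (congruent p∣) = [ (λ p∣c → contradiction p∣c p∤c) , congruent ]′ (euclid c (a - b) (subst (+ p ∣_) (identity a b c) p∣))
    where
    identity : ∀ a b c → c * a - c * b ≡ c * (a - b)
    identity = solve-∀

-- Gauss's lemma for 2: the h = (p - 1)/2 products 2, 4, …, 2h are congruent to the even numbers up to h and the
-- negatives of the odd numbers up to h.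
factorial evens -odds : ℕ → ℤ
factorial zero    = 1ℤ
factorial (suc n) = + suc n * factorial n
evens zero        = 1ℤ
evens (suc n)     = + 2 * + suc n * evens n
-odds zero        = 1ℤ
-odds (suc n)     = - (+ 2 * + n + 1ℤ) * -odds n

evens≡2^n*n! : ∀ n → evens n ≡ (+ 2) ^ n * factorial n
evens≡2^n*n! zero    = refl
evens≡2^n*n! (suc n) = trans (cong (+ 2 * + suc n *_) (evens≡2^n*n! n)) (identity (+ suc n) ((+ 2) ^ n) (factorial n))
  where
  identity : ∀ a b c → + 2 * a * (b * c) ≡ + 2 * b * (a * c)
  identity = solve-∀

-- The even and the odd numbers up to 2n make up (2n)!, with one sign for each odd number. This
-- version and the next, with one odd number more, cover even and odd h.
evens*-odds : ∀ n → evens n * -odds n ≡ sign n * factorial (n ℕ.+ n)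
evens*-odds-suc : ∀ n → evens n * -odds (suc n) ≡ sign (suc n) * factorial (suc (n ℕ.+ n))
evens*-odds zero    = refl
evens*-odds (suc n) = begin
  + 2 * + suc n * evens n * -odds (suc n)                          ≡⟨ assoc (+ 2 * + suc n) (evens n) (-odds (suc n)) ⟩
  + 2 * + suc n * (evens n * -odds (suc n))                        ≡⟨ cong (+ 2 * + suc n *_) (evens*-odds-suc n) ⟩
  + 2 * + suc n * (sign (suc n) * factorial (suc (n ℕ.+ n)))       ≡⟨ swap (+ 2 * + suc n) (sign (suc n)) _ ⟩
  sign (suc n) * (+ 2 * + suc n * factorial (suc (n ℕ.+ n)))       ≡⟨ cong (λ x → sign (suc n) * (x * factorial (suc (n ℕ.+ n))))
                                                                             (trans (sym (pos-* 2 (suc n))) (cong (λ k → + (suc n ℕ.+ k)) (ℕ.+-identityʳ (suc n)))) ⟩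
  sign (suc n) * (+ (suc n ℕ.+ suc n) * factorial (suc (n ℕ.+ n))) ≡⟨ cong (λ k → sign (suc n) * (+ suc k * factorial (suc (n ℕ.+ n)))) (ℕ.+-suc n n) ⟩
  sign (suc n) * factorial (suc (suc (n ℕ.+ n)))                   ≡⟨ cong (λ k → sign (suc n) * factorial (suc k)) (ℕ.+-suc n n) ⟨
  sign (suc n) * factorial (suc n ℕ.+ suc n) ∎
  where
  assoc : ∀ a b c → a * b * c ≡ a * (b * c)
  assoc = solve-∀
  swap : ∀ a b c → a * (b * c) ≡ b * (a * c)
  swap = solve-∀
evens*-odds-suc n = begin
  evens n * (- (+ 2 * + n + 1ℤ) * -odds n)                         ≡⟨ swap (evens n) (+ 2 * + n + 1ℤ) (-odds n) ⟩
  - ((+ 2 * + n + 1ℤ) * (evens n * -odds n))                       ≡⟨ cong₂ (λ x y → - (x * y)) (suc-≡ n) (evens*-odds n) ⟩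
  - (+ suc (n ℕ.+ n) * (sign n * factorial (n ℕ.+ n)))             ≡⟨ swap′ (+ suc (n ℕ.+ n)) (sign n) (factorial (n ℕ.+ n)) ⟩
  sign (suc n) * factorial (suc (n ℕ.+ n)) ∎
  where
  swap : ∀ a b c → a * (- b * c) ≡ - (b * (a * c))
  swap = solve-∀
  swap′ : ∀ a b c → - (a * (b * c)) ≡ - b * (a * c)
  swap′ = solve-∀
  suc-≡ : ∀ n → + 2 * + n + 1ℤ ≡ + suc (n ℕ.+ n)
  suc-≡ n = trans (cong (_+ 1ℤ) (trans (sym (pos-* 2 n)) (cong (λ k → + (n ℕ.+ k)) (ℕ.+-identityʳ n)))) (+-comm (+ (n ℕ.+ n)) 1ℤ)

sign-odd : ∀ j → sign (suc (j ℕ.+ j)) ≡ -1ℤ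
sign-odd zero    = refl
sign-odd (suc j) rewrite ℕ.+-suc j j | sign-odd j = refl

module _ {p : ℕ} (pr : Prime p) where

  open PrimeModulus pr

  p∤factorial : ∀ n → n ℕ.< p → ¬ + p ∣ factorial n
  p∤factorial zero    _   p∣1 = p∤1 p∣1
  p∤factorial (suc n) n<p p∣! = Sum.[ (λ p∣n → ℕ.<⇒≱ n<p (ℕ.∣⇒≤ (∣⇒∣ᵤ p∣n))) , p∤factorial n (ℕ.<-trans (ℕ.n<1+n n) n<p) ]
    (euclid (+ suc n) (factorial n) p∣!)

  -- The largest even factors are replaced one by one: if n + 1 + s = h, then 2(n + 1) - p = -(2s +
  -- 1).
  evens≈ : ∀ h n s → p ≡ suc (h ℕ.+ h) → n ℕ.+ s ≡ h → evens h ≈ evens n * -odds s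
  evens≈ h n zero    p≡ n+s≡h rewrite trans (sym (ℕ.+-identityʳ n)) n+s≡h = ≈-reflexive (sym (*-identityʳ (evens h)))
  evens≈ h n (suc s) p≡ n+s≡h = ≈-trans (evens≈ h (suc n) s p≡ (trans (sym (ℕ.+-suc n s)) n+s≡h))
    (congruent (divides (evens n * -odds s) (trans (identity (+ suc n) (+ s) (evens n) (-odds s)) (cong (evens n * -odds s *_) (sym +p≡)))))
    where
    +p≡ : + p ≡ + 1 + + 2 * (+ suc n + + s)
    +p≡ = begin
      + p                              ≡⟨ cong +_ p≡ ⟩
      + 1 + + (h ℕ.+ h)                ≡⟨ cong (λ k → + 1 + + (h ℕ.+ k)) (ℕ.+-identityʳ h) ⟨
      + 1 + + (2 ℕ.* h)                ≡⟨ cong (λ x → + 1 + x) (pos-* 2 h) ⟩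
      + 1 + + 2 * + h                  ≡⟨ cong (λ k → + 1 + + 2 * + k) (trans (sym n+s≡h) (ℕ.+-suc n s)) ⟩
      + 1 + + 2 * (+ suc n + + s)      ∎
    identity : ∀ n s E O → + 2 * n * E * O - E * (- (+ 2 * s + 1ℤ) * O) ≡ E * O * (+ 1 + + 2 * (n + s))
    identity = solve-∀

  -- Both 2ʰ h! and -h! are congruent to the product 2 · 4 ⋯ 2h, and h! can be cancelled because h <
  -- p.
  gauss : ∀ h n s → p ≡ suc (h ℕ.+ h) → n ℕ.+ s ≡ h → evens n * -odds s ≡ - factorial h → (+ 2) ^ h ≈ -1ℤ
  gauss h n s p≡ n+s≡h product≡ = cancel (factorial h) (p∤factorial h h<p) (≈-trans
    (≈-reflexive (trans (*-comm (factorial h) _) (sym (evens≡2^n*n! h))))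
    (≈-trans (evens≈ h n s p≡ n+s≡h) (≈-reflexive (trans product≡ (identity (factorial h))))))
    where
    h<p : h ℕ.< p
    h<p = subst (h ℕ.<_) (sym p≡) (s≤s (ℕ.m≤m+n h h))
    identity : ∀ x → - x ≡ x * -1ℤ
    identity = solve-∀

  -- For p = 8j + 5 one has h = 2n with n = 2j + 1. The number n of odd factors is odd, so 2ʰ ≡ -1,
  -- and 2ⁿ is an explicit square root of -1.
  -1-residue : p % 8 ≡ 5 → ∃ λ t → + p ∣ t * t + + 1
  -1-residue p%8≡5 = (+ 2) ^ n , subst (+ p ∣_) square (difference (gauss h n n p≡ refl product≡))
    where
    j = p / 8
    n = suc (j ℕ.+ j)
    h = n ℕ.+ n
    p≡ : p ≡ suc (h ℕ.+ h)
    p≡ = trans (m≡m%n+[m/n]*n p 8) (trans (cong (ℕ._+ j ℕ.* 8) p%8≡5) (identity j))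
      where
      identity : ∀ j → 5 ℕ.+ j ℕ.* 8 ≡ suc (suc (j ℕ.+ j) ℕ.+ suc (j ℕ.+ j) ℕ.+ (suc (j ℕ.+ j) ℕ.+ suc (j ℕ.+ j)))
      identity = ℕ-solve-∀
    product≡ : evens n * -odds n ≡ - factorial h
    product≡ = trans (evens*-odds n) (trans (cong (_* factorial h) (sign-odd j)) (-1*i≡-i (factorial h)))
    square : (+ 2) ^ h - -1ℤ ≡ (+ 2) ^ n * (+ 2) ^ n + + 1
    square = cong (_+ + 1) (^-distribˡ-+-* (+ 2) n n)

  -- For p = 8j + 3 one has h = 4j + 1, with s = 2j + 1 odd factors, so 2ʰ ≡ -1. As h + 1 = 2s, the
  -- square of 2ˢ is ≡ -2.
  -2-residue : p % 8 ≡ 3 → ∃ λ t → + p ∣ t * t + + 2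
  -2-residue p%8≡3 = (+ 2) ^ s , subst (+ p ∣_) square (∣n⇒∣m*n (+ 2) (difference (gauss h n s p≡ (ℕ.+-suc n n) product≡)))
    where
    j = p / 8
    n = j ℕ.+ j
    s = suc n
    h = suc (n ℕ.+ n)
    p≡ : p ≡ suc (h ℕ.+ h)
    p≡ = trans (m≡m%n+[m/n]*n p 8) (trans (cong (ℕ._+ j ℕ.* 8) p%8≡3) (identity j))
      where
      identity : ∀ j → 3 ℕ.+ j ℕ.* 8 ≡ suc (suc (j ℕ.+ j ℕ.+ (j ℕ.+ j)) ℕ.+ suc (j ℕ.+ j ℕ.+ (j ℕ.+ j)))
      identity = ℕ-solve-∀
    product≡ : evens n * -odds s ≡ - factorial h
    product≡ = trans (evens*-odds-suc n) (trans (cong (_* factorial h) (sign-odd j)) (-1*i≡-i (factorial h)))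
    square : + 2 * ((+ 2) ^ h - -1ℤ) ≡ (+ 2) ^ s * (+ 2) ^ s + + 2
    square = trans (cong (λ x → + 2 * (+ 2 * x - -1ℤ)) (^-distribˡ-+-* (+ 2) n n)) (identity ((+ 2) ^ n))
      where
      identity : ∀ x → + 2 * (+ 2 * (x * x) - -1ℤ) ≡ (+ 2 * x) * (+ 2 * x) + + 2
      identity = solve-∀

%ℕ-≡⇒∣ : ∀ n .{{_ : ℕ.NonZero n}} a b → a %ℕ n ≡ b %ℕ n → + n ∣ a - b
%ℕ-≡⇒∣ n a b a%n≡b%n = divides (a /ℕ n - b /ℕ n) (begin
  a - b                                                                     ≡⟨ cong₂ _-_ (a≡a%ℕn+[a/ℕn]*n a n) (a≡a%ℕn+[a/ℕn]*n b n) ⟩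
  + (a %ℕ n) + a /ℕ n * + n - (+ (b %ℕ n) + b /ℕ n * + n)                   ≡⟨ cong (λ r → + r + a /ℕ n * + n - (+ (b %ℕ n) + b /ℕ n * + n)) a%n≡b%n ⟩
  + (b %ℕ n) + a /ℕ n * + n - (+ (b %ℕ n) + b /ℕ n * + n)                   ≡⟨ identity (+ (b %ℕ n)) (a /ℕ n) (b /ℕ n) (+ n) ⟩
  (a /ℕ n - b /ℕ n) * + n                                                   ∎)
  where
  identity : ∀ r x y n → r + x * n - (r + y * n) ≡ (x - y) * n
  identity = solve-∀

funToFin-cong : ∀ {m n} (f g : Fin n → Fin m) → (∀ i → f i ≡ g i) → funToFin f ≡ funToFin g
funToFin-cong {n = zero}  f g f≡g = refl
funToFin-cong {n = suc n} f g f≡g = cong₂ Fin.combine (f≡g zero) (funToFin-cong (f ∘ suc) (g ∘ suc) (f≡g ∘ suc))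

finToFun-injective : ∀ {m n} (i j : Fin (m ℕ.^ n)) → (∀ l → finToFun {m} {n} i l ≡ finToFun j l) → i ≡ j
finToFun-injective {m} {n} i j eq = trans (sym (Fin.funToFin-finToFin {n} {m} i))
  (trans (funToFin-cong (finToFun {m} {n} i) (finToFun j) eq) (Fin.funToFin-finToFin {n} {m} j))

-- Siegel's lemma for a single congruence, by the pigeonhole principle on the box {0, …, q}ᵏ.
small-solution : ∀ n .{{_ : ℕ.NonZero n}} k q → n ℕ.< suc q ℕ.^ k → (c : Fin k → ℤ) →
  ∃ λ (z : Fin k → ℤ) → (∃ λ i → z i ≢ 0ℤ) × (∀ i → ∣ z i ∣ ℕ.≤ q) × + n ∣ sumFin k (λ i → c i * z i)
small-solution n k q n<q^k c with Fin.pigeonhole n<q^k (λ x → fromℕ< (n%ℕd<d (sumFin k (λ i → c i * + toℕ (finToFun {suc q} {k} x i))) n))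
... | x , y , x<y , fx≡fy = z , nonzero , small , divisible
  where
  u v z : Fin k → ℤ
  u i = + toℕ (finToFun {suc q} {k} x i)
  v i = + toℕ (finToFun {suc q} {k} y i)
  z i = u i - v i

  nonzero : ∃ λ i → z i ≢ 0ℤ
  nonzero with Fin.any? (λ i → ¬? (z i ≟ 0ℤ))
  ... | yes found = found
  ... | no  none  = contradiction (cong toℕ (finToFun-injective {suc q} {k} x y λ i →
    Fin.toℕ-injective (+-injective (i-j≡0⇒i≡j (u i) (v i) (decidable-stable (z i ≟ 0ℤ) (λ z≢0 → none (i , z≢0))))))) (ℕ.<⇒≢ x<y)

  small : ∀ i → ∣ z i ∣ ℕ.≤ q
  small i = ℕ.≤-trans (ℕ.≤-reflexive (cong ∣_∣ (m-n≡m⊖n (toℕ (finToFun {suc q} {k} x i)) (toℕ (finToFun {suc q} {k} y i)))))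
    (ℕ.≤-trans (∣m⊝n∣≤m⊔n (toℕ (finToFun {suc q} {k} x i)) (toℕ (finToFun {suc q} {k} y i)))
      (ℕ.⊔-lub (Fin.toℕ≤pred[n] (finToFun {suc q} {k} x i)) (Fin.toℕ≤pred[n] (finToFun {suc q} {k} y i))))

  divisible : + n ∣ sumFin k (λ i → c i * z i)
  divisible = subst (+ n ∣_) (begin
    sumFin k (λ i → c i * u i) - sumFin k (λ i → c i * v i)                   ≡⟨ cong (λ s → sumFin k (λ i → c i * u i) + s)
                                                                                      (trans (negate _) (sym (sumFin-* k -1ℤ (λ i → c i * v i)))) ⟩
    sumFin k (λ i → c i * u i) + sumFin k (λ i → -1ℤ * (c i * v i))           ≡⟨ sumFin-+ k (λ i → c i * u i) (λ i → -1ℤ * (c i * v i)) ⟨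
    sumFin k (λ i → c i * u i + -1ℤ * (c i * v i))                            ≡⟨ sumFin-cong k (λ i → identity (c i) (u i) (v i)) ⟩
    sumFin k (λ i → c i * z i)                                                ∎)
    (%ℕ-≡⇒∣ n (sumFin k (λ i → c i * u i)) (sumFin k (λ i → c i * v i)) (trans (sym (Fin.toℕ-fromℕ< _)) (trans (cong toℕ fx≡fy) (Fin.toℕ-fromℕ< _))))
    where
    negate : ∀ x → - x ≡ -1ℤ * x
    negate = solve-∀
    identity : ∀ c u v → c * u + -1ℤ * (c * v) ≡ c * (u - v)
    identity = solve-∀

root : ∀ k .{{_ : ℕ.NonZero k}} n → ∃ λ q → q ℕ.^ k ℕ.≤ n × n ℕ.< suc q ℕ.^ k
root k@(suc _) zero    = zero , z≤n , ℕ.≤-reflexive (sym (ℕ.^-zeroˡ k))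
root k         (suc n) with root k n
... | q , q^k≤n , n<q+1^k with suc q ℕ.^ k ℕ.≤? suc n
...   | no  big   = q , ℕ.m≤n⇒m≤1+n q^k≤n , ℕ.≰⇒> big
...   | yes small = suc q , small , ℕ.<-≤-trans (s≤s n<q+1^k) (ℕ.^-monoˡ-< k (ℕ.n<1+n (suc q)))

-- Makes the bounds q² ≤ p and q⁴ ≤ p for the integral roots strict, which keeps the multiplier k
-- below 1 + d and below 16 respectively.
prime≢square : ∀ {p} → Prime p → ∀ q → q ℕ.* q ≢ p
prime≢square {p} pr q q*q≡p with prime⇒irreducible pr (ℕ.divides q (sym q*q≡p))
... | inj₁ refl = ¬prime[1] (subst Prime (sym q*q≡p) pr)
... | inj₂ refl = ¬prime[1] (subst Prime (ℕ.*-cancelˡ-≡ q 1 q (trans q*q≡p (sym (ℕ.*-identityʳ q)))) pr)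
  where instance _ = prime⇒nonZero pr

square-abs : ∀ a → a * a ≡ + (∣ a ∣ ℕ.* ∣ a ∣)
square-abs (+ n)    = sym (pos-* n n)
square-abs -[1+ n ] = refl

module _ {p : ℕ} (pr : Prime p) where

  open PrimeModulus pr
  private instance _ = prime⇒nonZero pr

  -- Divisibility comes from x² + dy² = (x + ty)(x - ty) + (t² + d)y², and the bound on k from x²,
  -- y² < p.
  small-form : ∀ d .{{_ : ℕ.NonZero d}} t q x y → + p ∣ t * t + + d → + p ∣ x + t * y → q ℕ.* q ℕ.< p →
    ∣ x ∣ ℕ.≤ q → ∣ y ∣ ℕ.≤ q → (x ≢ 0ℤ) ⊎ (y ≢ 0ℤ) →
    ∃ λ k → 0 ℕ.< k × k ℕ.< suc d × x * x + + d * (y * y) ≡ + k * + p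
  small-form d t q x y p∣t²+d p∣x+ty q²<p x≤q y≤q nonzero = conclude (∣⇒∣ᵤ p∣form)
    where
    X = ∣ x ∣
    Y = ∣ y ∣
    N = X ℕ.* X ℕ.+ d ℕ.* (Y ℕ.* Y)

    form≡N : x * x + + d * (y * y) ≡ + N
    form≡N = begin
      x * x + + d * (y * y)                            ≡⟨ cong₂ (λ a b → a + + d * b) (square-abs x) (square-abs y) ⟩
      + (X ℕ.* X) + + d * + (Y ℕ.* Y)                  ≡⟨ cong (λ b → + (X ℕ.* X) + b) (pos-* d (Y ℕ.* Y)) ⟨
      + (X ℕ.* X) + + (d ℕ.* (Y ℕ.* Y))                ≡⟨ pos-+ (X ℕ.* X) (d ℕ.* (Y ℕ.* Y)) ⟨
      + N                                              ∎

    p∣form : + p ∣ + N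
    p∣form = subst (+ p ∣_) (trans (identity x y t (+ d)) form≡N)
      (∣m∣n⇒∣m+n (∣m⇒∣m*n (x - t * y) p∣x+ty) (∣m⇒∣m*n (y * y) p∣t²+d))
      where
      identity : ∀ x y t d → (x + t * y) * (x - t * y) + (t * t + d) * (y * y) ≡ x * x + d * (y * y)
      identity = solve-∀

    N<[1+d]p : N ℕ.< suc d ℕ.* p
    N<[1+d]p = ℕ.+-mono-<-≤ (below x≤q) (ℕ.*-monoʳ-≤ d (ℕ.<⇒≤ (below y≤q)))
      where
      below : ∀ {m} → m ℕ.≤ q → m ℕ.* m ℕ.< p
      below m≤q = ℕ.≤-<-trans (ℕ.*-mono-≤ m≤q m≤q) q²<p

    conclude : p ℕ.∣ N → ∃ λ k → 0 ℕ.< k × k ℕ.< suc d × x * x + + d * (y * y) ≡ + k * + p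
    conclude (ℕ.divides k N≡kp) = k , positive k N≡kp , ℕ.*-cancelʳ-< p k (suc d) (subst (ℕ._< suc d ℕ.* p) N≡kp N<[1+d]p) ,
      trans form≡N (trans (cong +_ N≡kp) (pos-* k p))
      where
      positive : ∀ k → N ≡ k ℕ.* p → 0 ℕ.< k
      positive (suc k) _   = s≤s z≤n
      positive zero    N≡0 = contradiction nonzero Sum.[ (λ x≢0 → x≢0 (∣i∣≡0⇒i≡0 (square-0 X X²≡0))) , (λ y≢0 → y≢0 (∣i∣≡0⇒i≡0 (square-0 Y Y²≡0))) ]
        where
        square-0 : ∀ m → m ℕ.* m ≡ 0 → m ≡ 0
        square-0 m m²≡0 = Sum.reduce (ℕ.m*n≡0⇒m≡0∨n≡0 m m²≡0)
        X²≡0 : X ℕ.* X ≡ 0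
        X²≡0 = ℕ.m+n≡0⇒m≡0 (X ℕ.* X) N≡0
        Y²≡0 : Y ℕ.* Y ≡ 0
        Y²≡0 = ℕ.m*n≡0⇒m≡0 (Y ℕ.* Y) d (trans (ℕ.*-comm (Y ℕ.* Y) d) (ℕ.m+n≡0⇒n≡0 (X ℕ.* X) N≡0))

  thue : ∀ d .{{_ : ℕ.NonZero d}} t → + p ∣ t * t + + d → ∃₂ λ x y → ∃ λ k → 0 ℕ.< k × k ℕ.< suc d × x * x + + d * (y * y) ≡ + k * + p
  thue d t p∣t²+d = from-root (root 2 p)
    where
    c : Fin 2 → ℤ
    c zero    = 1ℤ
    c (suc _) = t

    linear-≡ : ∀ x y t → 1ℤ * x + (t * y + 0ℤ) ≡ x + t * y
    linear-≡ = solve-∀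

    from-solution : ∀ q → q ℕ.* q ℕ.< p →
      (∃ λ (z : Fin 2 → ℤ) → (∃ λ i → z i ≢ 0ℤ) × (∀ i → ∣ z i ∣ ℕ.≤ q) × + p ∣ sumFin 2 (λ i → c i * z i)) →
      ∃₂ λ x y → ∃ λ k → 0 ℕ.< k × k ℕ.< suc d × x * x + + d * (y * y) ≡ + k * + p
    from-solution q q²<p (z , nonzero , small , p∣) = x , y ,
      small-form d t q x y p∣t²+d (subst (+ p ∣_) (linear-≡ x y t) p∣) q²<p (small zero) (small (suc zero)) (either nonzero)
      where
      x = z zero
      y = z (suc zero)
      either : (∃ λ i → z i ≢ 0ℤ) → (x ≢ 0ℤ) ⊎ (y ≢ 0ℤ)
      either (zero     , x≢0) = inj₁ x≢0
      either (suc zero , y≢0) = inj₂ y≢0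

    from-root : (∃ λ q → q ℕ.^ 2 ℕ.≤ p × p ℕ.< suc q ℕ.^ 2) → _
    from-root (q , q²≤p , p<[q+1]²) = from-solution q
      (ℕ.≤∧≢⇒< (subst (ℕ._≤ p) (cong (q ℕ.*_) (ℕ.*-identityʳ q)) q²≤p) (prime≢square pr q))
      (small-solution p 2 q p<[q+1]² c)

  sum-of-squares : p % 8 ≡ 5 → ∃₂ λ x y → x * x + y * y ≡ + p
  sum-of-squares p%8≡5 = conclude (thue 1 (proj₁ t) (proj₂ t))
    where
    t = -1-residue pr p%8≡5
    identity : ∀ x y → x * x + y * y ≡ x * x + + 1 * (y * y)
    identity = solve-∀
    conclude : (∃₂ λ x y → ∃ λ k → 0 ℕ.< k × k ℕ.< 2 × x * x + + 1 * (y * y) ≡ + k * + p) → ∃₂ λ x y → x * x + y * y ≡ + p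
    conclude (x , y , 1 , _ , _ , x²+y²≡p)              = x , y , trans (identity x y) (trans x²+y²≡p (*-identityˡ (+ p)))
    conclude (x , y , suc (suc _) , _ , s≤s (s≤s ()) , _)

  square-plus-twice-square : p % 8 ≡ 3 → ∃₂ λ x y → x * x + + 2 * (y * y) ≡ + p
  square-plus-twice-square p%8≡3 = conclude (thue 2 (proj₁ t) (proj₂ t))
    where
    t = -2-residue pr p%8≡3

    -- The case k = 2: x must be even, and with x = 2w division by 2 gives y² + 2w² = p, the two
    -- variables exchanging roles.
    halve : ∀ {x} y → (∃₂ λ (r : Fin 2) w → x ≡ + toℕ r + + 2 * w) → x * x + + 2 * (y * y) ≡ + 2 * + p →
      ∃₂ λ x y → x * x + + 2 * (y * y) ≡ + p
    halve y (zero , w , refl) x²+2y²≡2p = y , w , *-cancelˡ-≡ (+ 2) (y * y + + 2 * (w * w)) (+ p) (trans (identity y w) x²+2y²≡2p)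
      where
      identity : ∀ y w → + 2 * (y * y + + 2 * (w * w)) ≡ (+ 0 + + 2 * w) * (+ 0 + + 2 * w) + + 2 * (y * y)
      identity = solve-∀
    halve y (suc zero , w , refl) x²+2y²≡2p = contradiction (divides (+ p - + 2 * (w * w) - + 2 * w - y * y) odd) (toWitnessFalse {a? = + 2 ∣? 1ℤ} _)
      where
      identity : ∀ y w → 1ℤ ≡ (+ 1 + + 2 * w) * (+ 1 + + 2 * w) + + 2 * (y * y) - (+ 2 * (w * w) + + 2 * w + y * y) * + 2
      identity = solve-∀
      identity′ : ∀ p y w → + 2 * p - (+ 2 * (w * w) + + 2 * w + y * y) * + 2 ≡ (p - + 2 * (w * w) - + 2 * w - y * y) * + 2
      identity′ = solve-∀
      odd : 1ℤ ≡ (+ p - + 2 * (w * w) - + 2 * w - y * y) * + 2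
      odd = trans (identity y w) (trans (cong (_- (+ 2 * (w * w) + + 2 * w + y * y) * + 2) x²+2y²≡2p) (identity′ (+ p) y w))

    conclude : (∃₂ λ x y → ∃ λ k → 0 ℕ.< k × k ℕ.< 3 × x * x + + 2 * (y * y) ≡ + k * + p) →
      ∃₂ λ x y → x * x + + 2 * (y * y) ≡ + p
    conclude (x , y , 1 , _ , _ , x²+2y²≡p)  = x , y , trans x²+2y²≡p (*-identityˡ (+ p))
    conclude (x , y , 2 , _ , _ , x²+2y²≡2p) = halve y (residue 2 x) x²+2y²≡2p
    conclude (x , y , suc (suc (suc _)) , _ , s≤s (s≤s (s≤s ())) , _)

-- Wilson's theorem and Euler's criterion

module _ {p : ℕ} (pr : Prime p) where

  open PrimeModulus pr
  private instance _ = prime⇒nonZero pr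

  module Pairing (n : ℤ) where

    Partner : ℕ → ℕ → Set
    Partner k l = + k * + l ≈ n

    Paired : List ℕ → Set
    Paired L = ∀ {k} → k ∈ L → ∃ λ l → l ∈ L × l ≢ k × Partner k l

    Functional : List ℕ → Set
    Functional L = ∀ {k l l′} → k ∈ L → l ∈ L → l′ ∈ L → Partner k l → Partner k l′ → l ≡ l′

    partner-sym : ∀ k l → Partner k l → Partner l k
    partner-sym k l = ≈-trans (≈-reflexive (*-comm (+ l) (+ k)))

    -- The head and its partner contribute n and are removed together. What remains is still paired:
    -- by `Functional`, an element whose partner is one of the two removed would be the other one,
    -- which `Unique` excludes. The bound `m` on the length makes the recursion structural.
    paired-product : ∀ m L → length L ℕ.≤ m → Unique L → Paired L → Functional L →
      ∃ λ h → length L ≡ h ℕ.+ h × + product L ≈ n ^ h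
    paired-product m [] _ _ _ _ = 0 , refl , ≈-refl
    paired-product (suc m) (k ∷ xs) (s≤s len) unique paired functional with paired (here refl)
    ... | l , here l≡k , l≢k , _ = contradiction l≡k l≢k
    ... | l , there l∈xs , l≢k , kl≈n with ∈-∃++ l∈xs
    ... | ys , zs , refl with Permutation.Unique-resp-↭ (setoid ℕ) (↭⇒↭ₛ (prep k (↭-shift l ys zs))) unique
    ... | (k≢l All.∷ k∉) ∷ (l∉ ∷ unique′) = extend (paired-product m L′ len′ unique′ paired′ functional′)
      where
      L′ = ys ++ zs
      perm : k ∷ ys ++ [ l ] ++ zs ↭ k ∷ l ∷ L′
      perm = prep k (↭-shift l ys zs)
      include : ∀ {x} → x ∈ L′ → x ∈ k ∷ ys ++ [ l ] ++ zs
      include x∈ = ∈-resp-↭ (↭-sym perm) (there (there x∈))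
      len-xs : length (ys ++ [ l ] ++ zs) ≡ suc (length L′)
      len-xs = ↭-length (↭-shift l ys zs)
      len′ : length L′ ℕ.≤ m
      len′ = ℕ.≤-trans (ℕ.n≤1+n _) (subst (ℕ._≤ m) len-xs len)
      paired′ : Paired L′
      paired′ {x} x∈ with paired (include x∈)
      ... | y , y∈ , y≢x , xy≈n with ∈-resp-↭ perm y∈
      ... | here refl = contradiction
        (functional (here refl) (there l∈xs) (include x∈) kl≈n (partner-sym x y xy≈n)) (All.lookup l∉ x∈)
      ... | there (here refl) = contradiction
        (functional (there l∈xs) (here refl) (include x∈) (partner-sym k y kl≈n) (partner-sym x y xy≈n)) (All.lookup k∉ x∈)
      ... | there (there y∈L′) = y , y∈L′ , y≢x , xy≈n
      functional′ : Functional L′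
      functional′ a b c = functional (include a) (include b) (include c)
      extend : (∃ λ h → length L′ ≡ h ℕ.+ h × + product L′ ≈ n ^ h) →
               ∃ λ h → length (k ∷ ys ++ [ l ] ++ zs) ≡ h ℕ.+ h × + product (k ∷ ys ++ [ l ] ++ zs) ≈ n ^ h
      extend (h , len≡ , product≈) = suc h , cong suc (trans len-xs (trans (cong suc len≡) (sym (ℕ.+-suc h h)))) ,
        ≈-trans (≈-reflexive product≡) (*-cong kl≈n product≈)
        where
        product≡ : + product (k ∷ ys ++ [ l ] ++ zs) ≡ + k * + l * + product L′
        product≡ = begin
          + product (k ∷ ys ++ [ l ] ++ zs)              ≡⟨ cong +_ (product-↭ perm) ⟩
          + (k ℕ.* (l ℕ.* product L′))                   ≡⟨ cong +_ (ℕ.*-assoc k l (product L′)) ⟨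
          + (k ℕ.* l ℕ.* product L′)                     ≡⟨ pos-* (k ℕ.* l) (product L′) ⟩
          + (k ℕ.* l) * + product L′                     ≡⟨ cong (_* + product L′) (pos-* k l) ⟩
          + k * + l * + product L′                       ∎

  residue≈ : ∀ a → + (a %ℕ p) ≈ a
  residue≈ a = ≈-sym (congruent (divides (a /ℕ p) (trans (cong (_- + (a %ℕ p)) (a≡a%ℕn+[a/ℕn]*n a p)) (identity (+ (a %ℕ p)) (a /ℕ p * + p)))))
    where
    identity : ∀ r x → r + x - r ≡ x
    identity = solve-∀

  ≈⇒≡ : ∀ {k l} → k ℕ.< p → l ℕ.< p → + k ≈ + l → k ≡ l
  ≈⇒≡ {k} {l} k<p l<p (congruent p∣k-l) = +-injective (i-j≡0⇒i≡j (+ k) (+ l) (∣i∣≡0⇒i≡0 (small (∣⇒∣ᵤ p∣k-l) bound)))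
    where
    bound : ∣ + k - + l ∣ ℕ.< p
    bound = ℕ.≤-<-trans (ℕ.≤-trans (ℕ.≤-reflexive (cong ∣_∣ (m-n≡m⊖n k l))) (∣m⊝n∣≤m⊔n k l)) (ℕ.⊔-lub k<p l<p)
    small : ∀ {m} → p ℕ.∣ m → m ℕ.< p → m ≡ 0
    small {zero}  _   _   = refl
    small {suc m} p∣m m<p = contradiction (ℕ.∣⇒≤ p∣m) (ℕ.<⇒≱ m<p)

  inverse : ∀ a → ¬ + p ∣ a → ∃ λ b → a * b ≈ 1ℤ
  inverse a p∤a with a %ℕ p in eq
  ... | zero = contradiction (≈0⇒∣ (≈-trans (≈-sym (residue≈ a)) (≈-reflexive (cong +_ eq)))) p∤a
  ... | suc r = invert (coprime-Bézout (prime⇒coprime pr (subst (ℕ._< p) eq (n%ℕd<d a p))))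
    where
    a≈r : a ≈ + suc r
    a≈r = ≈-trans (≈-sym (residue≈ a)) (≈-reflexive (cong +_ eq))
    lift : ∀ x y u v → 1 ℕ.+ y ℕ.* u ≡ x ℕ.* v → + 1 + + y * + u ≡ + x * + v
    lift x y u v eq = trans (cong (λ z → + 1 + z) (sym (pos-* y u))) (trans (cong +_ eq) (pos-* x v))
    invert : Bézout.Identity 1 p (suc r) → ∃ λ b → a * b ≈ 1ℤ
    invert (Bézout.+- x y eq′) = - + y , ≈-trans (*-cong a≈r ≈-refl) (congruent (divides (- + x)
      (trans (identity (+ suc r) (+ y)) (trans (cong -_ (lift x y (suc r) p eq′)) (negate (+ x) (+ p))))))
      where
      identity : ∀ r y → r * - y - 1ℤ ≡ - (+ 1 + y * r)
      identity = solve-∀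
      negate : ∀ x p → - (x * p) ≡ - x * p
      negate = solve-∀
    invert (Bézout.-+ x y eq′) = + y , ≈-trans (*-cong a≈r ≈-refl) (congruent (divides (+ x)
      (trans (cong (_- 1ℤ) (trans (*-comm (+ suc r) (+ y)) (sym (lift y x p (suc r) eq′)))) (identity (+ x * + p)))))
      where
      identity : ∀ z → + 1 + z - 1ℤ ≡ z
      identity = solve-∀

  p∤small : ∀ {k} .{{_ : ℕ.NonZero k}} → k ℕ.< p → ¬ + p ∣ + k
  p∤small k<p p∣k = ℕ.<⇒≱ k<p (ℕ.∣⇒≤ (∣⇒∣ᵤ p∣k))

  quotient : ∀ n k .{{_ : ℕ.NonZero k}} → ¬ + p ∣ n → k ℕ.< p → ∃ λ l → l ≢ 0 × l ℕ.< p × + k * + l ≈ n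
  quotient n k p∤n k<p with inverse (+ k) (p∤small k<p)
  ... | b , kb≈1 = (n * b) %ℕ p , nonzero , n%ℕd<d (n * b) p , kl≈n
    where
    kl≈n : + k * + ((n * b) %ℕ p) ≈ n
    kl≈n = ≈-trans (*-cong (≈-refl {+ k}) (residue≈ (n * b))) (≈-trans (≈-reflexive (rearrange (+ k) n b))
      (≈-trans (*-cong (≈-refl {n}) kb≈1) (≈-reflexive (*-identityʳ n))))
      where
      rearrange : ∀ k n b → k * (n * b) ≡ n * (k * b)
      rearrange = solve-∀
    nonzero : (n * b) %ℕ p ≢ 0
    nonzero l≡0 = p∤n (≈0⇒∣ (≈-trans (≈-sym kl≈n) (≈-reflexive (trans (cong (λ l → + k * + l) l≡0) (*-comm (+ k) 0ℤ)))))

units : ℕ → List ℕ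
units n = map suc (downFrom n)

product-units : ∀ n → product (units n) ≡ n !
product-units zero    = refl
product-units (suc n) = cong (suc n ℕ.*_) (product-units n)

product-2+ : ∀ n → product (map (2 ℕ.+_) (downFrom n)) ≡ suc n !
product-2+ zero    = refl
product-2+ (suc n) = cong (λ x → (2 ℕ.+ n) ℕ.* x) (product-2+ n)

length-map-downFrom : ∀ (f : ℕ → ℕ) n → length (map f (downFrom n)) ≡ n
length-map-downFrom f n = trans (length-map f (downFrom n)) (length-downFrom n)

-- The involutions k ↦ n/k pair up the residues 1, …, p - 1 when n is not a square, and 2, …, p - 2 when n = 1.
module _ {m : ℕ} (pr : Prime (3 ℕ.+ m)) where

  private p = 3 ℕ.+ m
  open PrimeModulus pr

  functional : ∀ n L → (∀ {k} → k ∈ L → k ≢ 0 × k ℕ.< p) → Pairing.Functional pr n L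
  functional n L range {k} k∈ l∈ l′∈ kl≈n kl′≈n = ≈⇒≡ pr (proj₂ (range l∈)) (proj₂ (range l′∈))
    (cancel (+ k) (p∤small pr {{ℕ.≢-nonZero (proj₁ (range k∈))}} (proj₂ (range k∈))) (≈-trans kl≈n (≈-sym kl′≈n)))

  -1≈ : -1ℤ ≈ + (2 ℕ.+ m)
  -1≈ = congruent (divides -1ℤ (sym (-1*i≡-i (+ p))))

  -- Only 1 and p - 1 are their own inverses modulo p; all other residues cancel in pairs, so that
  -- (p - 1)! ≡ p - 1.
  wilson : + ((2 ℕ.+ m) !) ≈ -1ℤ
  wilson = conclude (Pairing.paired-product pr 1ℤ m L (ℕ.≤-reflexive (length-map-downFrom (2 ℕ.+_) m))
                       (Unique.map⁺ (λ { refl → refl }) (Unique.downFrom⁺ m)) paired (functional 1ℤ L range))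
    where
    L = map (2 ℕ.+_) (downFrom m)

    range : ∀ {k} → k ∈ L → k ≢ 0 × k ℕ.< p
    range k∈ with ∈-map⁻ (2 ℕ.+_) k∈
    ... | i , i∈ , refl = (λ ()) , s≤s (s≤s (ℕ.m≤n⇒m≤1+n (∈-downFrom⁻ i∈)))

    module _ {i} (i<m : i ℕ.< m) where
      k = 2 ℕ.+ i
      k<p : k ℕ.< p
      k<p = s≤s (s≤s (ℕ.m≤n⇒m≤1+n i<m))
      k≉1 : ¬ + k ≈ 1ℤ
      k≉1 k≈1 = contradiction (≈⇒≡ pr k<p (s≤s (s≤s z≤n)) k≈1) λ ()
      k≉-1 : ¬ + k ≈ -1ℤ
      k≉-1 k≈-1 = ℕ.<⇒≢ i<m (ℕ.suc-injective (ℕ.suc-injective (≈⇒≡ pr k<p (ℕ.n<1+n (2 ℕ.+ m)) (≈-trans k≈-1 -1≈))))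
      k²≉1 : ¬ + k * + k ≈ 1ℤ
      k²≉1 k²≈1 = Sum.[ k≉1 ∘ congruent , k≉-1 ∘ congruent ] (euclid (+ k - 1ℤ) (+ k + 1ℤ) (subst (+ p ∣_) (factor (+ k)) (difference k²≈1)))
        where
        factor : ∀ x → x * x - 1ℤ ≡ (x - 1ℤ) * (x + 1ℤ)
        factor = solve-∀
      k≈-1 : + k * + (2 ℕ.+ m) ≈ 1ℤ → + k ≈ -1ℤ
      k≈-1 kl≈1 = ≈-trans (≈-reflexive (negate (+ k))) (*-cong (≈-refl { -1ℤ }) (≈-trans (*-cong (≈-refl {+ k}) -1≈) kl≈1))
        where
        negate : ∀ x → x ≡ -1ℤ * (x * -1ℤ)
        negate = solve-∀
      quotient∈L : ∀ l → l ≢ 0 → l ℕ.< p → + k * + l ≈ 1ℤ → l ∈ L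
      quotient∈L zero          l≢0 _   _    = contradiction refl l≢0
      quotient∈L (suc zero)    _   _   k1≈1 = contradiction (≈-trans (≈-reflexive (sym (*-identityʳ (+ k)))) k1≈1) k≉1
      quotient∈L (suc (suc j)) _   l<p kl≈1 = ∈-map⁺ (2 ℕ.+_) (∈-downFrom⁺
        (ℕ.≤∧≢⇒< (ℕ.s≤s⁻¹ (ℕ.s≤s⁻¹ (ℕ.s≤s⁻¹ l<p))) (λ j≡m → k≉-1 (k≈-1 (subst (λ j → + k * + (2 ℕ.+ j) ≈ 1ℤ) j≡m kl≈1)))))
      pair : (∃ λ l → l ≢ 0 × l ℕ.< p × + k * + l ≈ 1ℤ) → ∃ λ l → l ∈ L × l ≢ k × + k * + l ≈ 1ℤ
      pair (l , l≢0 , l<p , kl≈1) = l , quotient∈L l l≢0 l<p kl≈1 , (λ l≡k → k²≉1 (subst (λ l → + k * + l ≈ 1ℤ) l≡k kl≈1)) , kl≈1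

    paired : Pairing.Paired pr 1ℤ L
    paired k∈ with ∈-map⁻ (2 ℕ.+_) k∈
    ... | i , i∈ , refl = pair (∈-downFrom⁻ i∈) (quotient pr 1ℤ (2 ℕ.+ i) p∤1 (k<p (∈-downFrom⁻ i∈)))

    conclude : (∃ λ h → length L ≡ h ℕ.+ h × + product L ≈ 1ℤ ^ h) → + ((2 ℕ.+ m) !) ≈ -1ℤ
    conclude (h , _ , product≈) = ≈-trans
      (≈-reflexive (trans (cong (λ x → + ((2 ℕ.+ m) ℕ.* x)) (sym (product-2+ m))) (pos-* (2 ℕ.+ m) (product L))))
      (*-cong (≈-sym -1≈) (≈-trans product≈ (≈-reflexive (^-zeroˡ h))))

  -- If n had no square root, no residue would be its own partner under kl ≡ n, and the h pairs
  -- would give (p - 1)! ≡ nʰ ≡ 1. With Wilson's theorem, p would divide 2.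
  euler-criterion : ∀ n h → 2 ℕ.+ m ≡ h ℕ.+ h → ¬ + p ∣ n → n ^ h ≈ 1ℤ → ∃ λ t → t * t ≈ n
  euler-criterion n h p-1≡2h p∤n n^h≈1 = decide (Fin.any? (λ (t : Fin p) → + p ∣? (+ toℕ t * + toℕ t - n)))
    where
    L = units (2 ℕ.+ m)

    range : ∀ {k} → k ∈ L → k ≢ 0 × k ℕ.< p
    range k∈ with ∈-map⁻ suc k∈
    ... | i , i∈ , refl = (λ ()) , s≤s (∈-downFrom⁻ i∈)

    module _ (nonresidue : ¬ ∃ λ (t : Fin p) → + p ∣ + toℕ t * + toℕ t - n) where
      pair : ∀ k → (∃ λ l → l ≢ 0 × l ℕ.< p × + k * + l ≈ n) → ∃ λ l → l ∈ L × l ≢ k × + k * + l ≈ n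
      pair k (zero  , l≢0 , _   , _)    = contradiction refl l≢0
      pair k (suc j , _   , l<p , kl≈n) = suc j , ∈-map⁺ suc (∈-downFrom⁺ (ℕ.s≤s⁻¹ l<p)) ,
        (λ { refl → nonresidue (fromℕ< l<p , subst (λ t → + p ∣ + t * + t - n) (sym (Fin.toℕ-fromℕ< l<p)) (difference kl≈n)) }) , kl≈n

      paired : Pairing.Paired pr n L
      paired k∈ with ∈-map⁻ suc k∈
      ... | i , i∈ , refl = pair (suc i) (quotient pr n (suc i) p∤n (s≤s (∈-downFrom⁻ i∈)))

    absurd : (∃ λ h′ → length L ≡ h′ ℕ.+ h′ × + product L ≈ n ^ h′) → ∃ λ t → t * t ≈ n
    absurd (h′ , length≡ , product≈) = contradiction (difference 1≈-1) (p∤small pr (s≤s (s≤s (s≤s z≤n))))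
      where
      h′≡h : h′ ≡ h
      h′≡h = ℕ.*-cancelˡ-≡ h′ h 2 (trans (double h′) (trans (trans (sym length≡) (trans (length-map-downFrom suc (2 ℕ.+ m)) p-1≡2h)) (sym (double h))))
        where
        double : ∀ h → 2 ℕ.* h ≡ h ℕ.+ h
        double = ℕ-solve-∀
      1≈-1 : 1ℤ ≈ -1ℤ
      1≈-1 = ≈-trans (≈-sym n^h≈1) (≈-trans (≈-sym (subst (λ h → + product L ≈ n ^ h) h′≡h product≈))
        (≈-trans (≈-reflexive (cong +_ (product-units (2 ℕ.+ m)))) wilson))

    decide : Dec (∃ λ (t : Fin p) → + p ∣ + toℕ t * + toℕ t - n) → ∃ λ t → t * t ≈ n
    decide (yes (t , p∣t²-n)) = + toℕ t , congruent p∣t²-n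
    decide (no nonresidue)    = absurd (Pairing.paired-product pr n (2 ℕ.+ m) L (ℕ.≤-reflexive (length-map-downFrom suc (2 ℕ.+ m)))
      (Unique.map⁺ (λ { refl → refl }) (Unique.downFrom⁺ (2 ℕ.+ m))) (paired nonresidue) (functional n L range))

-- Primes as norms from ℤ[ζ]

-- Over ℤ[√2], norm α is the relative norm of αᾱ = size α + cross α √2.
size cross : ℤ[ζ] → ℤ
size  ⟨ a , b , c , d ⟩ = a * a + b * b + c * c + d * d
cross ⟨ a , b , c , d ⟩ = a * b + b * c + c * d - d * a

norm-size : ∀ α → norm α + + 2 * (cross α * cross α) ≡ size α * size α
norm-size ⟨ a , b , c , d ⟩ = identity a b c d
  where
  identity : ∀ a b c d →
    (a * a - c * c + + 2 * (b * d)) * (a * a - c * c + + 2 * (b * d)) +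
    (+ 2 * (a * c) - b * b + d * d) * (+ 2 * (a * c) - b * b + d * d) +
    + 2 * ((a * b + b * c + c * d - d * a) * (a * b + b * c + c * d - d * a)) ≡
    (a * a + b * b + c * c + d * d) * (a * a + b * b + c * c + d * d)
  identity = solve-∀

-- The irrationality of √2, by descent from (n, m) with n = 2k to (m, k). It shows that a nonzero
-- element of ℤ[ζ] has nonzero norm.
2m²≡n²⇒n≡0 : ∀ n m → 2 ℕ.* (m ℕ.* m) ≡ n ℕ.* n → n ≡ 0
2m²≡n²⇒n≡0 = <-rec _ descend
  where
  descend : ∀ n → (∀ {k} → k ℕ.< n → ∀ m → 2 ℕ.* (m ℕ.* m) ≡ k ℕ.* k → k ≡ 0) → ∀ m → 2 ℕ.* (m ℕ.* m) ≡ n ℕ.* n → n ≡ 0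
  descend zero    rec m eq = refl
  descend n@(suc _) rec m eq with Sum.reduce (euclidsLemma n n prime[2] (ℕ.divides (m ℕ.* m) (trans (sym eq) (ℕ.*-comm 2 (m ℕ.* m)))))
  ... | ℕ.divides k n≡2k = trans n≡2k (cong (ℕ._* 2) k≡0)
    where
    m²≡2k² : m ℕ.* m ≡ 2 ℕ.* (k ℕ.* k)
    m²≡2k² = ℕ.*-cancelˡ-≡ (m ℕ.* m) (2 ℕ.* (k ℕ.* k)) 2 (trans eq (trans (cong₂ ℕ._*_ n≡2k n≡2k) (identity k)))
      where
      identity : ∀ k → k ℕ.* 2 ℕ.* (k ℕ.* 2) ≡ 2 ℕ.* (2 ℕ.* (k ℕ.* k))
      identity = ℕ-solve-∀
    m<n : m ℕ.< n
    m<n = ℕ.≰⇒> λ n≤m → ℕ.<⇒≱ (ℕ.m<m+n (n ℕ.* n) (s≤s z≤n))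
      (ℕ.≤-trans (ℕ.*-monoʳ-≤ 2 (ℕ.*-mono-≤ n≤m n≤m)) (ℕ.≤-reflexive eq))
    m≡0 : m ≡ 0
    m≡0 = rec m<n k (sym m²≡2k²)
    k≡0 : k ≡ 0
    k≡0 = Sum.reduce (ℕ.m*n≡0⇒m≡0∨n≡0 k (ℕ.m*n≡0⇒m≡0 (k ℕ.* k) 2
      (trans (ℕ.*-comm (k ℕ.* k) 2) (trans (sym m²≡2k²) (cong₂ ℕ._*_ m≡0 m≡0)))))

-- If t⁴ ≡ -1 (mod n) then α ↦ α(t) is a homomorphism ℤ[ζ] → ℤ/n, and α divides norm α.
evaluate : ℤ → ℤ[ζ] → ℤ
evaluate t ⟨ a , b , c , d ⟩ = a + b * t + c * (t * t) + d * (t * (t * t))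

∣evaluate⇒∣norm : ∀ n t α → n ∣ t * t * (t * t) + 1ℤ → n ∣ evaluate t α → n ∣ norm α
∣evaluate⇒∣norm n t α@(⟨ a , b , c , d ⟩) n∣t⁴+1 n∣α = subst (n ∣_) (split (re α) (im α) (t * t))
  (∣m∣n⇒∣m+n (∣m⇒∣m*n (re α - t * t * im α) n∣re+t²im) (∣m⇒∣m*n (im α * im α) n∣t⁴+1))
  where
  -- Modulo t⁴ + 1, the product α(t)α(-t) is the relative norm to ℤ[i] with t² in the place of i;
  -- `split` then multiplies it by its conjugate.
  factor : ∀ a b c d t →
    (a + b * t + c * (t * t) + d * (t * (t * t))) * (a - b * t + c * (t * t) - d * (t * (t * t))) +
    (t * t * (t * t) + 1ℤ) * (+ 2 * (b * d) + d * d * (t * t) - c * c) ≡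
    (a * a - c * c + + 2 * (b * d)) + t * t * (+ 2 * (a * c) - b * b + d * d)
  factor = solve-∀
  n∣re+t²im : n ∣ re α + t * t * im α
  n∣re+t²im = subst (n ∣_) (factor a b c d t)
    (∣m∣n⇒∣m+n (∣m⇒∣m*n (a - b * t + c * (t * t) - d * (t * (t * t))) n∣α)
               (∣m⇒∣m*n (+ 2 * (b * d) + d * d * (t * t) - c * c) n∣t⁴+1))
  split : ∀ x y s → (x + s * y) * (x - s * y) + (s * s + 1ℤ) * (y * y) ≡ x * x + y * y
  split = solve-∀

module SmallNorm {p : ℕ} (pr : Prime p) (t : ℤ) (p∣t⁴+1 : + p ∣ t * t * (t * t) + 1ℤ) where

  open PrimeModulus pr
  private instance _ = prime⇒nonZero pr

  -- By `norm-size` the norm is at most the square of the size, hence at most (4q²)² = 16q⁴ < 16p.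
  -- The same identity shows that norm 0 would force size 0, by the irrationality of √2.
  bounded-norm : ∀ q a b c d → q ℕ.* q ℕ.* (q ℕ.* q) ℕ.< p → + p ∣ norm ⟨ a , b , c , d ⟩ →
    ∣ a ∣ ℕ.≤ q → ∣ b ∣ ℕ.≤ q → ∣ c ∣ ℕ.≤ q → ∣ d ∣ ℕ.≤ q → ¬ (a ≡ 0ℤ × b ≡ 0ℤ × c ≡ 0ℤ × d ≡ 0ℤ) →
    ∃ λ k → 0 ℕ.< k × k ℕ.< 16 × norm ⟨ a , b , c , d ⟩ ≡ + k * + p
  bounded-norm q a b c d q⁴<p p∣norm a≤q b≤q c≤q d≤q nonzero = conclude (∣⇒∣ᵤ (subst (+ p ∣_) norm≡N p∣norm))
    where
    α = ⟨ a , b , c , d ⟩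
    A = ∣ a ∣ ; B = ∣ b ∣ ; C = ∣ c ∣ ; D = ∣ d ∣ ; F = ∣ cross α ∣ ; R = ∣ re α ∣ ; I = ∣ im α ∣
    N = R ℕ.* R ℕ.+ I ℕ.* I
    S = A ℕ.* A ℕ.+ B ℕ.* B ℕ.+ C ℕ.* C ℕ.+ D ℕ.* D

    norm≡N : norm α ≡ + N
    norm≡N = trans (cong₂ _+_ (square-abs (re α)) (square-abs (im α))) (sym (pos-+ (R ℕ.* R) (I ℕ.* I)))

    size≡S : size α ≡ + S
    size≡S = begin
      a * a + b * b + c * c + d * d
        ≡⟨ cong₂ _+_ (cong₂ _+_ (cong₂ _+_ (square-abs a) (square-abs b)) (square-abs c)) (square-abs d) ⟩
      + (A ℕ.* A) + + (B ℕ.* B) + + (C ℕ.* C) + + (D ℕ.* D)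
        ≡⟨ cong (λ x → x + + (C ℕ.* C) + + (D ℕ.* D)) (pos-+ (A ℕ.* A) (B ℕ.* B)) ⟨
      + (A ℕ.* A ℕ.+ B ℕ.* B) + + (C ℕ.* C) + + (D ℕ.* D)
        ≡⟨ cong (λ x → x + + (D ℕ.* D)) (pos-+ (A ℕ.* A ℕ.+ B ℕ.* B) (C ℕ.* C)) ⟨
      + (A ℕ.* A ℕ.+ B ℕ.* B ℕ.+ C ℕ.* C) + + (D ℕ.* D)
        ≡⟨ pos-+ (A ℕ.* A ℕ.+ B ℕ.* B ℕ.+ C ℕ.* C) (D ℕ.* D) ⟨
      + S ∎

    N+2F²≡S² : N ℕ.+ 2 ℕ.* (F ℕ.* F) ≡ S ℕ.* S
    N+2F²≡S² = +-injective (begin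
      + (N ℕ.+ 2 ℕ.* (F ℕ.* F))             ≡⟨ pos-+ N (2 ℕ.* (F ℕ.* F)) ⟩
      + N + + (2 ℕ.* (F ℕ.* F))             ≡⟨ cong (λ x → + N + x) (pos-* 2 (F ℕ.* F)) ⟩
      + N + + 2 * + (F ℕ.* F)               ≡⟨ cong₂ (λ x y → x + + 2 * y) norm≡N (square-abs (cross α)) ⟨
      norm α + + 2 * (cross α * cross α)    ≡⟨ norm-size α ⟩
      size α * size α                       ≡⟨ cong₂ _*_ size≡S size≡S ⟩
      + S * + S                             ≡⟨ pos-* S S ⟨
      + (S ℕ.* S)                           ∎)

    S≤4q² : S ℕ.≤ 4 ℕ.* (q ℕ.* q)
    S≤4q² = ℕ.≤-trans (ℕ.+-mono-≤ (ℕ.+-mono-≤ (ℕ.+-mono-≤ (ℕ.*-mono-≤ a≤q a≤q) (ℕ.*-mono-≤ b≤q b≤q)) (ℕ.*-mono-≤ c≤q c≤q)) (ℕ.*-mono-≤ d≤q d≤q))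
                      (ℕ.≤-reflexive (identity (q ℕ.* q)))
      where
      identity : ∀ x → x ℕ.+ x ℕ.+ x ℕ.+ x ≡ 4 ℕ.* x
      identity = ℕ-solve-∀

    N<16p : N ℕ.< 16 ℕ.* p
    N<16p = ℕ.≤-<-trans (ℕ.≤-trans (ℕ.m≤m+n N (2 ℕ.* (F ℕ.* F))) (ℕ.≤-trans (ℕ.≤-reflexive N+2F²≡S²)
        (ℕ.≤-trans (ℕ.*-mono-≤ S≤4q² S≤4q²) (ℕ.≤-reflexive (identity (q ℕ.* q))))))
      (ℕ.*-monoʳ-< 16 q⁴<p)
      where
      identity : ∀ x → 4 ℕ.* x ℕ.* (4 ℕ.* x) ≡ 16 ℕ.* (x ℕ.* x)
      identity = ℕ-solve-∀

    N≢0 : N ≢ 0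
    N≢0 N≡0 = nonzero (vanish a A²≡0 , vanish b B²≡0 , vanish c C²≡0 , vanish d (ℕ.m+n≡0⇒n≡0 (A ℕ.* A ℕ.+ B ℕ.* B ℕ.+ C ℕ.* C) S≡0))
      where
      S≡0 : S ≡ 0
      S≡0 = 2m²≡n²⇒n≡0 S F (trans (cong (ℕ._+ 2 ℕ.* (F ℕ.* F)) (sym N≡0)) N+2F²≡S²)
      A²+B²+C²≡0 : A ℕ.* A ℕ.+ B ℕ.* B ℕ.+ C ℕ.* C ≡ 0
      A²+B²+C²≡0 = ℕ.m+n≡0⇒m≡0 (A ℕ.* A ℕ.+ B ℕ.* B ℕ.+ C ℕ.* C) S≡0
      C²≡0 : C ℕ.* C ≡ 0
      C²≡0 = ℕ.m+n≡0⇒n≡0 (A ℕ.* A ℕ.+ B ℕ.* B) A²+B²+C²≡0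
      A²+B²≡0 : A ℕ.* A ℕ.+ B ℕ.* B ≡ 0
      A²+B²≡0 = ℕ.m+n≡0⇒m≡0 (A ℕ.* A ℕ.+ B ℕ.* B) A²+B²+C²≡0
      A²≡0 : A ℕ.* A ≡ 0
      A²≡0 = ℕ.m+n≡0⇒m≡0 (A ℕ.* A) A²+B²≡0
      B²≡0 : B ℕ.* B ≡ 0
      B²≡0 = ℕ.m+n≡0⇒n≡0 (A ℕ.* A) A²+B²≡0
      vanish : ∀ x → ∣ x ∣ ℕ.* ∣ x ∣ ≡ 0 → x ≡ 0ℤ
      vanish x x²≡0 = ∣i∣≡0⇒i≡0 (Sum.reduce (ℕ.m*n≡0⇒m≡0∨n≡0 ∣ x ∣ x²≡0))

    conclude : p ℕ.∣ N → ∃ λ k → 0 ℕ.< k × k ℕ.< 16 × norm α ≡ + k * + p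
    conclude (ℕ.divides k N≡kp) = k , positive k N≡kp , ℕ.*-cancelʳ-< p k 16 (subst (ℕ._< 16 ℕ.* p) N≡kp N<16p) ,
      trans norm≡N (trans (cong +_ N≡kp) (pos-* k p))
      where
      positive : ∀ k → N ≡ k ℕ.* p → 0 ℕ.< k
      positive (suc k) _   = s≤s z≤n
      positive zero    N≡0 = contradiction N≡0 N≢0

  small-norm : ∃₂ λ α k → 0 ℕ.< k × k ℕ.< 16 × norm α ≡ + k * + p
  small-norm = from-root (root 4 p)
    where
    c : Fin 4 → ℤ
    c zero                   = 1ℤ
    c (suc zero)             = t
    c (suc (suc zero))       = t * t
    c (suc (suc (suc zero))) = t * (t * t)

    evaluate-≡ : ∀ x y z w t → 1ℤ * x + (t * y + (t * t * z + (t * (t * t) * w + 0ℤ))) ≡ x + y * t + z * (t * t) + w * (t * (t * t))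
    evaluate-≡ = solve-∀

    from-solution : ∀ q → q ℕ.* q ℕ.* (q ℕ.* q) ℕ.< p →
      (∃ λ (z : Fin 4 → ℤ) → (∃ λ i → z i ≢ 0ℤ) × (∀ i → ∣ z i ∣ ℕ.≤ q) × + p ∣ sumFin 4 (λ i → c i * z i)) →
      ∃₂ λ α k → 0 ℕ.< k × k ℕ.< 16 × norm α ≡ + k * + p
    from-solution q q⁴<p (z , nonzero , small , p∣) = ⟨ z₀ , z₁ , z₂ , z₃ ⟩ ,
      bounded-norm q z₀ z₁ z₂ z₃ q⁴<p
        (∣evaluate⇒∣norm (+ p) t ⟨ z₀ , z₁ , z₂ , z₃ ⟩ p∣t⁴+1 (subst (+ p ∣_) (evaluate-≡ z₀ z₁ z₂ z₃ t) p∣))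
        (small zero) (small (suc zero)) (small (suc (suc zero))) (small (suc (suc (suc zero)))) (λ zero-≡ → refute zero-≡ nonzero)
      where
      z₀ = z zero
      z₁ = z (suc zero)
      z₂ = z (suc (suc zero))
      z₃ = z (suc (suc (suc zero)))
      refute : z₀ ≡ 0ℤ × z₁ ≡ 0ℤ × z₂ ≡ 0ℤ × z₃ ≡ 0ℤ → ¬ ∃ λ i → z i ≢ 0ℤ
      refute (e₀ , _ , _ , _) (zero                   , z≢0) = z≢0 e₀
      refute (_ , e₁ , _ , _) (suc zero               , z≢0) = z≢0 e₁
      refute (_ , _ , e₂ , _) (suc (suc zero)         , z≢0) = z≢0 e₂
      refute (_ , _ , _ , e₃) (suc (suc (suc zero))   , z≢0) = z≢0 e₃

    from-root : (∃ λ q → q ℕ.^ 4 ℕ.≤ p × p ℕ.< suc q ℕ.^ 4) → ∃₂ λ α k → 0 ℕ.< k × k ℕ.< 16 × norm α ≡ + k * + p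
    from-root (q , q⁴≤p , p<[q+1]⁴) = from-solution q
      (ℕ.≤∧≢⇒< (subst (ℕ._≤ p) (fourth q) q⁴≤p) (prime≢square pr (q ℕ.* q)))
      (small-solution p 4 q p<[q+1]⁴ c)
      where
      fourth : ∀ q → q ℕ.* (q ℕ.* (q ℕ.* (q ℕ.* 1))) ≡ q ℕ.* q ℕ.* (q ℕ.* q)
      fourth = ℕ-solve-∀

-- The value at ζ = 1. Its parity is the class of α modulo 1 - ζ, the prime above 2.
sum : ℤ[ζ] → ℤ
sum ⟨ a , b , c , d ⟩ = a + b + c + d

norm-+[] : ∀ n α β → ∃ λ k → norm (α +[ n ] β) ≡ norm α + n * k
norm-+[] n ⟨ a , b , c , d ⟩ ⟨ a′ , b′ , c′ , d′ ⟩ = k ,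
  trans (cong₂ (λ x y → x * x + y * y) (re-≡ n a b c d a′ b′ c′ d′) (im-≡ n a b c d a′ b′ c′ d′)) (square-≡ n (re ⟨ a , b , c , d ⟩) (im ⟨ a , b , c , d ⟩) r i)
  where
  r i k : ℤ
  r = + 2 * (a * a′) + n * (a′ * a′) - + 2 * (c * c′) - n * (c′ * c′) + + 2 * (b * d′ + b′ * d + n * (b′ * d′))
  i = + 2 * (a * c′ + a′ * c + n * (a′ * c′)) - + 2 * (b * b′) - n * (b′ * b′) + + 2 * (d * d′) + n * (d′ * d′)
  k = + 2 * (re ⟨ a , b , c , d ⟩ * r) + n * (r * r) + (+ 2 * (im ⟨ a , b , c , d ⟩ * i) + n * (i * i))
  re-≡ : ∀ n a b c d a′ b′ c′ d′ →
    (a + n * a′) * (a + n * a′) - (c + n * c′) * (c + n * c′) + + 2 * ((b + n * b′) * (d + n * d′)) ≡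
    a * a - c * c + + 2 * (b * d) + n * (+ 2 * (a * a′) + n * (a′ * a′) - + 2 * (c * c′) - n * (c′ * c′) + + 2 * (b * d′ + b′ * d + n * (b′ * d′)))
  re-≡ = solve-∀
  im-≡ : ∀ n a b c d a′ b′ c′ d′ →
    + 2 * ((a + n * a′) * (c + n * c′)) - (b + n * b′) * (b + n * b′) + (d + n * d′) * (d + n * d′) ≡
    + 2 * (a * c) - b * b + d * d + n * (+ 2 * (a * c′ + a′ * c + n * (a′ * c′)) - + 2 * (b * b′) - n * (b′ * b′) + + 2 * (d * d′) + n * (d′ * d′))
  im-≡ = solve-∀
  square-≡ : ∀ n x y r i → (x + n * r) * (x + n * r) + (y + n * i) * (y + n * i) ≡
    x * x + y * y + n * (+ 2 * (x * r) + n * (r * r) + (+ 2 * (y * i) + n * (i * i)))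
  square-≡ = solve-∀

sum-or-norm : ∀ (a b c d : Fin 4) → let α = fromFin a b c d in (+ 2 ∣ sum α) ⊎ (+ 8 ∣ norm α - 1ℤ)
sum-or-norm = from-yes (Fin.all? λ (a : Fin 4) → Fin.all? λ (b : Fin 4) → Fin.all? λ (c : Fin 4) → Fin.all? λ (d : Fin 4) →
  let α = fromFin a b c d in (+ 2 ∣? sum α) ⊎-dec (+ 8 ∣? (norm α - 1ℤ)))

-- An element outside the prime above 2 has norm ≡ 1 (mod 8). Both alternatives depend only on α
-- modulo 4, which leaves 256 classes to check.
even-or-1mod8 : ∀ α → (+ 2 ∣ sum α) ⊎ (+ 8 ∣ norm α - 1ℤ)
even-or-1mod8 α = reduce (residues 4 α)
  where
  sum-≡ : ∀ a b c d a′ b′ c′ d′ → a + b + c + d + + 2 * (+ 2 * (a′ + b′ + c′ + d′)) ≡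
    a + + 4 * a′ + (b + + 4 * b′) + (c + + 4 * c′) + (d + + 4 * d′)
  sum-≡ = solve-∀
  norm-≡ : ∀ x y k l → x * x + y * y - 1ℤ + + 8 * (+ 2 * (x * k) + + 8 * (k * k) + (+ 2 * (y * l) + + 8 * (l * l))) ≡
    (x + + 8 * k) * (x + + 8 * k) + (y + + 8 * l) * (y + + 8 * l) - 1ℤ
  norm-≡ = solve-∀
  2∣sum-shift : ∀ ρ β → + 2 ∣ sum ρ → + 2 ∣ sum (ρ +[ + 4 ] β)
  2∣sum-shift ⟨ a , b , c , d ⟩ ⟨ a′ , b′ , c′ , d′ ⟩ 2∣ = subst (+ 2 ∣_) (sum-≡ a b c d a′ b′ c′ d′)
    (∣m∣n⇒∣m+n 2∣ (∣m⇒∣m*n (+ 2 * (a′ + b′ + c′ + d′)) (divides (+ 1) refl)))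
  8∣norm-shift : ∀ ρ β → + 8 ∣ norm ρ - 1ℤ → + 8 ∣ norm (ρ +[ + 4 ] β) - 1ℤ
  8∣norm-shift ρ β 8∣ = subst (+ 8 ∣_)
    (trans (norm-≡ (re ρ) (im ρ) k l) (sym (cong₂ (λ x y → x * x + y * y - 1ℤ) (proj₂ (re-+4 ρ β)) (proj₂ (im-+4 ρ β)))))
    (∣m∣n⇒∣m+n 8∣ (∣m⇒∣m*n (+ 2 * (re ρ * k) + + 8 * (k * k) + (+ 2 * (im ρ * l) + + 8 * (l * l))) (divides (+ 1) refl)))
    where
    k l : ℤ
    k = proj₁ (re-+4 ρ β)
    l = proj₁ (im-+4 ρ β)
  reduce : ∀ {α} → Residues 4 α → (+ 2 ∣ sum α) ⊎ (+ 8 ∣ norm α - 1ℤ)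
  reduce (reduced a b c d β) = Sum.map (2∣sum-shift ρ β) (8∣norm-shift ρ β) (sum-or-norm a b c d)
    where
    ρ : ℤ[ζ]
    ρ = fromFin a b c d

-- Division by 1 - ζ.
halve-norm : ∀ α → + 2 ∣ sum α → ∃ λ β → norm α ≡ + 2 * norm β
halve-norm ⟨ a , b , c , d ⟩ (divides w sum≡2w) = ⟨ w - b - c - d , w - c - d , w - d , w ⟩ ,
  trans (cong (λ a → norm ⟨ a , b , c , d ⟩) a≡) (identity w b c d)
  where
  isolate : ∀ a b c d → a ≡ a + b + c + d - b - c - d
  isolate = solve-∀
  a≡ : a ≡ w * + 2 - b - c - d
  a≡ = trans (isolate a b c d) (cong (λ x → x - b - c - d) sum≡2w)
  identity : ∀ w b c d →
    ((w * + 2 - b - c - d) * (w * + 2 - b - c - d) - c * c + + 2 * (b * d)) * ((w * + 2 - b - c - d) * (w * + 2 - b - c - d) - c * c + + 2 * (b * d)) +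
    (+ 2 * ((w * + 2 - b - c - d) * c) - b * b + d * d) * (+ 2 * ((w * + 2 - b - c - d) * c) - b * b + d * d) ≡
    + 2 * (((w - b - c - d) * (w - b - c - d) - (w - d) * (w - d) + + 2 * ((w - c - d) * w)) * ((w - b - c - d) * (w - b - c - d) - (w - d) * (w - d) + + 2 * ((w - c - d) * w)) +
           (+ 2 * ((w - b - c - d) * (w - d)) - (w - c - d) * (w - c - d) + w * w) * (+ 2 * ((w - b - c - d) * (w - d)) - (w - c - d) * (w - c - d) + w * w))
  identity = solve-∀

-- 1 ± (ζ + ζ³) = 1 ± √-2, the prime factors of 3.
σ₊ σ₋ : ℤ[ζ]
σ₊ = ⟨ 1ℤ , 1ℤ , 0ℤ , 1ℤ ⟩
σ₋ = ⟨ 1ℤ , -1ℤ , 0ℤ , -1ℤ ⟩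

Div3 : ℤ[ζ] → Set
Div3 ⟨ a , b , c , d ⟩ = (+ 3 ∣ a) × (+ 3 ∣ b) × (+ 3 ∣ c) × (+ 3 ∣ d)

div3? : ∀ α → Dec (Div3 α)
div3? ⟨ a , b , c , d ⟩ = (+ 3 ∣? a) ×-dec (+ 3 ∣? b) ×-dec (+ 3 ∣? c) ×-dec (+ 3 ∣? d)

-- Since 3 = σ₊σ₋ with both factors prime of norm 9, an α of norm divisible by 3 is a multiple of
-- one of them, and its product with the other is a multiple of 3. The statement is checked on the
-- 81 classes modulo 3.
div3-classes : ∀ (a b c d : Fin 3) → let α = fromFin a b c d in
  + 3 ∣ norm α → Div3 (σ₊ ⊗ α) ⊎ Div3 (σ₋ ⊗ α)
div3-classes = from-yes (Fin.all? λ (a : Fin 3) → Fin.all? λ (b : Fin 3) → Fin.all? λ (c : Fin 3) → Fin.all? λ (d : Fin 3) →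
  let α = fromFin a b c d in + 3 ∣? norm α →-dec (div3? (σ₊ ⊗ α) ⊎-dec div3? (σ₋ ⊗ α)))

div3-shift : ∀ α β → Div3 α → Div3 (α +[ + 3 ] β)
div3-shift ⟨ a , b , c , d ⟩ ⟨ a′ , b′ , c′ , d′ ⟩ (3∣a , 3∣b , 3∣c , 3∣d) = shift a′ 3∣a , shift b′ 3∣b , shift c′ 3∣c , shift d′ 3∣d
  where
  shift : ∀ {x} y → + 3 ∣ x → + 3 ∣ x + + 3 * y
  shift y 3∣x = ∣m∣n⇒∣m+n 3∣x (∣m⇒∣m*n y (divides (+ 1) refl))

3∣norm⇒Div3 : ∀ α → + 3 ∣ norm α → Div3 (σ₊ ⊗ α) ⊎ Div3 (σ₋ ⊗ α)
3∣norm⇒Div3 α = reduce (residues 3 α)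
  where
  reduce : ∀ {α} → Residues 3 α → + 3 ∣ norm α → Div3 (σ₊ ⊗ α) ⊎ Div3 (σ₋ ⊗ α)
  reduce (reduced a b c d β) 3∣ = Sum.map (back σ₊) (back σ₋)
    (div3-classes a b c d (∣m+n∣n⇒∣m (subst (+ 3 ∣_) (proj₂ (norm-+[] (+ 3) ρ β)) 3∣) (∣m⇒∣m*n (proj₁ (norm-+[] (+ 3) ρ β)) (divides (+ 1) refl))))
    where
    ρ : ℤ[ζ]
    ρ = fromFin a b c d
    back : ∀ σ → Div3 (σ ⊗ ρ) → Div3 (σ ⊗ (ρ +[ + 3 ] β))
    back σ div = subst Div3 (sym (⊗-+[] (+ 3) σ ρ β)) (div3-shift (σ ⊗ ρ) (σ ⊗ β) div)

Div3⇒norm : ∀ α → Div3 α → ∃ λ β → norm α ≡ + 81 * norm β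
Div3⇒norm ⟨ a , b , c , d ⟩ (divides a′ a≡ , divides b′ b≡ , divides c′ c≡ , divides d′ d≡) =
  ⟨ a′ , b′ , c′ , d′ ⟩ , trans (cong norm (⟨⟩-≡ a≡ b≡ c≡ d≡)) (identity a′ b′ c′ d′)
  where
  identity : ∀ a b c d →
    (a * + 3 * (a * + 3) - c * + 3 * (c * + 3) + + 2 * (b * + 3 * (d * + 3))) * (a * + 3 * (a * + 3) - c * + 3 * (c * + 3) + + 2 * (b * + 3 * (d * + 3))) +
    (+ 2 * (a * + 3 * (c * + 3)) - b * + 3 * (b * + 3) + d * + 3 * (d * + 3)) * (+ 2 * (a * + 3 * (c * + 3)) - b * + 3 * (b * + 3) + d * + 3 * (d * + 3)) ≡
    + 81 * ((a * a - c * c + + 2 * (b * d)) * (a * a - c * c + + 2 * (b * d)) + (+ 2 * (a * c) - b * b + d * d) * (+ 2 * (a * c) - b * b + d * d))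
  identity = solve-∀

-- With σα = 3β for one of the two σ, comparing norms gives 9 norm α = 81 norm β.
ninth-norm : ∀ α → + 3 ∣ norm α → ∃ λ β → norm α ≡ + 9 * norm β
ninth-norm α 3∣ = Sum.[ divide σ₊ refl , divide σ₋ refl ] (3∣norm⇒Div3 α 3∣)
  where
  divide : ∀ σ → norm σ ≡ + 9 → Div3 (σ ⊗ α) → ∃ λ β → norm α ≡ + 9 * norm β
  divide σ norm≡9 div = β , *-cancelˡ-≡ (+ 9) (norm α) (+ 9 * norm β)
    (trans (cong (_* norm α) (sym norm≡9)) (trans (sym (norm-⊗ σ α)) (trans (proj₂ (Div3⇒norm (σ ⊗ α) div)) (regroup (norm β)))))
    where
    β : ℤ[ζ]
    β = proj₁ (Div3⇒norm (σ ⊗ α) div)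
    regroup : ∀ x → + 81 * x ≡ + 9 * (+ 9 * x)
    regroup = solve-∀

1mod8-below16 : ∀ (k : Fin 16) → + 8 ∣ + toℕ k - 1ℤ → (toℕ k ≡ 1) ⊎ (toℕ k ≡ 9)
1mod8-below16 = from-yes (Fin.all? λ (k : Fin 16) → (+ 8 ∣? (+ toℕ k - 1ℤ)) →-dec ((toℕ k ℕ.≟ 1) ⊎-dec (toℕ k ℕ.≟ 9)))

-- If 1 - ζ divides α, the quotient has norm (k/2)p, as p is odd. Otherwise kp ≡ 1 (mod 8), hence k
-- ≡ 1 (mod 8) because p is, and k < 16 leaves only 1 and 9; the 9 is removed by a prime factor of
-- 3. The bound `n` on `k` drives the recursion.
norm-descent : ∀ p w → p ≡ 1 ℕ.+ 8 ℕ.* w → ∀ n k α → k ℕ.≤ n → 0 ℕ.< k → k ℕ.< 16 → norm α ≡ + k * + p → ∃ λ β → norm β ≡ + p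
norm-descent p w p≡ zero    zero α k≤n ()
norm-descent p w p≡ (suc n) k    α k≤n 0<k k<16 norm≡kp = Sum.[ even , odd ] (even-or-1mod8 α)
  where
  +p≡ : + p ≡ + 1 + + 8 * + w
  +p≡ = trans (cong +_ p≡) (cong (λ x → + 1 + x) (pos-* 8 w))

  even : + 2 ∣ sum α → ∃ λ β → norm β ≡ + p
  even 2∣sum = conclude (euclidsLemma k p prime[2]
    (subst (2 ℕ.∣_) (abs-* (+ k) (+ p)) (∣⇒∣ᵤ (divides (norm β) (trans (sym norm≡kp) (trans norm≡2 (*-comm (+ 2) (norm β))))))))
    where
    β : ℤ[ζ]
    β = proj₁ (halve-norm α 2∣sum)
    norm≡2 : norm α ≡ + 2 * norm β
    norm≡2 = proj₂ (halve-norm α 2∣sum)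
    half : ∀ j → k ≡ j ℕ.* 2 → norm β ≡ + j * + p
    half j k≡j2 = *-cancelˡ-≡ (+ 2) (norm β) (+ j * + p) (begin
      + 2 * norm β           ≡⟨ norm≡2 ⟨
      norm α                 ≡⟨ norm≡kp ⟩
      + k * + p              ≡⟨ cong (λ k → + k * + p) k≡j2 ⟩
      + (j ℕ.* 2) * + p      ≡⟨ cong (_* + p) (pos-* j 2) ⟩
      + j * + 2 * + p        ≡⟨ regroup (+ j) (+ p) ⟩
      + 2 * (+ j * + p)      ∎)
      where
      regroup : ∀ j p → j * + 2 * p ≡ + 2 * (j * p)
      regroup = solve-∀
    conclude : (2 ℕ.∣ k) ⊎ (2 ℕ.∣ p) → ∃ λ β → norm β ≡ + p
    conclude (inj₁ (ℕ.divides zero    k≡0))  = contradiction k≡0 (ℕ.>⇒≢ 0<k)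
    conclude (inj₁ (ℕ.divides j@(suc _) k≡j2)) = norm-descent p w p≡ n j β (ℕ.s≤s⁻¹ (ℕ.<-≤-trans j<k k≤n)) (s≤s z≤n) (ℕ.<-trans j<k k<16) (half j k≡j2)
      where
      j<k : j ℕ.< k
      j<k = subst (j ℕ.<_) (sym k≡j2) (ℕ.m<m*n j 2 (s≤s (s≤s z≤n)))
    conclude (inj₂ 2∣p) = contradiction
      (ℕ.∣m+n∣m⇒∣n (subst (2 ℕ.∣_) (trans p≡ (ℕ.+-comm 1 (8 ℕ.* w))) 2∣p) (ℕ.∣m⇒∣m*n w (ℕ.divides 4 refl)))
      (toWitnessFalse {a? = 2 ℕ.∣? 1} _)

  odd : + 8 ∣ norm α - 1ℤ → ∃ λ β → norm β ≡ + p
  odd 8∣ = conclude (subst (λ k → (k ≡ 1) ⊎ (k ≡ 9)) (Fin.toℕ-fromℕ< k<16)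
      (1mod8-below16 (fromℕ< k<16) (subst (λ k → + 8 ∣ + k - 1ℤ) (sym (Fin.toℕ-fromℕ< k<16)) 8∣k-1)))
    where
    8∣k-1 : + 8 ∣ + k - 1ℤ
    8∣k-1 = ∣m+n∣n⇒∣m (subst (+ 8 ∣_) (begin
      norm α - 1ℤ                               ≡⟨ cong (_- 1ℤ) (trans norm≡kp (cong (+ k *_) +p≡)) ⟩
      + k * (+ 1 + + 8 * + w) - 1ℤ              ≡⟨ regroup (+ k) (+ w) ⟩
      + k - 1ℤ + + 8 * (+ k * + w)              ∎) 8∣) (∣m⇒∣m*n (+ k * + w) (divides (+ 1) refl))
      where
      regroup : ∀ k w → k * (+ 1 + + 8 * w) - 1ℤ ≡ k - 1ℤ + + 8 * (k * w)
      regroup = solve-∀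
    conclude : (k ≡ 1) ⊎ (k ≡ 9) → ∃ λ β → norm β ≡ + p
    conclude (inj₁ k≡1) = α , trans norm≡kp (trans (cong (λ k → + k * + p) k≡1) (*-identityˡ (+ p)))
    conclude (inj₂ k≡9) = β , *-cancelˡ-≡ (+ 9) (norm β) (+ p) (trans (sym (proj₂ ninth)) norm≡9p)
      where
      norm≡9p : norm α ≡ + 9 * + p
      norm≡9p = trans norm≡kp (cong (λ k → + k * + p) k≡9)
      regroup : ∀ p → + 9 * p ≡ + 3 * p * + 3
      regroup = solve-∀
      ninth : ∃ λ β → norm α ≡ + 9 * norm β
      ninth = ninth-norm α (divides (+ 3 * + p) (trans norm≡9p (regroup (+ p))))
      β : ℤ[ζ]
      β = proj₁ ninth

-- Uniqueness of p = a² + b² up to units and conjugation, and the norm p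

module _ {p : ℕ} (pr : Prime p) (a b : ℤ) (p≡a²+b² : + p ≡ a * a + b * b) where

  open PrimeModulus pr
  private instance _ = prime⇒nonZero pr

  p∤b : ¬ + p ∣ b
  p∤b p∣b = conclude p∣a p∣b
    where
    isolate : ∀ a b → a * a + b * b + b * - b ≡ a * a
    isolate = solve-∀
    p∣a : + p ∣ a
    p∣a = Sum.reduce (euclid a a (subst (+ p ∣_) (trans (cong (_+ b * - b) p≡a²+b²) (isolate a b))
      (∣m∣n⇒∣m+n (divides (+ 1) (sym (*-identityˡ (+ p)))) (∣m⇒∣m*n (- b) p∣b))))
    conclude : + p ∣ a → ¬ + p ∣ b
    conclude (divides x a≡) (divides y b≡) = p∤1 (divides (x * x + y * y) (*-cancelˡ-≡ (+ p) 1ℤ ((x * x + y * y) * + p)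
      (trans (*-identityʳ (+ p)) (trans p≡a²+b² (trans (cong₂ (λ a b → a * a + b * b) a≡ b≡) (regroup x y (+ p)))))))
      where
      regroup : ∀ x y p → x * p * (x * p) + y * p * (y * p) ≡ p * ((x * x + y * y) * p)
      regroup = solve-∀

  imaginary-unit : ∃ λ r → r * r ≈ -1ℤ
  -- The root is a/b, because a² ≡ -b² (mod p).
  imaginary-unit = a * c , congruent (subst (+ p ∣_) (regroup a b c) (∣m∣n⇒∣m+n p∣ (∣m⇒∣m*n (- (b * c + 1ℤ)) (difference bc≈1))))
    where
    c : ℤ
    c = proj₁ (inverse pr b p∤b)
    bc≈1 : b * c ≈ 1ℤ
    bc≈1 = proj₂ (inverse pr b p∤b)
    p∣ : + p ∣ (a * a + b * b) * (c * c)
    p∣ = subst (λ x → + p ∣ x * (c * c)) p≡a²+b² (∣m⇒∣m*n (c * c) (divides (+ 1) (sym (*-identityˡ (+ p)))))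
    regroup : ∀ a b c → (a * a + b * b) * (c * c) + (b * c - 1ℤ) * - (b * c + 1ℤ) ≡ a * c * (a * c) - -1ℤ
    regroup = solve-∀

  -- If p divides the real part of (x + iy)(a + ib) then it also divides the imaginary part, and the quotient c + ie is a
  -- unit of ℤ[i] with x + iy = (c + ie)(a - ib).
  quotient-unit : ∀ x y → + p ≡ x * x + y * y → + p ∣ x * a - y * b → ∃₂ λ c e → c * c + e * e ≡ 1ℤ × x ≡ c * a + e * b × y ≡ e * a - c * b
  quotient-unit x y p≡x²+y² (divides c xa-yb≡) = conclude (Sum.reduce (euclid u u p∣u²))
    where
    u : ℤ
    u = x * b + y * a
    P : ℤ
    P = + p
    brahmagupta : ∀ a b x y → (x * x + y * y) * (a * a + b * b) ≡ (x * a - y * b) * (x * a - y * b) + (x * b + y * a) * (x * b + y * a)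
    brahmagupta = solve-∀
    P²≡ : P * P ≡ c * P * (c * P) + u * u
    P²≡ = begin
      P * P                                                  ≡⟨ cong₂ _*_ p≡x²+y² p≡a²+b² ⟩
      (x * x + y * y) * (a * a + b * b)                      ≡⟨ brahmagupta a b x y ⟩
      (x * a - y * b) * (x * a - y * b) + u * u              ≡⟨ cong (λ z → z * z + u * u) xa-yb≡ ⟩
      c * P * (c * P) + u * u                                ∎
    p∣u² : P ∣ u * u
    p∣u² = divides (P - c * (c * P)) (begin
      u * u                                                  ≡⟨ isolate (u * u) (c * P) ⟩
      c * P * (c * P) + u * u - c * P * (c * P)              ≡⟨ cong (_- c * P * (c * P)) P²≡ ⟨
      P * P - c * P * (c * P)                                ≡⟨ regroup c P ⟩
      (P - c * (c * P)) * P                                  ∎)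
      where
      isolate : ∀ v w → v ≡ w * w + v - w * w
      isolate = solve-∀
      regroup : ∀ c P → P * P - c * P * (c * P) ≡ (P - c * (c * P)) * P
      regroup = solve-∀
    conclude : P ∣ u → ∃₂ λ c e → c * c + e * e ≡ 1ℤ × x ≡ c * a + e * b × y ≡ e * a - c * b
    conclude (divides e u≡) = c , e ,
      *-cancelˡ-≡ (P) (c * c + e * e) 1ℤ (*-cancelˡ-≡ P (P * (c * c + e * e)) (P * 1ℤ) (begin
        P * (P * (c * c + e * e))               ≡⟨ regroup P c e ⟩
        c * P * (c * P) + e * P * (e * P)       ≡⟨ cong (λ z → c * P * (c * P) + z * z) u≡ ⟨
        c * P * (c * P) + u * u                 ≡⟨ P²≡ ⟨
        P * P                                   ≡⟨ cong (P *_) (*-identityʳ P) ⟨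
        P * (P * 1ℤ)                            ∎)) ,
      *-cancelˡ-≡ P x (c * a + e * b) (begin
        P * x                                   ≡⟨ cong (_* x) p≡a²+b² ⟩
        (a * a + b * b) * x                     ≡⟨ solve-x a b x y ⟩
        (x * a - y * b) * a + u * b             ≡⟨ cong₂ (λ v w → v * a + w * b) xa-yb≡ u≡ ⟩
        c * P * a + e * P * b                   ≡⟨ collect c e P a b ⟩
        P * (c * a + e * b)                     ∎) ,
      *-cancelˡ-≡ P y (e * a - c * b) (begin
        P * y                                   ≡⟨ cong (_* y) p≡a²+b² ⟩
        (a * a + b * b) * y                     ≡⟨ solve-y a b x y ⟩
        u * a - (x * a - y * b) * b             ≡⟨ cong₂ (λ v w → w * a - v * b) xa-yb≡ u≡ ⟩
        e * P * a - c * P * b                   ≡⟨ collect′ c e P a b ⟩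
        P * (e * a - c * b)                     ∎)
      where
      regroup : ∀ P c e → P * (P * (c * c + e * e)) ≡ c * P * (c * P) + e * P * (e * P)
      regroup = solve-∀
      solve-x : ∀ a b x y → (a * a + b * b) * x ≡ (x * a - y * b) * a + (x * b + y * a) * b
      solve-x = solve-∀
      solve-y : ∀ a b x y → (a * a + b * b) * y ≡ (x * b + y * a) * a - (x * a - y * b) * b
      solve-y = solve-∀
      collect : ∀ c e P a b → c * P * a + e * P * b ≡ P * (c * a + e * b)
      collect = solve-∀
      collect′ : ∀ c e P a b → e * P * a - c * P * b ≡ P * (e * a - c * b)
      collect′ = solve-∀

data GaussianUnit : ℤ → ℤ → Set where
  unit-1  : GaussianUnit 1ℤ 0ℤ
  unit--1 : GaussianUnit -1ℤ 0ℤ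
  unit-i  : GaussianUnit 0ℤ 1ℤ
  unit--i : GaussianUnit 0ℤ -1ℤ

gaussianUnit : ∀ c e → c * c + e * e ≡ 1ℤ → GaussianUnit c e
gaussianUnit c e c²+e²≡1 = from-abs c e (∣ c ∣) (∣ e ∣) refl refl (+-injective (trans (sym sum≡) c²+e²≡1))
  where
  sum≡ : c * c + e * e ≡ + (∣ c ∣ ℕ.* ∣ c ∣ ℕ.+ ∣ e ∣ ℕ.* ∣ e ∣)
  sum≡ = trans (cong₂ _+_ (square-abs c) (square-abs e)) (sym (pos-+ (∣ c ∣ ℕ.* ∣ c ∣) (∣ e ∣ ℕ.* ∣ e ∣)))
  from-abs : ∀ c e m n → ∣ c ∣ ≡ m → ∣ e ∣ ≡ n → m ℕ.* m ℕ.+ n ℕ.* n ≡ 1 → GaussianUnit c e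
  from-abs (+ 0)    (+ 1)    0 1 refl refl _ = unit-i
  from-abs (+ 0)    -[1+ 0 ] 0 1 refl refl _ = unit--i
  from-abs (+ 1)    (+ 0)    1 0 refl refl _ = unit-1
  from-abs -[1+ 0 ] (+ 0)    1 0 refl refl _ = unit--1
  from-abs _ _ 0 0 _ _ ()
  from-abs _ _ 0 (suc (suc _)) _ _ ()
  from-abs _ _ 1 (suc _) _ _ ()
  from-abs _ _ (suc (suc _)) _ _ _ ()

±3-neg : ∀ {x} → Is8m±3 x → Is8m±3 (- x)
±3-neg (m , inj₁ refl) = - m , inj₂ (identity m)
  where
  identity : ∀ m → - (+ 8 * m + + 3) ≡ + 8 * - m - + 3
  identity = solve-∀
±3-neg (m , inj₂ refl) = - m , inj₁ (identity m)
  where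
  identity : ∀ m → - (+ 8 * m - + 3) ≡ + 8 * - m + + 3
  identity = solve-∀

-- The sum and the difference of the coordinates of (c + ie)(a - ib) are among ±(a + b), ±(a - b).
±3-associate : ∀ {c e} a b → GaussianUnit c e → Is8m±3 (a + b) → Is8m±3 (a - b) →
  Is8m±3 (c * a + e * b + (e * a - c * b)) × Is8m±3 (c * a + e * b - (e * a - c * b))
±3-associate a b unit-1 a+b≡±3 a-b≡±3 = subst Is8m±3 (identity a b) a-b≡±3 , subst Is8m±3 (identity′ a b) a+b≡±3
  where
  identity : ∀ a b → a - b ≡ 1ℤ * a + 0ℤ * b + (0ℤ * a - 1ℤ * b)
  identity = solve-∀
  identity′ : ∀ a b → a + b ≡ 1ℤ * a + 0ℤ * b - (0ℤ * a - 1ℤ * b)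
  identity′ = solve-∀
±3-associate a b unit--1 a+b≡±3 a-b≡±3 = subst Is8m±3 (identity a b) (±3-neg a-b≡±3) , subst Is8m±3 (identity′ a b) (±3-neg a+b≡±3)
  where
  identity : ∀ a b → - (a - b) ≡ -1ℤ * a + 0ℤ * b + (0ℤ * a - -1ℤ * b)
  identity = solve-∀
  identity′ : ∀ a b → - (a + b) ≡ -1ℤ * a + 0ℤ * b - (0ℤ * a - -1ℤ * b)
  identity′ = solve-∀
±3-associate a b unit-i a+b≡±3 a-b≡±3 = subst Is8m±3 (identity a b) a+b≡±3 , subst Is8m±3 (identity′ a b) (±3-neg a-b≡±3)
  where
  identity : ∀ a b → a + b ≡ 0ℤ * a + 1ℤ * b + (1ℤ * a - 0ℤ * b)
  identity = solve-∀
  identity′ : ∀ a b → - (a - b) ≡ 0ℤ * a + 1ℤ * b - (1ℤ * a - 0ℤ * b)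
  identity′ = solve-∀
±3-associate a b unit--i a+b≡±3 a-b≡±3 = subst Is8m±3 (identity a b) (±3-neg a+b≡±3) , subst Is8m±3 (identity′ a b) a-b≡±3
  where
  identity : ∀ a b → - (a + b) ≡ 0ℤ * a + -1ℤ * b + (-1ℤ * a - 0ℤ * b)
  identity = solve-∀
  identity′ : ∀ a b → a - b ≡ 0ℤ * a + -1ℤ * b - (-1ℤ * a - 0ℤ * b)
  identity′ = solve-∀

-- The prime p divides (xa - yb)(xa + yb). If it divides the first factor, x + iy is an associate of
-- a - ib; the second case reduces to the first by b ↦ -b, which merely exchanges a + b and a - b.
±3-unique : ∀ {p} (pr : Prime p) a b x y → + p ≡ a * a + b * b → + p ≡ x * x + y * y →
  Is8m±3 (a + b) → Is8m±3 (a - b) → Is8m±3 (x + y) × Is8m±3 (x - y)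
±3-unique {p} pr a b x y p≡a²+b² p≡x²+y² a+b≡±3 a-b≡±3 = Sum.[ first , second ] (euclid (x * a - y * b) (x * a + y * b) p∣)
  where
  open PrimeModulus pr
  p∣ : + p ∣ (x * a - y * b) * (x * a + y * b)
  p∣ = divides (a * a - y * y) (begin
    (x * a - y * b) * (x * a + y * b)                                ≡⟨ expand a b x y ⟩
    a * a * (x * x + y * y) - y * y * (a * a + b * b)                ≡⟨ cong₂ (λ v w → a * a * v - y * y * w) p≡x²+y² p≡a²+b² ⟨
    a * a * + p - y * y * + p                                        ≡⟨ collect (a * a) (y * y) (+ p) ⟩
    (a * a - y * y) * + p                                            ∎)
    where
    expand : ∀ a b x y → (x * a - y * b) * (x * a + y * b) ≡ a * a * (x * x + y * y) - y * y * (a * a + b * b)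
    expand = solve-∀
    collect : ∀ v w p → v * p - w * p ≡ (v - w) * p
    collect = solve-∀
  transport : ∀ a b → Is8m±3 (a + b) → Is8m±3 (a - b) →
    (∃₂ λ c e → c * c + e * e ≡ 1ℤ × x ≡ c * a + e * b × y ≡ e * a - c * b) → Is8m±3 (x + y) × Is8m±3 (x - y)
  transport a b a+b≡±3 a-b≡±3 (c , e , unit , x≡ , y≡) = subst₂ (λ x y → Is8m±3 (x + y) × Is8m±3 (x - y)) (sym x≡) (sym y≡)
    (±3-associate a b (gaussianUnit c e unit) a+b≡±3 a-b≡±3)
  first : + p ∣ x * a - y * b → Is8m±3 (x + y) × Is8m±3 (x - y)
  first p∣ = transport a b a+b≡±3 a-b≡±3 (quotient-unit pr a b p≡a²+b² x y p≡x²+y² p∣)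
  second : + p ∣ x * a + y * b → Is8m±3 (x + y) × Is8m±3 (x - y)
  second p∣ = transport a (- b) a-b≡±3 (subst Is8m±3 (negate a b) a+b≡±3)
    (quotient-unit pr a (- b) (trans p≡a²+b² (square-neg a b)) x y p≡x²+y² (subst (+ p ∣_) (negate-y a b x y) p∣))
    where
    negate : ∀ a b → a + b ≡ a - - b
    negate = solve-∀
    square-neg : ∀ a b → a * a + b * b ≡ a * a + - b * - b
    square-neg = solve-∀
    negate-y : ∀ a b x y → x * a + y * b ≡ x * a - y * - b
    negate-y = solve-∀

-- Here (p - 1)/2 = 4(w + 1) is a multiple of 4 and r⁴ ≡ 1, so r satisfies Euler's criterion. A
-- square root t of r then has t⁴ ≡ r² ≡ -1.
quartic-root : ∀ w (pr : Prime (9 ℕ.+ w ℕ.* 8)) r → let open PrimeModulus pr in r * r ≈ -1ℤ → ∃ λ t → + (9 ℕ.+ w ℕ.* 8) ∣ t * t * (t * t) + 1ℤ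
quartic-root w pr r r²≈-1 = conclude (euler-criterion {m = 6 ℕ.+ w ℕ.* 8} pr r (4 ℕ.* suc w) (p-1≡2h w) p∤r r^h≈1)
  where
  open PrimeModulus pr
  p-1≡2h : ∀ w → 8 ℕ.+ w ℕ.* 8 ≡ 4 ℕ.* suc w ℕ.+ 4 ℕ.* suc w
  p-1≡2h = ℕ-solve-∀
  p∤r : ¬ + (9 ℕ.+ w ℕ.* 8) ∣ r
  p∤r p∣r = p∤1 (≈0⇒∣ (≈-trans (≈-sym (*-cong r²≈-1 (≈-refl { -1ℤ }))) (∣⇒≈0 (∣m⇒∣m*n -1ℤ (∣m⇒∣m*n r p∣r)))))
  r⁴≈1 : r ^ 4 ≈ 1ℤ
  r⁴≈1 = ≈-trans (≈-reflexive (regroup r)) (*-cong r²≈-1 r²≈-1)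
    where
    regroup : ∀ r → r * (r * (r * (r * 1ℤ))) ≡ r * r * (r * r)
    regroup = solve-∀
  r^h≈1 : r ^ (4 ℕ.* suc w) ≈ 1ℤ
  r^h≈1 = ≈-trans (≈-reflexive (sym (^-*-assoc r 4 (suc w)))) (≈-trans (^-cong (suc w) r⁴≈1) (≈-reflexive (^-zeroˡ (suc w))))
  conclude : (∃ λ t → t * t ≈ r) → ∃ λ t → + (9 ℕ.+ w ℕ.* 8) ∣ t * t * (t * t) + 1ℤ
  conclude (t , t²≈r) = t , difference (≈-trans (*-cong t²≈r t²≈r) r²≈-1)

prime-norm : ∀ {p} → Prime p → ∀ a b → + p ≡ a * a + b * b → p % 8 ≡ 1 → ∃ λ α → norm α ≡ + p
prime-norm {p} pr a b p≡a²+b² p%8≡1 = from-quotient (p / 8) (trans (m≡m%n+[m/n]*n p 8) (cong (ℕ._+ p / 8 ℕ.* 8) p%8≡1))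
  where
  from-quotient : ∀ w → p ≡ 1 ℕ.+ w ℕ.* 8 → ∃ λ α → norm α ≡ + p
  from-quotient zero    p≡1 = contradiction (subst Prime p≡1 pr) ¬prime[1]
  from-quotient (suc w) p≡  = descend (SmallNorm.small-norm pr (proj₁ root-1) (proj₂ root-1))
    where
    root-1 : ∃ λ t → + p ∣ t * t * (t * t) + 1ℤ
    root-1 = lift p≡ pr (imaginary-unit pr a b p≡a²+b²)
      where
      lift : ∀ {p} → p ≡ 9 ℕ.+ w ℕ.* 8 → (pr : Prime p) → (∃ λ r → PrimeModulus._≈_ pr (r * r) -1ℤ) → ∃ λ t → + p ∣ t * t * (t * t) + 1ℤ
      lift refl pr (r , r²≈-1) = quartic-root w pr r r²≈-1
    descend : (∃₂ λ α k → 0 ℕ.< k × k ℕ.< 16 × norm α ≡ + k * + p) → ∃ λ α → norm α ≡ + p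
    descend (α , k , 0<k , k<16 , norm≡kp) =
      norm-descent p (suc w) (trans p≡ (cong suc (ℕ.*-comm (suc w) 8))) k k α ℕ.≤-refl 0<k k<16 norm≡kp

-- The three classes of primes

+p≡p%8+8q : ∀ p → + p ≡ + (p % 8) + + 8 * + (p / 8)
+p≡p%8+8q p = trans (cong +_ (m≡m%n+[m/n]*n p 8)) (trans (pos-+ (p % 8) (p / 8 ℕ.* 8))
  (cong (λ x → + (p % 8) + x) (trans (pos-* (p / 8) 8) (*-comm (+ (p / 8)) (+ 8)))))

5mod8∈S16 : ∀ p → Prime p → p % 8 ≡ 5 → InS16 (+ 64 * + p)
5mod8∈S16 p pr p%8≡5 = conclude (sum-of-squares pr p%8≡5)
  where
  conclude : (∃₂ λ x y → x * x + y * y ≡ + p) → InS16 (+ 64 * + p)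
  -- `x - y` and `x + y` are the coordinates of (1 + i)(x + iy), whose norm is 2p = 10 + 16(p / 8).
  conclude (x , y , x²+y²≡p) = subst InS16 (trans (cong (+ 32 *_) twice) (double (+ p)))
    (twice-5mod8∈S16 (x - y) (x + y) (divides (+ (p / 8)) (trans (cong (_- + 10) (trans twice (cong (+ 2 *_) +p≡))) (collect (+ (p / 8))))))
    where
    +p≡ : + p ≡ + 5 + + 8 * + (p / 8)
    +p≡ = trans (+p≡p%8+8q p) (cong (λ r → + r + + 8 * + (p / 8)) p%8≡5)
    parallelogram : ∀ x y → (x - y) * (x - y) + (x + y) * (x + y) ≡ + 2 * (x * x + y * y)
    parallelogram = solve-∀
    twice : (x - y) * (x - y) + (x + y) * (x + y) ≡ + 2 * + p
    twice = trans (parallelogram x y) (cong (+ 2 *_) x²+y²≡p)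
    double : ∀ p → + 32 * (+ 2 * p) ≡ + 64 * p
    double = solve-∀
    collect : ∀ q → + 2 * (+ 5 + + 8 * q) - + 10 ≡ q * + 16
    collect = solve-∀

-- The relative norm of x + y√-2 to ℤ[i] is the rational integer p. Hence A + B and A - B both equal
-- p ≡ 3 (mod 8), and the absolute norm is p².
3mod8∈S16 : ∀ p → Prime p → p % 8 ≡ 3 → InS16 (+ 64 * (+ p * + p))
3mod8∈S16 p pr p%8≡3 = conclude (square-plus-twice-square pr p%8≡3)
  where
  -- α = x + y√-2 with √-2 = ζ + ζ³
  conclude : (∃₂ λ x y → x * x + + 2 * (y * y) ≡ + p) → InS16 (+ 64 * (+ p * + p))
  conclude (x , y , x²+2y²≡p) = subst InS16 (cong (+ 64 *_) norm≡)
    (64*norm∈S16 α (+ (p / 8) , inj₁ (trans (cong₂ _+_ re≡ im≡) (identity (+ (p / 8))))) (+ (p / 8) , inj₁ (trans (cong₂ _-_ re≡ im≡) (identity (+ (p / 8))))))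
    where
    α : ℤ[ζ]
    α = ⟨ x , y , 0ℤ , y ⟩
    +p≡ : + p ≡ + 3 + + 8 * + (p / 8)
    +p≡ = trans (+p≡p%8+8q p) (cong (λ r → + r + + 8 * + (p / 8)) p%8≡3)
    re-≡ : ∀ x y → x * x - 0ℤ * 0ℤ + + 2 * (y * y) ≡ x * x + + 2 * (y * y)
    re-≡ = solve-∀
    im-≡ : ∀ x y → + 2 * (x * 0ℤ) - y * y + y * y ≡ 0ℤ
    im-≡ = solve-∀
    re≡p : re α ≡ + p
    re≡p = trans (re-≡ x y) x²+2y²≡p
    re≡ : re α ≡ + 3 + + 8 * + (p / 8)
    re≡ = trans re≡p +p≡
    im≡ : im α ≡ 0ℤ
    im≡ = im-≡ x y
    identity : ∀ q → + 3 + + 8 * q + 0ℤ ≡ + 8 * q + + 3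
    identity = solve-∀
    norm≡ : norm α ≡ + p * + p
    norm≡ = trans (cong₂ (λ r i → r * r + i * i) re≡p im≡) (+-identityʳ (+ p * + p))

1mod8∈S16 : ∀ p a b → Prime p → + p ≡ a * a + b * b → p % 8 ≡ 1 → Is8m±3 (a + b) → Is8m±3 (a - b) → InS16 (+ 64 * + p)
1mod8∈S16 p a b pr p≡a²+b² p%8≡1 a+b≡±3 a-b≡±3 = conclude (prime-norm pr a b p≡a²+b² p%8≡1)
  where
  conclude : (∃ λ α → norm α ≡ + p) → InS16 (+ 64 * + p)
  conclude (α , norm≡p) = subst InS16 (cong (+ 64 *_) norm≡p) (64*norm∈S16 α (proj₁ ±3) (proj₂ ±3))
    where
    ±3 : Is8m±3 (re α + im α) × Is8m±3 (re α - im α)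
    ±3 = ±3-unique pr a b (re α) (im α) p≡a²+b² (sym norm≡p) a+b≡±3 a-b≡±3

theorem5p1 : ((p : ℕ) → Prime p → p % 8 ≡ 5 → InS16 (+ 64 * + p))
    × ((p : ℕ) → Prime p → p % 8 ≡ 3 → InS16 (+ 64 * (+ p * + p)))
    × ((p : ℕ) (a b : ℤ) → Prime p → + p ≡ a * a + b * b → p % 8 ≡ 1
    → Is8m±3 (a + b) → Is8m±3 (a - b) → InS16 (+ 64 * + p))
theorem5p1 = 5mod8∈S16 , 3mod8∈S16 , 1mod8∈S16
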